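{- Let $n\ge 1$ and $0\le m\le n$ be integers, and let $r_1>r_2>\cdots>r_m\ge 0$ and $s_{m+1}>\cdots>s_n\ge 0$ be sequences of non-negative integers such that $-r_j-\tfrac12\ne s_k+\tfrac12$ for all $1\le j\le m$ and $m+1\le k\le n$. Put $\mathbf r=(r_1,\dots,r_m)$, $\mathbf s=(s_{m+1},\dots,s_n)$, $r=\sum_{k=1}^m r_k$, $s=\sum_{k=m+1}^n s_k$, and let $G_{\mathbf r,\mathbf s}(q)$ be the coefficient of $t_1^{r_1+\frac12}\cdots t_m^{r_m+\frac12}\,t_{m+1}^{ -s_{m+1}-\frac12}\cdots t_n^{ -s_n-\frac12}$ in $F(t_1,\dots,t_n)$. Then, as $y\to0^+$, $$G_{\mathbf r,\mathbf s}\left(e^{ -2\pi y}\right)=\frac1{2^n}\left(1-\pi\left(r-s+m+\frac{n(n-3)}4\right)y+O\left(y^2\right)\right).$$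
   Context: Fermionic Fock space: let $\psi(k+\tfrac12),\psi^*(k+\tfrac12)$, $k\in\mathbb Z$, satisfy $[\psi^*(\ell+\tfrac12),\psi(k+\tfrac12)]_+=\delta_{\ell+k+1,0}$ for $\ell,k\in\mathbb{Z}$, all other anticommutators being zero. $\mathcal F$ is the complex vector space generated from a vacuum vector $\mathbf 1$, annihilated by all $\psi(k+\tfrac12)$ and $\psi^*(k+\tfrac12)$ with $k\ge 0$, with basis the monomials $\psi(-n_a-\tfrac12)\cdots\psi(-n_1-\tfrac12)\psi^*(-m_b-\tfrac12)\cdots\psi^*(-m_1-\tfrac12)\mathbf 1$, where $n_a>\cdots>n_1\ge0$ and $m_b>\cdots>m_1\ge 0$. Such a monomial has charge $a-b$ and is an eigenvector of $L(0)$ with eigenvalue $\sum_i(n_i+\tfrac12)+\sum_i(m_i+\tfrac12)$. $\mathcal F_0$ is the span of the monomials of charge $0$. Let $A(t)=\sum_{\ell\in\mathbb Z}\psi^*(\ell+\tfrac12)\psi(-\ell-\tfrac12)\,t^{ -\ell-\frac12}$, and define the Bloch-Okounkov $n$-point function (a formal series in the $t_j$, whose coefficients are power series in $q=e^{2\pi i\tau}$, $|q|<1$) by $$F(t_1,\dots,t_n)=\eta(\tau)\,\mathrm{tr}_{\mathcal F_0}A(t_1)\cdots A(t_n)\,q^{L(0)-\frac1{24}},\qquad \eta(\tau)=q^{\frac1{24}}\prod_{m\ge1}(1-q^m).$$ -}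

module Defs where

open import Data.Bool using (if_then_else_; _∧_)
import Data.Fin as Fin
open import Data.Integer using (ℤ; +_; -[1+_])
import Data.Integer as ℤ
import Data.Integer.Properties as ℤP
open import Data.List using (List; []; _∷_; _++_; map; foldr; length; filter; cartesianProductWith; concatMap)
open import Data.List.Properties using (≡-dec)
open import Data.List.Relation.Unary.All as All using (All; []; _∷_)
import Data.List.Relation.Unary.All.Properties as AllP
open import Data.List.Relation.Unary.AllPairs using (AllPairs; []; _∷_)
import Data.List.Relation.Unary.AllPairs.Properties as AllPairsP
open import Data.Nat using (ℕ; zero; suc)
import Data.Nat as ℕ
open import Data.Nat.ListAction using (sum)
import Data.Nat.Properties as ℕP
import Data.Nat.Solver as ℕS
open import Data.List.Membership.DecPropositional ℕP._≟_ using (_∈?_)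
open import Data.Product using (Σ-syntax; _×_; _,_; proj₁; proj₂)
open import Data.Rational using (ℚ; mkℚ; 0ℚ; 1ℚ; ½; _/_)
import Data.Rational as ℚ
import Data.Rational.Properties as ℚP
import Data.Rational.Solver as ℚS
open import Data.Rational.Unnormalised using (mkℚᵘ)
import Data.Rational.Unnormalised as ℚᵘ
import Data.Rational.Unnormalised.Properties as ℚᵘP
open import Data.Sum using (inj₁; inj₂)
open import Data.Vec.Functional using (Vector)
import Data.Vec.Functional as Vector
open import Relation.Binary.PropositionalEquality
  using (_≡_; refl; sym; trans; cong; cong₂; subst; subst₂)
open import Relation.Nullary using (yes; no; does; ¬?)
open import Relation.Nullary.Decidable using (_×-dec_)

opaque

  /-≤ : ∀ a b m n → a ℕ.* suc n ℕ.≤ b ℕ.* suc m → + a / suc m ℚ.≤ + b / suc n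
  /-≤ a b m n h = ℚP.toℚᵘ-cancel-≤
    (ℚᵘP.≤-trans (ℚᵘP.≤-reflexive (ℚP.toℚᵘ-fromℚᵘ (mkℚᵘ (+ a) m)))
    (ℚᵘP.≤-trans
      (ℚᵘ.*≤* (subst₂ ℤ._≤_ (ℤP.pos-* a (suc n)) (ℤP.pos-* b (suc m)) (ℤ.+≤+ h)))
      (ℚᵘP.≤-reflexive (ℚᵘP.≃-sym (ℚP.toℚᵘ-fromℚᵘ (mkℚᵘ (+ b) n))))))

  /-* : ∀ a k → (+ a / 1) ℚ.* (+ 1 / suc k) ≡ + a / suc k
  /-* a k = ℚP.toℚᵘ-injective
    (ℚᵘP.≃-trans (ℚP.toℚᵘ-homo-* (+ a / 1) (+ 1 / suc k))
    (ℚᵘP.≃-trans (ℚᵘP.*-cong (ℚP.toℚᵘ-fromℚᵘ (mkℚᵘ (+ a) 0)) (ℚP.toℚᵘ-fromℚᵘ (mkℚᵘ (+ 1) k)))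
    (ℚᵘP.≃-trans (ℚᵘ.*≡* (cong₂ ℤ._*_ (ℤP.*-identityʳ (+ a)) (cong +_ (sym (ℕP.+-identityʳ (suc k))))))
      (ℚᵘP.≃-sym (ℚP.toℚᵘ-fromℚᵘ (mkℚᵘ (+ a) k))))))

  0≤/ : ∀ a k → 0ℚ ℚ.≤ + a / suc k
  0≤/ a k = /-≤ 0 a 0 k ℕ.z≤n

  ∣p∣≤ℕ : ∀ p → Σ[ b ∈ ℕ ] ℚ.∣ p ∣ ℚ.≤ + b / 1
  ∣p∣≤ℕ p@(mkℚ n d c) = ℤ.∣ n ∣ ,
    subst (ℚ._≤ + ℤ.∣ n ∣ / 1) (ℚP.↥p/↧p≡p ℚ.∣ p ∣)
      (/-≤ ℤ.∣ n ∣ ℤ.∣ n ∣ d 0 (ℕP.*-monoʳ-≤ ℤ.∣ n ∣ (ℕ.s≤s ℕ.z≤n)))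

  archimedean : ∀ c ε → 0ℚ ℚ.< ε → Σ[ j ∈ ℕ ] + c / suc j ℚ.≤ ε
  archimedean c ε@(mkℚ (+ suc n) d _) _ = c ℕ.* suc d ,
    subst (+ c / suc (c ℕ.* suc d) ℚ.≤_) (ℚP.↥p/↧p≡p ε)
      (/-≤ c (suc n) (c ℕ.* suc d) d (ℕP.≤-trans (ℕP.n≤1+n _) (ℕP.m≤n*m (suc (c ℕ.* suc d)) (suc n))))
  archimedean c (mkℚ (+ zero) d _) (ℚ.*<* h) with subst (λ z → ℤ.0ℤ ℤ.< z) (ℤP.*-zeroˡ (+ 1)) h
  ... | ℤ.+<+ ()
  archimedean c (mkℚ -[1+ n ] d _) (ℚ.*<* ())

  *-mono : ∀ a b c d → 0ℚ ℚ.≤ a → 0ℚ ℚ.≤ d → a ℚ.≤ b → c ℚ.≤ d → a ℚ.* c ℚ.≤ b ℚ.* d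
  *-mono a b c d 0≤a 0≤d a≤b c≤d =
    ℚP.≤-trans (ℚP.*-monoˡ-≤-nonNeg a {{ℚ.nonNegative 0≤a}} c≤d)
               (ℚP.*-monoʳ-≤-nonNeg d {{ℚ.nonNegative 0≤d}} a≤b)

  halves : ∀ ε → ε ℚ.* ½ ℚ.+ ε ℚ.* ½ ≡ ε
  halves = solve 1 (λ e → e :* con ½ :+ e :* con ½ := e) refl
    where open ℚS.+-*-Solver

  0<* : ∀ a b → 0ℚ ℚ.< a → 0ℚ ℚ.< b → 0ℚ ℚ.< a ℚ.* b
  0<* a b p q = ℚP.positive⁻¹ (a ℚ.* b)
    {{ℚP.pos*pos⇒pos a {{ℚ.positive p}} b {{ℚ.positive q}}}}

  0<½ : 0ℚ ℚ.< ½
  0<½ = ℚP.positive⁻¹ ½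

  0<1/suc : ∀ k → 0ℚ ℚ.< + 1 / suc k
  0<1/suc k = ℚP.positive⁻¹ (+ 1 / suc k) {{ℚP.normalize-pos 1 (suc k)}}

  triangle : ∀ a b c → ℚ.∣ a ℚ.- c ∣ ℚ.≤ ℚ.∣ a ℚ.- b ∣ ℚ.+ ℚ.∣ b ℚ.- c ∣
  triangle a b c = subst (λ z → ℚ.∣ z ∣ ℚ.≤ ℚ.∣ a ℚ.- b ∣ ℚ.+ ℚ.∣ b ℚ.- c ∣)
    (solve 3 (λ a b c → (a :- b) :+ (b :- c) := a :- c) refl a b c)
    (ℚP.∣p+q∣≤∣p∣+∣q∣ (a ℚ.- b) (b ℚ.- c))
    where open ℚS.+-*-Solver

  ∣-∣-sym : ∀ a b → ℚ.∣ a ℚ.- b ∣ ≡ ℚ.∣ b ℚ.- a ∣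
  ∣-∣-sym a b = trans (sym (ℚP.∣-p∣≡∣p∣ (a ℚ.- b)))
    (cong ℚ.∣_∣ (solve 2 (λ a b → :- (a :- b) := b :- a) refl a b))
    where open ℚS.+-*-Solver

  halving : ∀ ε → 0ℚ ℚ.< ε → Σ[ h ∈ ℚ ] (0ℚ ℚ.< h × h ℚ.+ h ≡ ε)
  halving ε 0<ε = ε ℚ.* ½ , 0<* ε ½ 0<ε 0<½ , halves ε

Cauchy : (ℕ → ℚ) → Set
Cauchy x = ∀ ε → 0ℚ ℚ.< ε →
  Σ[ N ∈ ℕ ] (∀ m n → N ℕ.≤ m → N ℕ.≤ n → ℚ.∣ x m ℚ.- x n ∣ ℚ.≤ ε)

-- A real number is a Cauchy sequence of rationals; distinct sequences may have
-- the same limit, and ≤ and < depend on the limits only.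
record ℝ : Set where
  constructor mkℝ
  field
    seq    : ℕ → ℚ
    cauchy : Cauchy seq

open ℝ public

opaque

  Cauchy-const : ∀ p → Cauchy (λ _ → p)
  Cauchy-const p ε 0<ε = 0 , λ _ _ _ _ →
    subst (λ z → ℚ.∣ z ∣ ℚ.≤ ε) (sym (ℚP.+-inverseʳ p)) (ℚP.<⇒≤ 0<ε)

  Cauchy-+ : ∀ x y → Cauchy x → Cauchy y → Cauchy (λ n → x n ℚ.+ y n)
  Cauchy-+ x y cx cy ε 0<ε with cx (ε ℚ.* ½) (0<* ε ½ 0<ε 0<½) | cy (ε ℚ.* ½) (0<* ε ½ 0<ε 0<½)
  ... | N , hN | M , hM = N ℕ.+ M , λ m n p q → subst₂ ℚ._≤_
    (cong ℚ.∣_∣ (solve 4 (λ a b c d → (a :- c) :+ (b :- d) := (a :+ b) :- (c :+ d)) refl (x m) (y m) (x n) (y n)))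
    (halves ε)
    (ℚP.≤-trans (ℚP.∣p+q∣≤∣p∣+∣q∣ (x m ℚ.- x n) (y m ℚ.- y n))
      (ℚP.+-mono-≤ (hN m n (ℕP.m+n≤o⇒m≤o N p) (ℕP.m+n≤o⇒m≤o N q))
                   (hM m n (ℕP.m+n≤o⇒n≤o N p) (ℕP.m+n≤o⇒n≤o N q))))
    where open ℚS.+-*-Solver

  Cauchy-neg : ∀ x → Cauchy x → Cauchy (λ n → ℚ.- x n)
  Cauchy-neg x cx ε 0<ε with cx ε 0<ε
  ... | N , hN = N , λ m n p q → subst (ℚ._≤ ε)
    (trans (sym (ℚP.∣-p∣≡∣p∣ (x m ℚ.- x n)))
      (cong ℚ.∣_∣ (solve 2 (λ a b → :- (a :- b) := (:- a) :- (:- b)) refl (x m) (x n))))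
    (hN m n p q)
    where open ℚS.+-*-Solver

  bounded-below : ∀ (x : ℕ → ℚ) N → Σ[ b ∈ ℕ ] (∀ n → n ℕ.< N → ℚ.∣ x n ∣ ℚ.≤ + b / 1)
  bounded-below x zero = 0 , λ n ()
  bounded-below x (suc N) with bounded-below x N | ∣p∣≤ℕ (x N)
  ... | b , hb | c , hc = b ℕ.+ c , go
    where
    go : ∀ n → n ℕ.< suc N → ℚ.∣ x n ∣ ℚ.≤ + (b ℕ.+ c) / 1
    go n (ℕ.s≤s n≤N) with ℕP.m≤n⇒m<n∨m≡n n≤N
    ... | inj₁ n<N  = ℚP.≤-trans (hb n n<N) (/-≤ b (b ℕ.+ c) 0 0 (ℕP.*-monoˡ-≤ 1 (ℕP.m≤m+n b c)))
    ... | inj₂ refl = ℚP.≤-trans hc (/-≤ c (b ℕ.+ c) 0 0 (ℕP.*-monoˡ-≤ 1 (ℕP.m≤n+m c b)))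

  bounded : ∀ x → Cauchy x → Σ[ b ∈ ℕ ] (∀ n → ℚ.∣ x n ∣ ℚ.≤ + suc b / 1)
  bounded x cx with cx 1ℚ (ℚP.positive⁻¹ 1ℚ)
  ... | N , hN with bounded-below x N | ∣p∣≤ℕ (x N)
  ... | b , hb | c , hc = b ℕ.+ c , go
    where
    open ℚS.+-*-Solver
    c+1 : + c / 1 ℚ.+ 1ℚ ≡ + suc c / 1
    c+1 = ℚP.toℚᵘ-injective
      (ℚᵘP.≃-trans (ℚP.toℚᵘ-homo-+ (+ c / 1) 1ℚ)
      (ℚᵘP.≃-trans (ℚᵘP.+-congˡ (mkℚᵘ (+ 1) 0) (ℚP.toℚᵘ-fromℚᵘ (mkℚᵘ (+ c) 0)))
      (ℚᵘP.≃-trans (ℚᵘ.*≡* (cong (ℤ._* + 1) (trans (cong (ℤ._+ + 1) (ℤP.*-identityʳ (+ c))) (cong +_ (ℕP.+-comm c 1)))))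
        (ℚᵘP.≃-sym (ℚP.toℚᵘ-fromℚᵘ (mkℚᵘ (+ suc c) 0))))))
    go : ∀ n → ℚ.∣ x n ∣ ℚ.≤ + suc (b ℕ.+ c) / 1
    go n with n ℕP.<? N
    ... | yes n<N = ℚP.≤-trans (hb n n<N) (/-≤ b (suc (b ℕ.+ c)) 0 0 (ℕP.*-monoˡ-≤ 1 (ℕP.m≤n⇒m≤1+n (ℕP.m≤m+n b c))))
    ... | no  n≮N = ℚP.≤-trans
      (subst (λ z → ℚ.∣ z ∣ ℚ.≤ ℚ.∣ x N ∣ ℚ.+ ℚ.∣ x n ℚ.- x N ∣)
        (solve 2 (λ a b → a :+ (b :- a) := b) refl (x N) (x n))
        (ℚP.∣p+q∣≤∣p∣+∣q∣ (x N) (x n ℚ.- x N)))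
      (ℚP.≤-trans (ℚP.+-mono-≤ hc (hN n N (ℕP.≮⇒≥ n≮N) ℕP.≤-refl))
        (subst (ℚ._≤ + suc (b ℕ.+ c) / 1) (sym c+1)
          (/-≤ (suc c) (suc (b ℕ.+ c)) 0 0 (ℕP.*-monoˡ-≤ 1 (ℕ.s≤s (ℕP.m≤n+m c b))))))

  Cauchy-* : ∀ x y → Cauchy x → Cauchy y → Cauchy (λ n → x n ℚ.* y n)
  Cauchy-* x y cx cy ε 0<ε with bounded x cx | bounded y cy
  ... | b , hb | c , hc with cx (ε ℚ.* ½ ℚ.* (+ 1 / suc c)) (0<* (ε ℚ.* ½) (+ 1 / suc c) (0<* ε ½ 0<ε 0<½) (0<1/suc c))
                           | cy (ε ℚ.* ½ ℚ.* (+ 1 / suc b)) (0<* (ε ℚ.* ½) (+ 1 / suc b) (0<* ε ½ 0<ε 0<½) (0<1/suc b))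
  ... | N , hN | M , hM = N ℕ.+ M , λ m n p q → subst₂ ℚ._≤_
    (cong ℚ.∣_∣ (solve 4 (λ a b c d → a :* (b :- d) :+ d :* (a :- c) := a :* b :- c :* d) refl (x m) (y m) (x n) (y n)))
    (halves ε)
    (ℚP.≤-trans (ℚP.∣p+q∣≤∣p∣+∣q∣ (x m ℚ.* (y m ℚ.- y n)) (y n ℚ.* (x m ℚ.- x n)))
      (ℚP.+-mono-≤ (piece b (x m) (y m ℚ.- y n) (hb m) (hM m n (ℕP.m+n≤o⇒n≤o N p) (ℕP.m+n≤o⇒n≤o N q)))
                   (piece c (y n) (x m ℚ.- x n) (hc n) (hN m n (ℕP.m+n≤o⇒m≤o N p) (ℕP.m+n≤o⇒m≤o N q)))))
    where
    open ℚS.+-*-Solver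
    piece : ∀ b u v → ℚ.∣ u ∣ ℚ.≤ + suc b / 1 → ℚ.∣ v ∣ ℚ.≤ ε ℚ.* ½ ℚ.* (+ 1 / suc b) →
            ℚ.∣ u ℚ.* v ∣ ℚ.≤ ε ℚ.* ½
    piece b u v hu hv = subst₂ ℚ._≤_ (sym (ℚP.∣p*q∣≡∣p∣*∣q∣ u v)) cancel
      (*-mono ℚ.∣ u ∣ (+ suc b / 1) ℚ.∣ v ∣ (ε ℚ.* ½ ℚ.* (+ 1 / suc b)) (ℚP.0≤∣p∣ u) (ℚP.≤-trans (ℚP.0≤∣p∣ v) hv) hu hv)
      where
      unit : (+ suc b / 1) ℚ.* (+ 1 / suc b) ≡ 1ℚ
      unit = trans (/-* (suc b) b) (ℚP.≤-antisym
        (/-≤ (suc b) 1 b 0 (ℕP.≤-reflexive (ℕP.*-comm (suc b) 1)))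
        (/-≤ 1 (suc b) 0 b (ℕP.≤-reflexive (ℕP.*-comm 1 (suc b)))))
      cancel : (+ suc b / 1) ℚ.* (ε ℚ.* ½ ℚ.* (+ 1 / suc b)) ≡ ε ℚ.* ½
      cancel = trans (solve 3 (λ B e i → B :* (e :* i) := e :* (B :* i)) refl (+ suc b / 1) (ε ℚ.* ½) (+ 1 / suc b))
        (trans (cong (ε ℚ.* ½ ℚ.*_) unit) (ℚP.*-identityʳ (ε ℚ.* ½)))

infixl 6 _+_ _-_
infixl 7 _*_
infix  8 -_
infixr 9 _^_
infix  4 _≤_ _<_

fromℚ : ℚ → ℝ
fromℚ p = mkℝ (λ _ → p) (Cauchy-const p)

0ℝ 1ℝ : ℝ
0ℝ = fromℚ 0ℚ
1ℝ = fromℚ 1ℚ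

_+_ _*_ : ℝ → ℝ → ℝ
x + y = mkℝ (λ n → seq x n ℚ.+ seq y n) (Cauchy-+ (seq x) (seq y) (cauchy x) (cauchy y))
x * y = mkℝ (λ n → seq x n ℚ.* seq y n) (Cauchy-* (seq x) (seq y) (cauchy x) (cauchy y))

-_ : ℝ → ℝ
- x = mkℝ (λ n → ℚ.- seq x n) (Cauchy-neg (seq x) (cauchy x))

_-_ : ℝ → ℝ → ℝ
x - y = x + (- y)

_^_ : ℝ → ℕ → ℝ
x ^ zero  = 1ℝ
x ^ suc n = x ^ n * x

_≤_ _<_ : ℝ → ℝ → Set
x ≤ y = ∀ ε → 0ℚ ℚ.< ε → Σ[ N ∈ ℕ ] (∀ n → N ℕ.≤ n → seq x n ℚ.≤ seq y n ℚ.+ ε)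
x < y = Σ[ ε ∈ ℚ ] (0ℚ ℚ.< ε × Σ[ N ∈ ℕ ] (∀ n → N ℕ.≤ n → seq x n ℚ.+ ε ℚ.≤ seq y n))

expTerm : ℚ → ℕ → ℚ
expTerm a zero    = 1ℚ
expTerm a (suc k) = expTerm a k ℚ.* a ℚ.* (+ 1 / suc k)

-- expPartial a n = Σ_{k<n} aᵏ/k!
expPartial : ℚ → ℕ → ℚ
expPartial a zero    = 0ℚ
expPartial a (suc n) = expPartial a n ℚ.+ expTerm a n

opaque

  Cauchy-expPartial : ∀ x → Cauchy x → ∀ p → Cauchy (λ n → expPartial (x n) p)
  Cauchy-expPartial x cx zero    = Cauchy-const 0ℚ
  Cauchy-expPartial x cx (suc p) =
    Cauchy-+ (λ n → expPartial (x n) p) (λ n → expTerm (x n) p) (Cauchy-expPartial x cx p) (term p)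
    where
    term : ∀ k → Cauchy (λ n → expTerm (x n) k)
    term zero    = Cauchy-const 1ℚ
    term (suc k) = Cauchy-* (λ n → expTerm (x n) k ℚ.* x n) (λ _ → + 1 / suc k)
      (Cauchy-* (λ n → expTerm (x n) k) x (term k) cx) (Cauchy-const (+ 1 / suc k))

module ExpTail (b : ℕ) (B : ℚ) (B≡b : B ≡ + b / 1) where

  K : ℕ
  K = b ℕ.+ b

  opaque

    0≤B : 0ℚ ℚ.≤ B
    0≤B = subst (0ℚ ℚ.≤_) (sym B≡b) (0≤/ b 0)

    0≤term : ∀ k → 0ℚ ℚ.≤ expTerm B k
    0≤term zero    = 0≤/ 1 0
    0≤term (suc k) = *0≤ (expTerm B k ℚ.* B) (+ 1 / suc k) (*0≤ (expTerm B k) B (0≤term k) 0≤B) (0≤/ 1 k)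
      where
      *0≤ : ∀ p q → 0ℚ ℚ.≤ p → 0ℚ ℚ.≤ q → 0ℚ ℚ.≤ p ℚ.* q
      *0≤ p q hp hq = subst (ℚ._≤ p ℚ.* q) (ℚP.*-zeroˡ q) (ℚP.*-monoʳ-≤-nonNeg q {{ℚ.nonNegative hq}} hp)

    term≤ : ∀ a → ℚ.∣ a ∣ ℚ.≤ B → ∀ k → ℚ.∣ expTerm a k ∣ ℚ.≤ expTerm B k
    term≤ a h zero    = ℚP.≤-refl
    term≤ a h (suc k) = subst (ℚ._≤ expTerm B (suc k))
      (sym (trans (ℚP.∣p*q∣≡∣p∣*∣q∣ (expTerm a k ℚ.* a) i)
        (cong₂ ℚ._*_ (ℚP.∣p*q∣≡∣p∣*∣q∣ (expTerm a k) a) (ℚP.0≤p⇒∣p∣≡p (0≤/ 1 k)))))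
      (ℚP.*-monoʳ-≤-nonNeg i {{ℚ.nonNegative (0≤/ 1 k)}}
        (*-mono ℚ.∣ expTerm a k ∣ (expTerm B k) ℚ.∣ a ∣ B (ℚP.0≤∣p∣ (expTerm a k)) 0≤B (term≤ a h k) h))
      where
      i : ℚ
      i = + 1 / suc k

    halve : ∀ k → b ℕ.+ b ℕ.≤ suc k → expTerm B (suc k) ℚ.≤ expTerm B k ℚ.* ½
    halve k h = subst (ℚ._≤ expTerm B k ℚ.* ½) (sym (ℚP.*-assoc (expTerm B k) B (+ 1 / suc k)))
      (ℚP.*-monoˡ-≤-nonNeg (expTerm B k) {{ℚ.nonNegative (0≤term k)}}
        (subst (ℚ._≤ ½) (sym (trans (cong (ℚ._* (+ 1 / suc k)) B≡b) (/-* b k)))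
          (/-≤ b 1 k 1 (subst₂ ℕ._≤_ (double b) (sym (ℕP.*-identityˡ (suc k))) h))))
      where
      double : ∀ b → b ℕ.+ b ≡ b ℕ.* 2
      double = solve 1 (λ b → b :+ b := b :* con 2) refl
        where open ℕS.+-*-Solver

    tail : ∀ a → ℚ.∣ a ∣ ℚ.≤ B → ∀ i k → b ℕ.+ b ℕ.≤ suc k →
           ℚ.∣ expPartial a (i ℕ.+ k) ℚ.- expPartial a k ∣ ℚ.≤ expTerm B k ℚ.+ expTerm B k
    tail a h zero    k hk = subst (λ z → ℚ.∣ z ∣ ℚ.≤ expTerm B k ℚ.+ expTerm B k)
      (sym (ℚP.+-inverseʳ (expPartial a k))) (ℚP.+-mono-≤ (0≤term k) (0≤term k))
    tail a h (suc i) k hk = ℚP.≤-trans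
      (triangle (expPartial a (suc i ℕ.+ k)) (expPartial a (suc k)) (expPartial a k))
      (ℚP.≤-trans (ℚP.+-mono-≤
          (subst (λ z → ℚ.∣ expPartial a z ℚ.- expPartial a (suc k) ∣ ℚ.≤ E' ℚ.+ E')
            (ℕP.+-suc i k) (tail a h i (suc k) (ℕP.m≤n⇒m≤1+n hk)))
          (subst (λ z → ℚ.∣ z ∣ ℚ.≤ E)
            (solve 2 (λ s t → t := (s :+ t) :- s) refl (expPartial a k) (expTerm a k)) (term≤ a h k)))
        (ℚP.+-monoˡ-≤ E (subst (E' ℚ.+ E' ℚ.≤_) (halves E) (ℚP.+-mono-≤ (halve k hk) (halve k hk)))))
      where
      open ℚS.+-*-Solver
      E E' : ℚ
      E  = expTerm B k
      E' = expTerm B (suc k)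

    decay : ∀ j → expTerm B (j ℕ.+ K) ℚ.≤ expTerm B K ℚ.* (+ 1 / suc j)
    decay zero    = ℚP.≤-reflexive (sym (ℚP.*-identityʳ (expTerm B K)))
    decay (suc j) = ℚP.≤-trans (halve (j ℕ.+ K) (ℕP.m≤n⇒m≤1+n (ℕP.m≤n+m K j)))
      (ℚP.≤-trans (ℚP.*-monoʳ-≤-nonNeg ½ (decay j))
        (subst (ℚ._≤ expTerm B K ℚ.* (+ 1 / suc (suc j))) (sym (ℚP.*-assoc (expTerm B K) (+ 1 / suc j) ½))
          (ℚP.*-monoˡ-≤-nonNeg (expTerm B K) {{ℚ.nonNegative (0≤term K)}} step)))
      where
      open ℚS.+-*-Solver
      i : ℚ
      i = + 1 / suc j
      i≤ : i ℚ.≤ + 2 / suc (suc j)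
      i≤ = /-≤ 1 2 j (suc j) (subst₂ ℕ._≤_ (sym (ℕP.*-identityˡ (suc (suc j)))) (ℕP.*-comm (suc j) 2) lem)
        where
        lem : suc (suc j) ℕ.≤ suc j ℕ.* 2
        lem = ℕ.s≤s (ℕ.s≤s (ℕP.m≤m*n j 2))
      step : i ℚ.* ½ ℚ.≤ + 1 / suc (suc j)
      step = ℚP.≤-trans (ℚP.*-monoʳ-≤-nonNeg ½ i≤)
        (ℚP.≤-reflexive (trans (cong (ℚ._* ½) (sym (/-* 2 (suc j))))
          (solve 1 (λ t → con (+ 2 / 1) :* t :* con ½ := t) refl (+ 1 / suc (suc j)))))

    vanish : ∀ ε → 0ℚ ℚ.< ε → Σ[ k ∈ ℕ ] (K ℕ.≤ k × expTerm B k ℚ.≤ ε)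
    vanish ε 0<ε with ∣p∣≤ℕ (expTerm B K)
    ... | c , hc with archimedean c ε 0<ε
    ... | j , hj = j ℕ.+ K , ℕP.m≤n+m K j , ℚP.≤-trans (decay j)
      (ℚP.≤-trans (ℚP.*-monoʳ-≤-nonNeg (+ 1 / suc j) {{ℚ.nonNegative (0≤/ 1 j)}}
          (subst (ℚ._≤ + c / 1) (ℚP.0≤p⇒∣p∣≡p (0≤term K)) hc))
        (subst (ℚ._≤ ε) (sym (/-* c j)) hj))

opaque

  split : ∀ ε → 0ℚ ℚ.< ε → Σ[ h ∈ ℚ ] Σ[ δ ∈ ℚ ]
    (0ℚ ℚ.< h × 0ℚ ℚ.< δ × (δ ℚ.+ δ) ℚ.+ (h ℚ.+ (δ ℚ.+ δ)) ≡ ε)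
  split ε 0<ε with halving ε 0<ε
  ... | h , 0<h , hh with halving h 0<h
  ... | c , 0<c , cc with halving c 0<c
  ... | d , 0<d , dd = h , d , 0<h , 0<d ,
    trans (cong (λ z → z ℚ.+ (h ℚ.+ z)) dd)
      (trans (solve 2 (λ a e → a :+ (e :+ a) := (a :+ a) :+ e) refl c h)
        (trans (cong (ℚ._+ h) cc) hh))
    where open ℚS.+-*-Solver

  near-diagonal : ∀ (x : ℕ → ℚ) b B → B ≡ + b / 1 → (∀ n → ℚ.∣ x n ∣ ℚ.≤ B) → ∀ δ k → b ℕ.+ b ℕ.≤ k → expTerm B k ℚ.≤ δ →
    ∀ m → k ℕ.≤ m → ℚ.∣ expPartial (x m) m ℚ.- expPartial (x m) k ∣ ℚ.≤ δ ℚ.+ δ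
  near-diagonal x b B B≡b hb δ k hk small m k≤m = ℚP.≤-trans
    (subst (λ z → ℚ.∣ expPartial (x m) z ℚ.- expPartial (x m) k ∣ ℚ.≤ expTerm B k ℚ.+ expTerm B k)
      (ℕP.m∸n+n≡m k≤m)
      (ExpTail.tail b B B≡b (x m) (hb m) (m ℕ.∸ k) k (ℕP.m≤n⇒m≤1+n hk)))
    (ℚP.+-mono-≤ small small)

  diagonal-bound : ∀ (x : ℕ → ℚ) δ h k N →
    (∀ m → k ℕ.≤ m → ℚ.∣ expPartial (x m) m ℚ.- expPartial (x m) k ∣ ℚ.≤ δ ℚ.+ δ) →
    (∀ m n → N ℕ.≤ m → N ℕ.≤ n → ℚ.∣ expPartial (x m) k ℚ.- expPartial (x n) k ∣ ℚ.≤ h) →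
    ∀ m n → N ℕ.+ k ℕ.≤ m → N ℕ.+ k ℕ.≤ n →
    ℚ.∣ expPartial (x m) m ℚ.- expPartial (x n) n ∣ ℚ.≤ (δ ℚ.+ δ) ℚ.+ (h ℚ.+ (δ ℚ.+ δ))
  diagonal-bound x δ h k N near hN m n p q =
    ℚP.≤-trans (triangle (expPartial (x m) m) (expPartial (x m) k) (expPartial (x n) n))
    (ℚP.+-mono-≤ (near m (ℕP.m+n≤o⇒n≤o N p))
    (ℚP.≤-trans (triangle (expPartial (x m) k) (expPartial (x n) k) (expPartial (x n) n))
    (ℚP.+-mono-≤ (hN m n (ℕP.m+n≤o⇒m≤o N p) (ℕP.m+n≤o⇒m≤o N q))
      (subst (ℚ._≤ δ ℚ.+ δ) (∣-∣-sym (expPartial (x n) n) (expPartial (x n) k)) (near n (ℕP.m+n≤o⇒n≤o N q))))))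

  Cauchy-exp-bounded : ∀ x → Cauchy x → ∀ b B → B ≡ + b / 1 → (∀ n → ℚ.∣ x n ∣ ℚ.≤ B) →
    Cauchy (λ n → expPartial (x n) n)
  Cauchy-exp-bounded x cx b B B≡b hb ε 0<ε =
    let h , δ , 0<h , 0<δ , total = split ε 0<ε
        k , hk , small            = ExpTail.vanish b B B≡b δ 0<δ
        N , hN                    = Cauchy-expPartial x cx k h 0<h
    in N ℕ.+ k , λ m n p q → subst (ℚ.∣ expPartial (x m) m ℚ.- expPartial (x n) n ∣ ℚ.≤_) total
      (diagonal-bound x δ h k N (near-diagonal x b B B≡b hb δ k hk small) hN m n p q)

  Cauchy-exp : ∀ x → Cauchy x → Cauchy (λ n → expPartial (x n) n)
  Cauchy-exp x cx with bounded x cx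
  ... | b , hb = Cauchy-exp-bounded x cx (suc b) (+ suc b / 1) refl hb

-- The diagonal n ↦ Σ_{k<n} xₙᵏ/k! converges to eˣ because the exponential
-- series converges uniformly on bounded sets.
exp : ℝ → ℝ
exp x = mkℝ (λ n → expPartial (seq x n) n) (Cauchy-exp (seq x) (cauchy x))

-- leibniz k n = Σ_{j<n} (-1)ʲ · 4/(2(k+j)+1), in nested form.
leibniz : ℕ → ℕ → ℚ
leibniz k zero    = 0ℚ
leibniz k (suc n) = (+ 4 / suc (2 ℕ.* k)) ℚ.- leibniz (suc k) n

opaque

  leibniz-bounds : ∀ n k → 0ℚ ℚ.≤ leibniz k n × leibniz k n ℚ.≤ + 4 / suc (2 ℕ.* k)
  leibniz-bounds zero    k = ℚP.≤-refl , 0≤/ 4 (2 ℕ.* k)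
  leibniz-bounds (suc n) k with leibniz-bounds n (suc k)
  ... | lo , hi =
    subst (ℚ._≤ a ℚ.- t) (ℚP.+-inverseʳ t) (ℚP.+-monoˡ-≤ (ℚ.- t) (ℚP.≤-trans hi anti)) ,
    subst (a ℚ.- t ℚ.≤_) (ℚP.+-identityʳ a) (ℚP.+-monoʳ-≤ a (ℚP.neg-antimono-≤ lo))
    where
    a t : ℚ
    a = + 4 / suc (2 ℕ.* k)
    t = leibniz (suc k) n
    anti : + 4 / suc (2 ℕ.* suc k) ℚ.≤ a
    anti = /-≤ 4 4 (2 ℕ.* suc k) (2 ℕ.* k)
      (ℕP.*-monoʳ-≤ 4 (ℕ.s≤s (ℕP.*-monoʳ-≤ 2 (ℕP.n≤1+n k))))

  leibniz-tail : ∀ n i k → ℚ.∣ leibniz k (n ℕ.+ i) ℚ.- leibniz k n ∣ ℚ.≤ + 4 / suc (2 ℕ.* (k ℕ.+ n))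
  leibniz-tail zero    i k with leibniz-bounds i k
  ... | lo , hi = subst₂ ℚ._≤_
    (trans (sym (ℚP.0≤p⇒∣p∣≡p lo)) (cong ℚ.∣_∣ (sym (ℚP.+-identityʳ (leibniz k i)))))
    (cong (λ z → + 4 / suc (2 ℕ.* z)) (sym (ℕP.+-identityʳ k))) hi
  leibniz-tail (suc n) i k = subst₂ ℚ._≤_
    (trans (∣-∣-sym (leibniz (suc k) (n ℕ.+ i)) (leibniz (suc k) n))
      (cong ℚ.∣_∣ (solve 3 (λ a s t → t :- s := (a :- s) :- (a :- t)) refl
        (+ 4 / suc (2 ℕ.* k)) (leibniz (suc k) (n ℕ.+ i)) (leibniz (suc k) n))))
    (cong (λ z → + 4 / suc (2 ℕ.* z)) (sym (ℕP.+-suc k n)))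
    (leibniz-tail n i (suc k))
    where open ℚS.+-*-Solver

  Cauchy-leibniz : Cauchy (leibniz 0)
  Cauchy-leibniz ε 0<ε with archimedean 4 (ε ℚ.* ½) (0<* ε ½ 0<ε 0<½)
  ... | N , hN = N , λ m n p q → subst (ℚ.∣ leibniz 0 m ℚ.- leibniz 0 n ∣ ℚ.≤_) (halves ε)
    (ℚP.≤-trans (triangle (leibniz 0 m) (leibniz 0 N) (leibniz 0 n))
      (ℚP.+-mono-≤ (near m p) (subst (ℚ._≤ ε ℚ.* ½) (∣-∣-sym (leibniz 0 n) (leibniz 0 N)) (near n q))))
    where
    near : ∀ m → N ℕ.≤ m → ℚ.∣ leibniz 0 m ℚ.- leibniz 0 N ∣ ℚ.≤ ε ℚ.* ½
    near m N≤m = ℚP.≤-trans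
      (subst (λ z → ℚ.∣ leibniz 0 z ℚ.- leibniz 0 N ∣ ℚ.≤ + 4 / suc (2 ℕ.* N))
        (ℕP.m+[n∸m]≡n N≤m) (leibniz-tail N (m ℕ.∸ N) 0))
      (ℚP.≤-trans (/-≤ 4 4 (2 ℕ.* N) N (ℕP.*-monoʳ-≤ 4 (ℕ.s≤s (ℕP.m≤n*m N 2)))) hN)

-- π = 4/1 - 4/3 + 4/5 - ⋯
π : ℝ
π = mkℝ (leibniz 0) Cauchy-leibniz

record ℂ : Set where
  constructor _+i_
  field
    re im : ℝ

open ℂ public

infixl 6 _+ᶜ_ _-ᶜ_
infixl 7 _*ᶜ_
infix  8 -ᶜ_
infixr 9 _^ᶜ_

ofℝ : ℝ → ℂ
ofℝ x = x +i 0ℝ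

0ᶜ 1ᶜ : ℂ
0ᶜ = ofℝ 0ℝ
1ᶜ = ofℝ 1ℝ

-ᶜ_ : ℂ → ℂ
-ᶜ z = (- re z) +i (- im z)

_+ᶜ_ _*ᶜ_ _-ᶜ_ : ℂ → ℂ → ℂ
z +ᶜ w = (re z + re w) +i (im z + im w)
z *ᶜ w = (re z * re w - im z * im w) +i (re z * im w + im z * re w)
z -ᶜ w = z +ᶜ (-ᶜ w)

_^ᶜ_ : ℂ → ℕ → ℂ
z ^ᶜ zero  = 1ᶜ
z ^ᶜ suc n = z ^ᶜ n *ᶜ z

-- |z| ≤ c, squared so as to need no square root.
∣_∣≤_ : ℂ → ℝ → Set
∣ z ∣≤ c = 0ℝ ≤ c × re z * re z + im z * im z ≤ c * c

-- ∑ n f = f 0 + ⋯ + f (n - 1)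
∑ : ℕ → (ℕ → ℂ) → ℂ
∑ zero    f = 0ᶜ
∑ (suc n) f = ∑ n f +ᶜ f n

PowerSeries : Set
PowerSeries = ℕ → ℂ

_⊛_ : PowerSeries → PowerSeries → PowerSeries
(f ⊛ g) N = ∑ (suc N) (λ i → f i *ᶜ g (N ℕ.∸ i))

monomial : ℕ → PowerSeries
monomial k N = if k ℕ.≡ᵇ N then 1ᶜ else 0ᶜ

eulerPartial : ℕ → PowerSeries
eulerPartial zero    = monomial 0
eulerPartial (suc M) = eulerPartial M ⊛ (λ N → monomial 0 N -ᶜ monomial (suc M) N)

-- ∏_{m≥1} (1 - qᵐ); the factors with m > N do not affect the coefficient of q^N.
eulerProduct : PowerSeries
eulerProduct N = eulerPartial N N

-- f converges at q, with sum g.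
HasValue : PowerSeries → ℂ → ℂ → Set
HasValue f q g = ∀ ε → 0ℚ ℚ.< ε →
  Σ[ N ∈ ℕ ] (∀ n → N ℕ.≤ n → ∣ ∑ n (λ k → f k *ᶜ q ^ᶜ k) -ᶜ g ∣≤ fromℚ ε)

-- k +½ is the half-integer k + 1/2.
record HalfInt : Set where
  constructor _+½
  field
    floor : ℤ

neg : HalfInt → HalfInt
neg (k +½) = (ℤ.- ℤ.suc k) +½

record Descending : Set where
  constructor descending
  field
    list        : List ℕ
    .decreasing : AllPairs ℕ._>_ list

open Descending public

above below : ℕ → List ℕ → List ℕ
above n = filter (n ℕP.<?_)
below n = filter (ℕP._<? n)

insert remove : ℕ → Descending → Descending
insert n (descending xs d) = descending (above n xs ++ n ∷ below n xs) (AllPairsP.++⁺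
  (AllPairsP.filter⁺ (n ℕP.<?_) d)
  (AllP.all-filter (ℕP._<? n) xs ∷ AllPairsP.filter⁺ (ℕP._<? n) d)
  (All.map (λ n<x → n<x ∷ All.map (λ y<n → ℕP.<-trans y<n n<x) (AllP.all-filter (ℕP._<? n) xs))
    (AllP.all-filter (n ℕP.<?_) xs)))
remove n (descending xs d) =
  descending (filter (λ x → ¬? (x ℕP.≟ n)) xs) (AllPairsP.filter⁺ (λ x → ¬? (x ℕP.≟ n)) d)

-- The basis vector ψ(-n_a-½)⋯ψ(-n₁-½) ψ*(-m_b-½)⋯ψ*(-m₁-½) 𝟏, with
-- ns = n_a ∷ ⋯ ∷ n₁ ∷ [] and ms = m_b ∷ ⋯ ∷ m₁ ∷ [].
record Monomial : Set where
  constructor _∙_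
  field
    ns ms : Descending

open Monomial public

charge : Monomial → ℤ
charge μ = + length (list (ns μ)) ℤ.- + length (list (ms μ))

-- Twice the eigenvalue ∑(nᵢ+½) + ∑(mᵢ+½) of L(0).
2L₀ : Monomial → ℕ
2L₀ μ = sum (map (λ n → 2 ℕ.* n ℕ.+ 1) (list (ns μ))) ℕ.+ sum (map (λ m → 2 ℕ.* m ℕ.+ 1) (list (ms μ)))

-- Vectors are finite formal linear combinations of basis vectors; two of them
-- are equal when they have the same coefficients ⟨ μ ∣ v ⟩.
Fock : Set
Fock = List (ℂ × Monomial)

⟨_∣_⟩ : Monomial → Fock → ℂ
⟨ μ ∣ []          ⟩ = 0ᶜ
⟨ μ ∣ (c , ν) ∷ v ⟩ =
  if does (≡-dec ℕP._≟_ (list (ns μ)) (list (ns ν))) ∧ does (≡-dec ℕP._≟_ (list (ms μ)) (list (ms ν)))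
  then c +ᶜ ⟨ μ ∣ v ⟩ else ⟨ μ ∣ v ⟩

linear : (Monomial → Fock) → Fock → Fock
linear f = concatMap (λ (c , μ) → map (λ (d , ν) → c *ᶜ d , ν) (f μ))

sgn : ℕ → ℂ
sgn zero    = 1ᶜ
sgn (suc k) = -ᶜ sgn k

-- A mode is moved to the right by the anticommutation relations: each
-- generator it passes contributes a sign; a negative mode stops at its place in
-- the decreasing order (and gives 0 if it is already there), while a positive
-- mode stops where it is contracted with the only negative mode it does not
-- anticommute with, and otherwise reaches and annihilates 𝟏.

ψ : HalfInt → Fock → Fock
ψ k = linear (act k)
  where
  act : HalfInt → Monomial → Fock
  act (-[1+ n ] +½) (ns ∙ ms) =
    if does (n ∈? list ns) then []
    else (sgn (length (above n (list ns))) , insert n ns ∙ ms) ∷ []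
  act ((+ k) +½) (ns ∙ ms) =
    if does (k ∈? list ms)
    then (sgn (length (list ns) ℕ.+ length (above k (list ms))) , ns ∙ remove k ms) ∷ []
    else []

ψ* : HalfInt → Fock → Fock
ψ* ℓ = linear (act ℓ)
  where
  act : HalfInt → Monomial → Fock
  act (-[1+ m ] +½) (ns ∙ ms) =
    if does (m ∈? list ms) then []
    else (sgn (length (list ns) ℕ.+ length (above m (list ms))) , ns ∙ insert m ms) ∷ []
  act ((+ ℓ) +½) (ns ∙ ms) =
    if does (ℓ ∈? list ns)
    then (sgn (length (above ℓ (list ns))) , remove ℓ ns ∙ ms) ∷ []
    else []

-- All strictly decreasing lists with entries < k.
descendingBelow : (k : ℕ) → List (Σ[ d ∈ Descending ] All (ℕ._< k) (list d))
descendingBelow k = map (λ (xs , d , b) → descending xs d , b) (lists k)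
  where
  lists : (k : ℕ) → List (Σ[ xs ∈ List ℕ ] (AllPairs ℕ._>_ xs × All (ℕ._< k) xs))
  lists zero    = ([] , [] , []) ∷ []
  lists (suc k) =
    map (λ (xs , d , b) → k ∷ xs , b ∷ d , ℕP.n<1+n k ∷ All.map ℕP.m<n⇒m<1+n b) (lists k) ++
    map (λ (xs , d , b) → xs , d , All.map ℕP.m<n⇒m<1+n b) (lists k)

-- The basis vectors of charge 0 on which L(0) is N. The entries of such a
-- monomial are < N. On charge 0 vectors L(0) has eigenvalues in ℕ only.
basis₀ : ℕ → List Monomial
basis₀ N = filter (λ μ → (charge μ ℤP.≟ + 0) ×-dec (2L₀ μ ℕP.≟ 2 ℕ.* N))
  (cartesianProductWith _∙_ (map proj₁ (descendingBelow N)) (map proj₁ (descendingBelow N)))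

-- tr_{F₀} T q^{L(0)}
tr₀ : (Fock → Fock) → PowerSeries
tr₀ T N = foldr (λ μ z → ⟨ μ ∣ T ((1ᶜ , μ) ∷ []) ⟩ +ᶜ z) 0ᶜ (basis₀ N)

-- The coefficient of t^e in A(t) = ∑_ℓ ψ*(ℓ+½) ψ(-ℓ-½) t^(-ℓ-½).
A[_] : HalfInt → Fock → Fock
A[ e ] v = ψ* (neg e) (ψ e v)

-- The coefficient of t₁^e₁ ⋯ tₙ^eₙ in F(t₁,…,tₙ); the factor q^(1/24) of η
-- cancels q^(-1/24) in the trace.
F : ∀ {n} → Vector HalfInt n → PowerSeries
F e = eulerProduct ⊛ tr₀ (λ v → Vector.foldr A[_] v e)

-- The exponents are r_j+½ for j ≤ m and -s_k-½ for k > m.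
G : ∀ {m l} → Vector ℕ m → Vector ℕ l → PowerSeries
G r s = F (Vector.map (λ a → (+ a) +½) r Vector.++ Vector.map (λ b → neg ((+ b) +½)) s)

total : ∀ {m} → Vector ℕ m → ℕ
total = Vector.foldr ℕ._+_ 0

StrictlyDecreasing : ∀ {m} → Vector ℕ m → Set
StrictlyDecreasing r = ∀ i j → i Fin.< j → r j ℕ.< r i

-- Each factor A(t_j) contributes a projection, so G r s is the probability, for the measure ∏(1 - qᵐ) q^|λ|
-- on partitions, that the sites of a finite set X of the Maya diagram are all empty; call it p X. Removing the
-- particle at a site x and shifting the others up gives p A = p (x ∷ A) + qˣ p (x ∷ A shifted by 1) for x ∉ A.
-- Comparing these identities at two sites x and w shows that p (x ∷ A) - p (w ∷ A) is (qʷ - qˣ) times another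
-- probability, hence O(y). So p varies by O(y) when points of X are moved, the recurrence becomes p A = 2 p X + O(y),
-- and p X = 2⁻ⁿ + O(y). Inserting this in the same two identities gives the next order. No modular or theta function
-- is involved; the normalisation p [] = 1 follows from the same recurrence, applied to the sets of all sites above N.

module Submission where

open import Defs
open import Data.Bool using (Bool; true; false; not; if_then_else_)
import Data.Bool.Properties as BoolP
open import Data.Empty using (⊥-elim)
open import Data.Fin using (Fin)
import Data.Fin as Fin
import Data.Fin.Properties as FinP
open import Data.Integer using (ℤ; +_; -[1+_])
import Data.Integer as ℤ
import Data.Integer.Properties as ℤP
import Data.Integer.Solver as ℤS
open import Data.List using (List; []; _∷_; _++_; [_]; map; foldr; length; filter; tabulate; cartesianProductWith)
import Data.List.Properties as LP
import Data.Nat.Properties as ℕP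
open import Data.List.Membership.DecPropositional ℕP._≟_ using (_∈?_)
open import Data.List.Membership.Propositional using (_∈_; _∉_)
import Data.List.Membership.Propositional.Properties as ∈P
open import Data.List.Relation.Binary.Permutation.Propositional using (_↭_; ↭-refl; ↭⇒↭ₛ; ↭-sym; ↭-trans; ↭-prep; ↭-swap; ↭-reflexive)
import Data.List.Relation.Binary.Permutation.Propositional.Properties as ↭P
import Data.List.Relation.Binary.Permutation.Setoid.Properties as ↭S
open import Data.List.Relation.Unary.All as All using (All; []; _∷_)
import Data.List.Relation.Unary.All.Properties as AllP
open import Data.List.Relation.Unary.AllPairs as AllPairs using (AllPairs; []; _∷_)
import Data.List.Relation.Unary.AllPairs.Properties as AllPairsP
open import Data.List.Relation.Unary.Any using (here; there)
import Data.List.Relation.Unary.Sorted.TotalOrder.Properties as SortedP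
open import Data.List.Relation.Unary.Unique.Propositional using (Unique)
import Data.List.Relation.Unary.Unique.Propositional.Properties as UniqueP
open import Data.List.Sort ℤP.≤-decTotalOrder using (sort; sort-↭; sort-↗)
open import Data.Nat using (ℕ; zero; suc)
import Data.Nat as ℕ
open import Data.Nat.ListAction using (sum)
import Data.Nat.ListAction.Properties as SumP
import Data.Nat.Solver as ℕS
open import Data.Product using (Σ-syntax; _×_; _,_; proj₁; proj₂)
open import Data.Rational using (ℚ; 0ℚ; 1ℚ; ½; _/_)
import Data.Rational as ℚ
import Data.Rational.Properties as ℚP
import Data.Rational.Solver as ℚS
open import Data.Rational.Unnormalised using (mkℚᵘ)
import Data.Rational.Unnormalised as ℚᵘ
import Data.Rational.Unnormalised.Properties as ℚᵘP
open import Data.Sum using (_⊎_; inj₁; inj₂)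
open import Data.Vec.Functional using (Vector)
import Data.Vec.Functional as Vector
open import Function using (_∘_; mk⇔)
open import Relation.Binary.Definitions using (tri<; tri≈; tri>)
open import Relation.Binary.PropositionalEquality
  using (_≡_; _≢_; refl; sym; trans; cong; cong₂; subst; subst₂; setoid)
open import Relation.Nullary using (Dec; yes; no; does; recompute; ¬_; ¬?)
open import Relation.Nullary.Decidable using (does-⇔; dec-true; dec-false; _×-dec_)

-- Finite sets and permutations

-- The recurrence does not simply descend from `A` to X = `x ∷ A`: its last term is `p (shift X)`,
-- with as many points as X. It becomes solvable because shifting X is a chain of moves of single
-- points by one site, and each move changes `p` by a difference of powers of `q`, already O(z),
-- times the probability of a set with one more point. A given order for n points thus needs only
-- the order below for n + 1 points. Hence boundedness for all sets comes before the leading term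
-- for all sets, and this before the linear term. The linear coefficients obey κ(X) = κ(A) - x +
-- n/2, which sums to n(n + 1)/4 minus the sum of the sites. The error constants must not depend on
-- `y`, whereas convergence of the series at q = exp(-2πy) rests on a geometric ratio that tends to
-- 1 as `y` tends to 0. `Gas` separates the two concerns: it keeps only what holds uniformly in `y`,
-- and the estimates of the asymptotic part are quantified over all gases.

unique-↭ : ∀ {A : Set} {xs ys : List A} → Unique xs → Unique ys →
  (∀ {z} → z ∈ xs → z ∈ ys) → (∀ {z} → z ∈ ys → z ∈ xs) → xs ↭ ys
unique-↭ {xs = []} {[]} _ _ _ _ = ↭-refl
unique-↭ {xs = []} {y ∷ ys} _ _ _ g with g (here refl)
... | ()
unique-↭ {A} {x ∷ xs} {ys} (x∉ ∷ uxs) uys f g with ∈P.∈-∃++ (f (here refl))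
... | as , bs , refl = ↭-trans (↭-prep x (unique-↭ uxs (AllPairs.tail u') f' g')) (↭-sym move)
  where
  move : as ++ [ x ] ++ bs ↭ x ∷ as ++ bs
  move = ↭P.shift x as bs
  u' : Unique (x ∷ as ++ bs)
  u' = ↭S.Unique-resp-↭ (setoid A) (↭⇒↭ₛ move) uys
  f' : ∀ {z} → z ∈ xs → z ∈ as ++ bs
  f' m with ↭P.∈-resp-↭ move (f (there m))
  ... | here refl = ⊥-elim (All.lookup x∉ m refl)
  ... | there m' = m'
  g' : ∀ {z} → z ∈ as ++ bs → z ∈ xs
  g' m with g (↭P.∈-resp-↭ (↭-sym move) (there m))
  ... | here refl = ⊥-elim (All.lookup (AllPairs.head u') m refl)
  ... | there m' = m'

-- Each head is the maximum of its list, so two different heads would each exceed the other.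
descending-ext : ∀ {xs ys : List ℕ} → AllPairs ℕ._>_ xs → AllPairs ℕ._>_ ys →
  (∀ {z} → z ∈ xs → z ∈ ys) → (∀ {z} → z ∈ ys → z ∈ xs) → xs ≡ ys
descending-ext {[]} {[]} _ _ _ _ = refl
descending-ext {[]} {y ∷ ys} _ _ _ g with g (here refl)
... | ()
descending-ext {x ∷ xs} {[]} _ _ f _ with f (here refl)
... | ()
descending-ext {x ∷ xs} {y ∷ ys} (x> ∷ sx) (y> ∷ sy) f g = cong₂ _∷_ x≡y (descending-ext sx sy f' g')
  where
  x≡y : x ≡ y
  x≡y with f (here refl) | g (here refl)
  ... | here e | _ = e
  ... | there _ | here e = sym e
  ... | there m | there m' = ⊥-elim (ℕP.<-asym (All.lookup y> m) (All.lookup x> m'))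
  f' : ∀ {z} → z ∈ xs → z ∈ ys
  f' m with f (there m)
  ... | here e = ⊥-elim (ℕP.<-irrefl (trans e (sym x≡y)) (All.lookup x> m))
  ... | there m' = m'
  g' : ∀ {z} → z ∈ ys → z ∈ xs
  g' m with g (there m)
  ... | here e = ⊥-elim (ℕP.<-irrefl (trans e x≡y) (All.lookup y> m))
  ... | there m' = m'

-- The field `decreasing` is irrelevant; sortedness is decidable, so `recompute` gives back a proof
-- that can be used.
sorted : ∀ d → AllPairs ℕ._>_ (list d)
sorted (descending xs d) = recompute (AllPairs.allPairs? ℕP._>?_ xs) d

unique : ∀ d → Unique (list d)
unique d = AllPairs.map (λ i>j e → ℕP.<-irrefl (sym e) i>j) (sorted d)

list-injective : ∀ {d e} → list d ≡ list e → d ≡ e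
list-injective {descending xs _} {descending .xs _} refl = refl

private
  >-≢ : ∀ {n x : ℕ} → x ≢ n → (n ℕ.< x) ⊎ (x ℕ.< n)
  >-≢ {n} {x} ne with ℕP.<-cmp n x
  ... | tri< l _ _ = inj₁ l
  ... | tri≈ _ e _ = ⊥-elim (ne (sym e))
  ... | tri> _ _ g = inj₂ g

∈-insert⁻ : ∀ n d {m} → m ∈ list (insert n d) → m ≢ n → m ∈ list d
∈-insert⁻ n d@(descending xs _) m∈ m≢n with ∈P.∈-++⁻ (above n xs) m∈
... | inj₁ a = proj₁ (∈P.∈-filter⁻ (n ℕP.<?_) {xs = xs} a)
... | inj₂ (here e) = ⊥-elim (m≢n e)
... | inj₂ (there b) = proj₁ (∈P.∈-filter⁻ (ℕP._<? n) {xs = xs} b)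

∈-insert⁺ : ∀ n d {m} → m ≢ n → m ∈ list d → m ∈ list (insert n d)
∈-insert⁺ n d@(descending xs _) m≢n m∈ with >-≢ m≢n
... | inj₁ l = ∈P.∈-++⁺ˡ (∈P.∈-filter⁺ (n ℕP.<?_) m∈ l)
... | inj₂ g = ∈P.∈-++⁺ʳ (above n xs) (there (∈P.∈-filter⁺ (ℕP._<? n) m∈ g))

∈-insert : ∀ n d → n ∈ list (insert n d)
∈-insert n (descending xs _) = ∈P.∈-++⁺ʳ (above n xs) (here refl)

∈-remove⁻ : ∀ n d {m} → m ∈ list (remove n d) → m ∈ list d × m ≢ n
∈-remove⁻ n (descending xs _) m∈ = ∈P.∈-filter⁻ (λ x → ¬? (x ℕP.≟ n)) {xs = xs} m∈

∈-remove⁺ : ∀ n d {m} → m ≢ n → m ∈ list d → m ∈ list (remove n d)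
∈-remove⁺ n (descending xs _) m≢n m∈ = ∈P.∈-filter⁺ (λ x → ¬? (x ℕP.≟ n)) m∈ m≢n

insert-↭ : ∀ n d → n ∉ list d → list (insert n d) ↭ n ∷ list d
insert-↭ n d n∉ = unique-↭ (unique (insert n d)) (All.tabulate (λ m e → n∉ (subst (_∈ list d) (sym e) m)) ∷ unique d) f g
  where
  f : ∀ {z} → z ∈ list (insert n d) → z ∈ n ∷ list d
  f {z} m with z ℕP.≟ n
  ... | yes e = here e
  ... | no ne = there (∈-insert⁻ n d m ne)
  g : ∀ {z} → z ∈ n ∷ list d → z ∈ list (insert n d)
  g (here refl) = ∈-insert n d
  g (there m) = ∈-insert⁺ n d (λ e → n∉ (subst (_∈ list d) e m)) m

remove-↭ : ∀ n d → n ∈ list d → list d ↭ n ∷ list (remove n d)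
remove-↭ n d n∈ = unique-↭ (unique d) (All.tabulate (λ m e → proj₂ (∈-remove⁻ n d m) (sym e)) ∷ unique (remove n d)) f g
  where
  f : ∀ {z} → z ∈ list d → z ∈ n ∷ list (remove n d)
  f {z} m with z ℕP.≟ n
  ... | yes e = here e
  ... | no ne = there (∈-remove⁺ n d ne m)
  g : ∀ {z} → z ∈ n ∷ list (remove n d) → z ∈ list d
  g (here refl) = n∈
  g (there m) = proj₁ (∈-remove⁻ n d m)

-- Translation of strictly decreasing lists by one

raiseList : Bool → List ℕ → List ℕ
raiseList true xs = map suc xs
raiseList false xs = map suc xs ++ 0 ∷ []

raiseList-sorted : ∀ b {xs} → AllPairs ℕ._>_ xs → AllPairs ℕ._>_ (raiseList b xs)
raiseList-sorted true d = AllPairsP.map⁺ (AllPairs.map ℕ.s≤s d)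
raiseList-sorted false {xs} d = AllPairsP.++⁺ (raiseList-sorted true d) ([] ∷ [])
  (AllP.map⁺ (All.tabulate {xs = xs} λ _ → ℕ.s≤s ℕ.z≤n ∷ []))

lowerList : List ℕ → List ℕ
lowerList [] = []
lowerList (zero ∷ xs) = lowerList xs
lowerList (suc n ∷ xs) = n ∷ lowerList xs

∈-lower⁻ : ∀ xs {n} → n ∈ lowerList xs → suc n ∈ xs
∈-lower⁻ (zero ∷ xs) m = there (∈-lower⁻ xs m)
∈-lower⁻ (suc x ∷ xs) (here e) = here (cong suc e)
∈-lower⁻ (suc x ∷ xs) (there m) = there (∈-lower⁻ xs m)

∈-lower⁺ : ∀ xs {n} → suc n ∈ xs → n ∈ lowerList xs
∈-lower⁺ (zero ∷ xs) (there m) = ∈-lower⁺ xs m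
∈-lower⁺ (suc x ∷ xs) (here e) = here (ℕP.suc-injective e)
∈-lower⁺ (suc x ∷ xs) (there m) = there (∈-lower⁺ xs m)

lowerList-sorted : ∀ {xs} → AllPairs ℕ._>_ xs → AllPairs ℕ._>_ (lowerList xs)
lowerList-sorted [] = []
lowerList-sorted {zero ∷ xs} (_ ∷ d) = lowerList-sorted d
lowerList-sorted {suc x ∷ xs} (x> ∷ d) =
  All.tabulate (λ m → ℕP.≤-pred (All.lookup x> (∈-lower⁻ xs m))) ∷ lowerList-sorted d

raise : Bool → Descending → Descending
raise b (descending xs d) = descending (raiseList b xs) (raiseList-sorted b d)

lower : Descending → Descending
lower (descending xs d) = descending (lowerList xs) (lowerList-sorted d)

mem : ℕ → Descending → Bool
mem n d = does (n ∈? list d)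

mem-⇔ : ∀ {m n d e} → (m ∈ list d → n ∈ list e) → (n ∈ list e → m ∈ list d) → mem m d ≡ mem n e
mem-⇔ {m} {n} {d} {e} f g = does-⇔ (mk⇔ f g) (m ∈? list d) (n ∈? list e)

mem-true : ∀ {n d} → n ∈ list d → mem n d ≡ true
mem-true {n} {d} = dec-true (n ∈? list d)

mem-false : ∀ {n d} → n ∉ list d → mem n d ≡ false
mem-false {n} {d} = dec-false (n ∈? list d)

true-mem : ∀ {n d} → mem n d ≡ true → n ∈ list d
true-mem {n} {d} h with n ∈? list d
... | yes m = m
... | no _ with h
...   | ()

false-mem : ∀ {n d} → mem n d ≡ false → n ∉ list d
false-mem {n} {d} h m with trans (sym h) (mem-true {n} {d} m)
... | ()

mem-insert-≡ : ∀ n d → mem n (insert n d) ≡ true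
mem-insert-≡ n d = mem-true {n} {insert n d} (∈-insert n d)

mem-insert-≢ : ∀ {m} n d → m ≢ n → mem m (insert n d) ≡ mem m d
mem-insert-≢ {m} n d ne = mem-⇔ {m} {m} {insert n d} {d} (λ h → ∈-insert⁻ n d h ne) (∈-insert⁺ n d ne)

mem-remove-≡ : ∀ n d → mem n (remove n d) ≡ false
mem-remove-≡ n d = mem-false {n} {remove n d} (λ m → proj₂ (∈-remove⁻ n d m) refl)

mem-remove-≢ : ∀ {m} n d → m ≢ n → mem m (remove n d) ≡ mem m d
mem-remove-≢ {m} n d ne = mem-⇔ {m} {m} {remove n d} {d} (proj₁ ∘ ∈-remove⁻ n d) (∈-remove⁺ n d ne)

mem-lower : ∀ n d → mem n (lower d) ≡ mem (suc n) d
mem-lower n d = mem-⇔ {n} {suc n} {lower d} {d} (∈-lower⁻ (list d)) (∈-lower⁺ (list d))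

mem-raise-suc : ∀ n b d → mem (suc n) (raise b d) ≡ mem n d
mem-raise-suc n b d = mem-⇔ {suc n} {n} {raise b d} {d} (f b) (g b)
  where
  f' : suc n ∈ map suc (list d) → n ∈ list d
  f' m with ∈P.∈-map⁻ suc m
  ... | _ , m' , refl = m'
  f : ∀ b → suc n ∈ raiseList b (list d) → n ∈ list d
  f true m = f' m
  f false m with ∈P.∈-++⁻ (map suc (list d)) m
  ... | inj₁ m' = f' m'
  ... | inj₂ (here ())
  ... | inj₂ (there ())
  g : ∀ b → n ∈ list d → suc n ∈ raiseList b (list d)
  g true m = ∈P.∈-map⁺ suc m
  g false m = ∈P.∈-++⁺ˡ (∈P.∈-map⁺ suc m)

mem-raise-0 : ∀ b d → mem 0 (raise b d) ≡ not b
mem-raise-0 true d = mem-false {0} {raise true d} λ m → lem (∈P.∈-map⁻ suc m)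
  where
  lem : ¬ (Σ[ x ∈ ℕ ] (x ∈ list d × 0 ≡ suc x))
  lem (_ , _ , ())
mem-raise-0 false d = mem-true {0} {raise false d} (∈P.∈-++⁺ʳ (map suc (list d)) (here refl))

-- Particle removal on Maya diagrams

-- Sites of the Maya diagram: site n + 1 is occupied when n ∈ ns, site -m when m ∉ ms.
occupied : Monomial → ℤ → Bool
occupied μ (+ suc n) = mem n (ns μ)
occupied μ (+ zero) = not (mem 0 (ms μ))
occupied μ -[1+ n ] = not (mem (suc n) (ms μ))

private
  mem-ext : ∀ {d e} → (∀ n → mem n d ≡ mem n e) → d ≡ e
  mem-ext {d} {e} h = list-injective (descending-ext (sorted d) (sorted e)
    (λ {z} m → true-mem {z} {e} (trans (sym (h z)) (mem-true {z} {d} m)))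
    (λ {z} m → true-mem {z} {d} (trans (h z) (mem-true {z} {e} m))))

monomial-ext : ∀ {μ ν} → (∀ x → occupied μ x ≡ occupied ν x) → μ ≡ ν
monomial-ext {a ∙ b} {a' ∙ b'} h = cong₂ _∙_ (mem-ext λ n → h (+ suc n)) (mem-ext holes)
  where
  holes : ∀ n → mem n b ≡ mem n b'
  holes zero = BoolP.not-injective (h (+ 0))
  holes (suc n) = BoolP.not-injective (h -[1+ n ])

vacate fill : ℤ → Monomial → Monomial
vacate (+ suc n) (a ∙ b) = remove n a ∙ b
vacate (+ zero) (a ∙ b) = a ∙ insert 0 b
vacate -[1+ n ] (a ∙ b) = a ∙ insert (suc n) b
fill (+ suc n) (a ∙ b) = insert n a ∙ b
fill (+ zero) (a ∙ b) = a ∙ remove 0 b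
fill -[1+ n ] (a ∙ b) = a ∙ remove (suc n) b

-- Translation by one carries site 0 to site 1, or back, across the border between `ms` and `ns`.
-- The flag of `raise` tells that this site produces no new entry 0: for `up` when site 0 was a
-- hole, for `down` when site 1 was a particle.
up down : Monomial → Monomial
up (a ∙ b) = raise (mem 0 b) a ∙ lower b
down (a ∙ b) = lower a ∙ raise (mem 0 a) b

occupied-vacate-≡ : ∀ x μ → occupied (vacate x μ) x ≡ false
occupied-vacate-≡ (+ suc n) (a ∙ b) = mem-remove-≡ n a
occupied-vacate-≡ (+ zero) (a ∙ b) = cong not (mem-insert-≡ 0 b)
occupied-vacate-≡ -[1+ n ] (a ∙ b) = cong not (mem-insert-≡ (suc n) b)

occupied-fill-≡ : ∀ x μ → occupied (fill x μ) x ≡ true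
occupied-fill-≡ (+ suc n) (a ∙ b) = mem-insert-≡ n a
occupied-fill-≡ (+ zero) (a ∙ b) = cong not (mem-remove-≡ 0 b)
occupied-fill-≡ -[1+ n ] (a ∙ b) = cong not (mem-remove-≡ (suc n) b)

occupied-vacate-≢ : ∀ x y μ → y ≢ x → occupied (vacate x μ) y ≡ occupied μ y
occupied-vacate-≢ (+ suc n) (+ suc m) (a ∙ b) ne = mem-remove-≢ n a (λ e → ne (cong (λ k → + suc k) e))
occupied-vacate-≢ (+ suc n) (+ zero) (a ∙ b) ne = refl
occupied-vacate-≢ (+ suc n) -[1+ m ] (a ∙ b) ne = refl
occupied-vacate-≢ (+ zero) (+ suc m) (a ∙ b) ne = refl
occupied-vacate-≢ (+ zero) (+ zero) (a ∙ b) ne = ⊥-elim (ne refl)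
occupied-vacate-≢ (+ zero) -[1+ m ] (a ∙ b) ne = cong not (mem-insert-≢ 0 b λ ())
occupied-vacate-≢ -[1+ n ] (+ suc m) (a ∙ b) ne = refl
occupied-vacate-≢ -[1+ n ] (+ zero) (a ∙ b) ne = cong not (mem-insert-≢ (suc n) b λ ())
occupied-vacate-≢ -[1+ n ] -[1+ m ] (a ∙ b) ne = cong not (mem-insert-≢ (suc n) b λ e → ne (cong -[1+_] (ℕP.suc-injective e)))

occupied-fill-≢ : ∀ x y μ → y ≢ x → occupied (fill x μ) y ≡ occupied μ y
occupied-fill-≢ (+ suc n) (+ suc m) (a ∙ b) ne = mem-insert-≢ n a (λ e → ne (cong (λ k → + suc k) e))
occupied-fill-≢ (+ suc n) (+ zero) (a ∙ b) ne = refl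
occupied-fill-≢ (+ suc n) -[1+ m ] (a ∙ b) ne = refl
occupied-fill-≢ (+ zero) (+ suc m) (a ∙ b) ne = refl
occupied-fill-≢ (+ zero) (+ zero) (a ∙ b) ne = ⊥-elim (ne refl)
occupied-fill-≢ (+ zero) -[1+ m ] (a ∙ b) ne = cong not (mem-remove-≢ 0 b λ ())
occupied-fill-≢ -[1+ n ] (+ suc m) (a ∙ b) ne = refl
occupied-fill-≢ -[1+ n ] (+ zero) (a ∙ b) ne = cong not (mem-remove-≢ (suc n) b λ ())
occupied-fill-≢ -[1+ n ] -[1+ m ] (a ∙ b) ne = cong not (mem-remove-≢ (suc n) b λ e → ne (cong -[1+_] (ℕP.suc-injective e)))

occupied-up : ∀ μ y → occupied (up μ) (ℤ.suc y) ≡ occupied μ y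
occupied-up (a ∙ b) (+ suc n) = mem-raise-suc n (mem 0 b) a
occupied-up (a ∙ b) (+ zero) = mem-raise-0 (mem 0 b) a
occupied-up (a ∙ b) -[1+ zero ] = cong not (mem-lower 0 b)
occupied-up (a ∙ b) -[1+ suc n ] = cong not (mem-lower (suc n) b)

occupied-down : ∀ μ y → occupied (down μ) y ≡ occupied μ (ℤ.suc y)
occupied-down (a ∙ b) (+ suc n) = mem-lower n a
occupied-down (a ∙ b) (+ zero) = trans (cong not (mem-raise-0 (mem 0 a) b)) (BoolP.not-involutive (mem 0 a))
occupied-down (a ∙ b) -[1+ zero ] = cong not (mem-raise-suc 0 (mem 0 a) b)
occupied-down (a ∙ b) -[1+ suc n ] = cong not (mem-raise-suc (suc n) (mem 0 a) b)

-- Removing the particle at x and moving all others up by one site keeps the charge.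
φ φ⁻¹ : ℤ → Monomial → Monomial
φ x μ = up (vacate x μ)
φ⁻¹ x ν = fill x (down ν)

occupied-φ-≢ : ∀ x y μ → y ≢ x → occupied (φ x μ) (ℤ.suc y) ≡ occupied μ y
occupied-φ-≢ x y μ ne = trans (occupied-up (vacate x μ) y) (occupied-vacate-≢ x y μ ne)

occupied-φ-≡ : ∀ x μ → occupied (φ x μ) (ℤ.suc x) ≡ false
occupied-φ-≡ x μ = trans (occupied-up (vacate x μ) x) (occupied-vacate-≡ x μ)

φ⁻¹-φ : ∀ x μ → occupied μ x ≡ true → φ⁻¹ x (φ x μ) ≡ μ
φ⁻¹-φ x μ h = monomial-ext go
  where
  go : ∀ y → occupied (φ⁻¹ x (φ x μ)) y ≡ occupied μ y
  go y with y ℤP.≟ x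
  ... | yes refl = trans (occupied-fill-≡ x (down (φ x μ))) (sym h)
  ... | no ne = trans (occupied-fill-≢ x y (down (φ x μ)) ne) (trans (occupied-down (φ x μ) y) (occupied-φ-≢ x y μ ne))

φ-φ⁻¹ : ∀ x ν → occupied ν (ℤ.suc x) ≡ false → φ x (φ⁻¹ x ν) ≡ ν
-- The occupation of `φ x μ` is described at successor sites only; every site is the successor of
-- its predecessor.
φ-φ⁻¹ x ν h = monomial-ext λ z → subst (λ z → occupied (φ x (φ⁻¹ x ν)) z ≡ occupied ν z) (ℤP.suc-pred z) (go (ℤ.pred z))
  where
  go : ∀ y → occupied (φ x (φ⁻¹ x ν)) (ℤ.suc y) ≡ occupied ν (ℤ.suc y)
  go y with y ℤP.≟ x
  ... | yes refl = trans (occupied-φ-≡ x (φ⁻¹ x ν)) (sym h)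
  ... | no ne = trans (occupied-φ-≢ x y (φ⁻¹ x ν) ne) (trans (occupied-fill-≢ x y (down ν) ne) (occupied-down ν y))

-- The recursion behind `descendingBelow` without its proof components, so that membership and
-- uniqueness can be shown by induction and transported along `list`.
lists : ℕ → List (List ℕ)
lists zero = [] ∷ []
lists (suc k) = map (k ∷_) (lists k) ++ lists k

Below : ℕ → Set
Below k = Σ[ xs ∈ List ℕ ] (AllPairs ℕ._>_ xs × All (ℕ._< k) xs)

-- The local function of descendingBelow has no name in scope; unification finds its value.
unfolded : ∀ k → Σ[ L ∈ List (Below k) ] (map (list ∘ proj₁) (descendingBelow k) ≡ map proj₁ L)
unfolded k = _ , sym (LP.map-∘ _)

below-lists : ∀ k → map proj₁ (proj₁ (unfolded k)) ≡ lists k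
below-lists zero = refl
below-lists (suc k) = trans (LP.map-++ proj₁ (map with-k L) (map without-k L))
  (cong₂ _++_ (trans (trans (sym (LP.map-∘ L)) (LP.map-∘ L)) (cong (map (k ∷_)) (below-lists k)))
    (trans (sym (LP.map-∘ L)) (below-lists k)))
  where
  L : List (Below k)
  L = proj₁ (unfolded k)
  with-k without-k : Below k → Below (suc k)
  with-k (xs , d , b) = k ∷ xs , b ∷ d , ℕP.n<1+n k ∷ All.map ℕP.m<n⇒m<1+n b
  without-k (xs , d , b) = xs , d , All.map ℕP.m<n⇒m<1+n b

-- Charge and energy under particle removal

weight : List ℕ → ℕ
weight xs = sum (map (λ n → 2 ℕ.* n ℕ.+ 1) xs)

weight-↭ : ∀ {xs ys} → xs ↭ ys → weight xs ≡ weight ys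
weight-↭ p = SumP.sum-↭ (↭P.map⁺ _ p)

weight-suc : ∀ xs → weight (map suc xs) ≡ weight xs ℕ.+ 2 ℕ.* length xs
weight-suc [] = refl
weight-suc (x ∷ xs) = trans (cong (2 ℕ.* suc x ℕ.+ 1 ℕ.+_) (weight-suc xs))
  (solve 3 (λ x w l → con 2 :* (con 1 :+ x) :+ con 1 :+ (w :+ con 2 :* l) := con 2 :* x :+ con 1 :+ w :+ con 2 :* (con 1 :+ l)) refl
    x (weight xs) (length xs))
  where open ℕS.+-*-Solver

length-raise : ∀ b d → length (list (raise b d)) ≡ length (list d) ℕ.+ (if b then 0 else 1)
length-raise true (descending xs _) = trans (LP.length-map suc xs) (sym (ℕP.+-identityʳ _))
length-raise false (descending xs _) = trans (LP.length-++ (map suc xs)) (cong (ℕ._+ 1) (LP.length-map suc xs))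

weight-raise : ∀ b d → weight (list (raise b d)) ≡ weight (list d) ℕ.+ 2 ℕ.* length (list d) ℕ.+ (if b then 0 else 1)
weight-raise true (descending xs _) = trans (weight-suc xs) (sym (ℕP.+-identityʳ _))
weight-raise false (descending xs _) = trans (trans (cong sum (LP.map-++ _ (map suc xs) (0 ∷ []))) (SumP.sum-++ (map _ (map suc xs)) _))
  (cong (ℕ._+ 1) (weight-suc xs))

lower-↭ : ∀ d → list d ↭ (if mem 0 d then 0 ∷ [] else []) ++ map suc (list (lower d))
lower-↭ d = go (mem 0 d) refl
  where
  u' : Unique (map suc (list (lower d)))
  u' = UniqueP.map⁺ ℕP.suc-injective (unique (lower d))
  back : ∀ {z} → z ∈ map suc (list (lower d)) → z ∈ list d
  back m with ∈P.∈-map⁻ suc m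
  ... | _ , m' , refl = ∈-lower⁻ (list d) m'
  go : ∀ b → mem 0 d ≡ b → list d ↭ (if b then 0 ∷ [] else []) ++ map suc (list (lower d))
  go true e = unique-↭ (unique d) (All.tabulate (λ m e' → ℕP.0≢1+n (trans e' (proj₂ (proj₂ (∈P.∈-map⁻ suc m))))) ∷ u') f g
    where
    f : ∀ {z} → z ∈ list d → z ∈ 0 ∷ map suc (list (lower d))
    f {zero} _ = here refl
    f {suc z} m = there (∈P.∈-map⁺ suc (∈-lower⁺ (list d) m))
    g : ∀ {z} → z ∈ 0 ∷ map suc (list (lower d)) → z ∈ list d
    g (here refl) = true-mem {0} {d} e
    g (there m) = back m
  go false e = unique-↭ (unique d) u' f back
    where
    f : ∀ {z} → z ∈ list d → z ∈ map suc (list (lower d))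
    f {zero} m = ⊥-elim (false-mem {0} {d} e m)
    f {suc z} m = ∈P.∈-map⁺ suc (∈-lower⁺ (list d) m)

length-lower : ∀ d → length (list d) ≡ (if mem 0 d then 1 else 0) ℕ.+ length (list (lower d))
length-lower d = trans (↭P.↭-length (lower-↭ d)) (go (mem 0 d))
  where
  go : ∀ b → length ((if b then 0 ∷ [] else []) ++ map suc (list (lower d))) ≡ (if b then 1 else 0) ℕ.+ length (list (lower d))
  go true = cong suc (LP.length-map suc (list (lower d)))
  go false = LP.length-map suc (list (lower d))

weight-lower : ∀ d → weight (list d) ≡ (if mem 0 d then 1 else 0) ℕ.+ (weight (list (lower d)) ℕ.+ 2 ℕ.* length (list (lower d)))
weight-lower d = trans (weight-↭ (lower-↭ d)) (go (mem 0 d))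
  where
  go : ∀ b → weight ((if b then 0 ∷ [] else []) ++ map suc (list (lower d))) ≡ (if b then 1 else 0) ℕ.+ (weight (list (lower d)) ℕ.+ 2 ℕ.* length (list (lower d)))
  go true = cong suc (weight-suc (list (lower d)))
  go false = weight-suc (list (lower d))

module ChargeAndEnergy where

  open ℤS.+-*-Solver using (solve; _:=_; _:+_; _:*_; _:-_; :-_; con)

  energy : Monomial → ℤ
  energy μ = + 2L₀ μ

  charge-up : ∀ μ → charge (up μ) ≡ charge μ ℤ.+ + 1
  charge-up (a ∙ b) = go (mem 0 b) (length-raise (mem 0 b) a) (length-lower b)
    where
    go : ∀ t {a' la b' lb} → a' ≡ la ℕ.+ (if t then 0 else 1) → lb ≡ (if t then 1 else 0) ℕ.+ b' →
      + a' ℤ.- + b' ≡ (+ la ℤ.- + lb) ℤ.+ + 1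
    go true {la = la} {b'} refl refl = trans (cong (ℤ._- + b') (ℤP.pos-+ la 0))
      (trans (solve 2 (λ a b → (a :+ con (+ 0)) :- b := (a :- (con (+ 1) :+ b)) :+ con (+ 1)) refl (+ la) (+ b'))
        (cong (λ t → (+ la ℤ.- t) ℤ.+ + 1) (sym (ℤP.pos-+ 1 b'))))
    go false {la = la} {b'} refl refl = trans (cong (ℤ._- + b') (ℤP.pos-+ la 1))
      (solve 2 (λ a b → (a :+ con (+ 1)) :- b := (a :- b) :+ con (+ 1)) refl (+ la) (+ b'))

  -- Each particle gains energy 1 and each hole loses 1, which adds the charge. The site that
  -- crosses the border gives a further ½: either a new particle of energy ½ appears, or a hole of
  -- energy ½ disappears where 1 was charged. The formula is doubled.
  energy-up : ∀ μ → energy (up μ) ≡ energy μ ℤ.+ (+ 2 ℤ.* charge μ ℤ.+ + 1)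
  energy-up (a ∙ b) = go (mem 0 b) (weight-raise (mem 0 b) a) (length-lower b) (weight-lower b)
    where
    go : ∀ t {wa' wa la wb wb' lb lb'} → wa' ≡ wa ℕ.+ 2 ℕ.* la ℕ.+ (if t then 0 else 1) → lb ≡ (if t then 1 else 0) ℕ.+ lb' →
      wb ≡ (if t then 1 else 0) ℕ.+ (wb' ℕ.+ 2 ℕ.* lb') →
      + (wa' ℕ.+ wb') ≡ + (wa ℕ.+ wb) ℤ.+ (+ 2 ℤ.* (+ la ℤ.- + lb) ℤ.+ + 1)
    cast : ∀ wa la t wb' → + (wa ℕ.+ 2 ℕ.* la ℕ.+ t ℕ.+ wb') ≡ + wa ℤ.+ + 2 ℤ.* + la ℤ.+ + t ℤ.+ + wb'
    cast wa la t wb' = trans (ℤP.pos-+ (wa ℕ.+ 2 ℕ.* la ℕ.+ t) wb') (cong (ℤ._+ + wb') (trans (ℤP.pos-+ (wa ℕ.+ 2 ℕ.* la) t)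
      (cong (ℤ._+ + t) (trans (ℤP.pos-+ wa (2 ℕ.* la)) (cong (λ z → + wa ℤ.+ z) (ℤP.pos-* 2 la))))))
    cast' : ∀ wa t wb' lb' → + (wa ℕ.+ (t ℕ.+ (wb' ℕ.+ 2 ℕ.* lb'))) ≡ + wa ℤ.+ (+ t ℤ.+ (+ wb' ℤ.+ + 2 ℤ.* + lb'))
    cast' wa t wb' lb' = trans (ℤP.pos-+ wa _) (cong (λ z → + wa ℤ.+ z) (trans (ℤP.pos-+ t _) (cong (λ z → + t ℤ.+ z)
      (trans (ℤP.pos-+ wb' (2 ℕ.* lb')) (cong (λ z → + wb' ℤ.+ z) (ℤP.pos-* 2 lb'))))))
    go true {wa = wa} {la} {wb' = wb'} {lb' = lb'} refl refl refl = trans (cast wa la 0 wb')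
      (trans (solve 4 (λ wa la wb' lb' → wa :+ con (+ 2) :* la :+ con (+ 0) :+ wb'
                := wa :+ (con (+ 1) :+ (wb' :+ con (+ 2) :* lb')) :+ (con (+ 2) :* (la :- (con (+ 1) :+ lb')) :+ con (+ 1))) refl
                (+ wa) (+ la) (+ wb') (+ lb'))
        (cong₂ (λ s t → s ℤ.+ (+ 2 ℤ.* (+ la ℤ.- t) ℤ.+ + 1)) (sym (cast' wa 1 wb' lb')) (sym (ℤP.pos-+ 1 lb'))))
    go false {wa = wa} {la} {wb' = wb'} {lb' = lb'} refl refl refl = trans (cast wa la 1 wb')
      (trans (solve 4 (λ wa la wb' lb' → wa :+ con (+ 2) :* la :+ con (+ 1) :+ wb'
                := wa :+ (con (+ 0) :+ (wb' :+ con (+ 2) :* lb')) :+ (con (+ 2) :* (la :- lb') :+ con (+ 1))) refl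
                (+ wa) (+ la) (+ wb') (+ lb'))
        (cong (λ s → s ℤ.+ (+ 2 ℤ.* (+ la ℤ.- + lb') ℤ.+ + 1)) (sym (cast' wa 0 wb' lb'))))

  private
    not-true : ∀ {b} → not b ≡ true → b ≡ false
    not-true {false} _ = refl

    fill-particle : ∀ n a b → n ∈ list a →
      charge (a ∙ b) ≡ charge (remove n a ∙ b) ℤ.+ + 1 × energy (a ∙ b) ≡ energy (remove n a ∙ b) ℤ.+ (+ 2 ℤ.* + suc n ℤ.- + 1)
    fill-particle n a b m = go {lb = length (list b)} (↭P.↭-length (remove-↭ n a m)) (weight-↭ (remove-↭ n a m))
      where
      go : ∀ {la la' lb wa wa' wb} → la ≡ suc la' → wa ≡ 2 ℕ.* n ℕ.+ 1 ℕ.+ wa' →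
        (+ la ℤ.- + lb ≡ (+ la' ℤ.- + lb) ℤ.+ + 1) × (+ (wa ℕ.+ wb) ≡ + (wa' ℕ.+ wb) ℤ.+ (+ 2 ℤ.* + suc n ℤ.- + 1))
      go {la' = la'} {lb} {wa' = wa'} {wb} refl refl =
        trans (cong (ℤ._- + lb) (ℤP.pos-+ 1 la')) (solve 2 (λ a b → (con (+ 1) :+ a) :- b := (a :- b) :+ con (+ 1)) refl (+ la') (+ lb)) ,
        trans (trans (ℤP.pos-+ (2 ℕ.* n ℕ.+ 1 ℕ.+ wa') wb) (cong (ℤ._+ + wb) (trans (ℤP.pos-+ (2 ℕ.* n ℕ.+ 1) wa') (cong (ℤ._+ + wa')
            (trans (ℤP.pos-+ (2 ℕ.* n) 1) (cong (ℤ._+ + 1) (ℤP.pos-* 2 n)))))))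
          (trans (solve 3 (λ n w w' → con (+ 2) :* n :+ con (+ 1) :+ w :+ w' := (w :+ w') :+ (con (+ 2) :* (con (+ 1) :+ n) :- con (+ 1))) refl
              (+ n) (+ wa') (+ wb))
            (cong₂ (λ s t → s ℤ.+ (+ 2 ℤ.* t ℤ.- + 1)) (sym (ℤP.pos-+ wa' wb)) (sym (ℤP.pos-+ 1 n))))

    fill-hole : ∀ n a b → n ∉ list b →
      charge (a ∙ b) ≡ charge (a ∙ insert n b) ℤ.+ + 1 × energy (a ∙ b) ≡ energy (a ∙ insert n b) ℤ.+ (+ 2 ℤ.* (ℤ.- + n) ℤ.- + 1)
    fill-hole n a b m = go (↭P.↭-length (insert-↭ n b m)) (weight-↭ (insert-↭ n b m))
      where
      go : ∀ {la lb lb' wa wb wb'} → lb' ≡ suc lb → wb' ≡ 2 ℕ.* n ℕ.+ 1 ℕ.+ wb →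
        (+ la ℤ.- + lb ≡ (+ la ℤ.- + lb') ℤ.+ + 1) × (+ (wa ℕ.+ wb) ≡ + (wa ℕ.+ wb') ℤ.+ (+ 2 ℤ.* (ℤ.- + n) ℤ.- + 1))
      go {la} {lb} {wa = wa} {wb} refl refl =
        trans (solve 2 (λ a b → a :- b := (a :- (con (+ 1) :+ b)) :+ con (+ 1)) refl (+ la) (+ lb))
          (cong (λ t → (+ la ℤ.- t) ℤ.+ + 1) (sym (ℤP.pos-+ 1 lb))) ,
        trans (ℤP.pos-+ wa wb) (trans
          (solve 3 (λ n w w' → w :+ w' := (w :+ (con (+ 2) :* n :+ con (+ 1) :+ w')) :+ (con (+ 2) :* (:- n) :- con (+ 1))) refl (+ n) (+ wa) (+ wb))
          (cong (ℤ._+ (+ 2 ℤ.* (ℤ.- + n) ℤ.- + 1)) (sym (trans (ℤP.pos-+ wa _) (cong (λ z → + wa ℤ.+ z)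
            (trans (ℤP.pos-+ (2 ℕ.* n ℕ.+ 1) wb) (cong (ℤ._+ + wb) (trans (ℤP.pos-+ (2 ℕ.* n) 1) (cong (ℤ._+ + 1) (ℤP.pos-* 2 n))))))))))

  -- A particle at site x contributes energy x - ½ on both sides of the border: n + ½ for x = n + 1,
  -- and for x = -m the missing hole of energy m + ½.
  charge-energy-vacate : ∀ x μ → occupied μ x ≡ true →
    charge μ ≡ charge (vacate x μ) ℤ.+ + 1 × energy μ ≡ energy (vacate x μ) ℤ.+ (+ 2 ℤ.* x ℤ.- + 1)
  charge-energy-vacate (+ suc n) (a ∙ b) h = fill-particle n a b (true-mem {n} {a} h)
  charge-energy-vacate (+ zero) (a ∙ b) h = fill-hole 0 a b (false-mem {0} {b} (not-true h))
  charge-energy-vacate -[1+ n ] (a ∙ b) h = fill-hole (suc n) a b (false-mem {suc n} {b} (not-true h))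

  charge-φ : ∀ x μ → occupied μ x ≡ true → charge (φ x μ) ≡ charge μ
  charge-φ x μ h = trans (charge-up (vacate x μ)) (sym (proj₁ (charge-energy-vacate x μ h)))

  -- Vacating x costs x - ½ and leaves charge -1; moving up then adds -1 + ½. The total loss is x,
  -- the exponent of `q` in the recurrence.
  energy-φ : ∀ x μ → occupied μ x ≡ true → charge μ ≡ + 0 → energy μ ≡ energy (φ x μ) ℤ.+ + 2 ℤ.* x
  energy-φ x μ h c0 =
    trans eμ (trans (solve 3 (λ e x c → e :+ (con (+ 2) :* x :- con (+ 1)) := e :+ (con (+ 2) :* c :+ con (+ 1)) :+ con (+ 2) :* x :- con (+ 2) :* (c :+ con (+ 1))) refl
        (energy ν) x (charge ν))
      (trans (cong₂ (λ s t → s ℤ.+ + 2 ℤ.* x ℤ.- + 2 ℤ.* t) (sym (energy-up ν)) (trans (sym cμ) c0))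
        (solve 2 (λ e x → e :+ con (+ 2) :* x :- con (+ 2) :* con (+ 0) := e :+ con (+ 2) :* x) refl (energy (φ x μ)) x)))
    where
    ν = vacate x μ
    cμ = proj₁ (charge-energy-vacate x μ h)
    eμ = proj₂ (charge-energy-vacate x μ h)

  +-cancelʳ : ∀ k i j → i ℤ.+ k ≡ j ℤ.+ k → i ≡ j
  +-cancelʳ k i j e = trans (lem i k) (trans (cong (ℤ._- k) e) (sym (lem j k)))
    where
    lem : ∀ i k → i ≡ i ℤ.+ k ℤ.- k
    lem = solve 2 (λ i k → i := i :+ k :- k) refl

open ChargeAndEnergy

-- The basis of one level of charge 0

descendings : ℕ → List Descending
descendings k = map proj₁ (descendingBelow k)

map-list-descendings : ∀ k → map list (descendings k) ≡ lists k
map-list-descendings k = trans (sym (LP.map-∘ (descendingBelow k))) (trans (proj₂ (unfolded k)) (below-lists k))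

∈-lists⁺ : ∀ k {xs} → AllPairs ℕ._>_ xs → All (ℕ._< k) xs → xs ∈ lists k
∈-lists⁺ zero [] [] = here refl
∈-lists⁺ zero (_ ∷ _) (() ∷ _)
∈-lists⁺ (suc k) [] [] = ∈P.∈-++⁺ʳ (map (k ∷_) (lists k)) (∈-lists⁺ k [] [])
∈-lists⁺ (suc k) {x ∷ xs} (x> ∷ d) (x<1+k ∷ b) with ℕP.m≤n⇒m<n∨m≡n (ℕP.≤-pred x<1+k)
... | inj₁ x<k = ∈P.∈-++⁺ʳ (map (k ∷_) (lists k)) (∈-lists⁺ k (x> ∷ d) (x<k ∷ All.map (λ y<x → ℕP.<-trans y<x x<k) x>))
... | inj₂ refl = ∈P.∈-++⁺ˡ (∈P.∈-map⁺ (k ∷_) (∈-lists⁺ k d x>))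

lists-bounded : ∀ k {xs} → xs ∈ lists k → All (ℕ._< k) xs
lists-bounded zero (here refl) = []
lists-bounded (suc k) m with ∈P.∈-++⁻ (map (k ∷_) (lists k)) m
... | inj₂ m' = All.map ℕP.m<n⇒m<1+n (lists-bounded k m')
... | inj₁ m' with ∈P.∈-map⁻ (k ∷_) m'
...   | _ , m'' , refl = ℕP.n<1+n k ∷ All.map ℕP.m<n⇒m<1+n (lists-bounded k m'')

unique-lists : ∀ k → Unique (lists k)
unique-lists zero = [] ∷ []
unique-lists (suc k) = UniqueP.++⁺ (UniqueP.map⁺ LP.∷-injectiveʳ (unique-lists k)) (unique-lists k) disjoint
  where
  disjoint : ∀ {xs} → ¬ (xs ∈ map (k ∷_) (lists k) × xs ∈ lists k)
  disjoint (m , m') with ∈P.∈-map⁻ (k ∷_) m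
  ... | _ , _ , refl = ℕP.<-irrefl refl (All.head (lists-bounded k m'))

unique-descendings : ∀ k → Unique (descendings k)
unique-descendings k = UniqueP.map⁻ (subst Unique (sym (map-list-descendings k)) (unique-lists k))

∈-descendings : ∀ k d → All (ℕ._< k) (list d) → d ∈ descendings k
∈-descendings k d b with ∈P.∈-map⁻ list (subst (list d ∈_) (sym (map-list-descendings k)) (∈-lists⁺ k (sorted d) b))
... | d' , m , e = subst (_∈ descendings k) (sym (list-injective e)) m

private
  OnShell : ℕ → Monomial → Set
  OnShell N μ = charge μ ≡ + 0 × 2L₀ μ ≡ 2 ℕ.* N

  onShell? : ∀ N μ → Dec (OnShell N μ)
  onShell? N μ = (charge μ ℤP.≟ + 0) ×-dec (2L₀ μ ℕP.≟ 2 ℕ.* N)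

unique-basis : ∀ N → Unique (basis₀ N)
unique-basis N = UniqueP.filter⁺ (onShell? N)
  (UniqueP.cartesianProductWith⁺ _∙_ (λ { refl → refl , refl }) (unique-descendings N) (unique-descendings N))

basis⁻ : ∀ N {μ} → μ ∈ basis₀ N → charge μ ≡ + 0 × 2L₀ μ ≡ 2 ℕ.* N
basis⁻ N m = proj₂ (∈P.∈-filter⁻ (onShell? N) {xs = cartesianProductWith _∙_ (descendings N) (descendings N)} m)

entry≤weight : ∀ {n xs} → n ∈ xs → 2 ℕ.* n ℕ.+ 1 ℕ.≤ weight xs
entry≤weight {n} {x ∷ xs} (here refl) = ℕP.m≤m+n _ _
entry≤weight {n} {x ∷ xs} (there m) = ℕP.≤-trans (entry≤weight m) (ℕP.m≤n+m _ _)

charge-0 : ∀ μ → charge μ ≡ + 0 → length (list (ns μ)) ≡ length (list (ms μ))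
charge-0 μ c0 = ℤP.+-injective (ℤP.i-j≡0⇒i≡j _ _ c0)

private
  module ℕR = ℕS.+-*-Solver

  1≤weight : ∀ {n : ℕ} {xs ys : List ℕ} → n ∈ xs → length xs ≡ length ys → 1 ℕ.≤ weight ys
  1≤weight {xs = x ∷ xs} {y ∷ ys} _ _ = ℕP.≤-trans (ℕP.m≤n+m 1 (2 ℕ.* y)) (ℕP.m≤m+n _ _)

  entry< : ∀ n N {w w'} → 2 ℕ.* n ℕ.+ 1 ℕ.≤ w → 1 ℕ.≤ w' → w ℕ.+ w' ≡ 2 ℕ.* N → n ℕ.< N
  entry< n N h k e = ℕP.*-cancelˡ-≤ 2 (ℕP.≤-trans (ℕP.≤-reflexive
    (ℕR.solve 1 (λ n → ℕR.con 2 ℕR.:* (ℕR.con 1 ℕR.:+ n)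
      ℕR.:= (ℕR.con 2 ℕR.:* n ℕR.:+ ℕR.con 1) ℕR.:+ ℕR.con 1) refl n))
    (subst (2 ℕ.* n ℕ.+ 1 ℕ.+ 1 ℕ.≤_) e (ℕP.+-mono-≤ h k)))

-- At charge 0 a particle of energy n + ½ is accompanied by a hole of energy at least ½, and
-- conversely, so n + 1 is at most N. This makes the finite search in `basis₀` complete.
entries-< : ∀ N μ → charge μ ≡ + 0 → 2L₀ μ ≡ 2 ℕ.* N → All (ℕ._< N) (list (ns μ)) × All (ℕ._< N) (list (ms μ))
entries-< N μ@(a ∙ b) c0 e =
  All.tabulate (λ {n} m → entry< n N (entry≤weight m) (1≤weight {ys = list b} m (charge-0 μ c0)) e) ,
  All.tabulate (λ {n} m → entry< n N (entry≤weight m) (1≤weight {ys = list a} m (sym (charge-0 μ c0))) (trans (ℕP.+-comm (weight (list b)) _) e))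

basis⁺ : ∀ N {μ} → charge μ ≡ + 0 → 2L₀ μ ≡ 2 ℕ.* N → μ ∈ basis₀ N
basis⁺ N {μ@(a ∙ b)} c0 e = let ba , bb = entries-< N μ c0 e in ∈P.∈-filter⁺ (onShell? N)
  (∈P.∈-cartesianProductWith⁺ _∙_ (∈-descendings N a ba) (∈-descendings N b bb)) (c0 , e)

-- Counting by bijection

module _ {A : Set} where

  count-split : ∀ {P : A → Set} (P? : ∀ x → Dec (P x)) (b : A → Bool) xs →
    length (filter P? xs) ≡ length (filter (λ x → P? x ×-dec (b x BoolP.≟ false)) xs) ℕ.+ length (filter (λ x → P? x ×-dec (b x BoolP.≟ true)) xs)
  count-split P? b [] = refl
  count-split P? b (x ∷ xs) with does (P? x) | b x
  ... | false | _ = count-split P? b xs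
  ... | true | false = cong suc (count-split P? b xs)
  ... | true | true = trans (cong suc (count-split P? b xs)) (sym (ℕP.+-suc _ _))

  unique-map : ∀ {B : Set} (f : A → B) (g : B → A) {xs} → (∀ {x} → x ∈ xs → g (f x) ≡ x) → Unique xs → Unique (map f xs)
  unique-map f g h [] = []
  unique-map f g h (x∉ ∷ u) = AllP.map⁺ (All.tabulate λ m e →
      All.lookup x∉ m (trans (sym (h (here refl))) (trans (cong g e) (h (there m))))) ∷ unique-map f g (λ m → h (there m)) u

  count-bijection : ∀ {B : Set} {xs : List A} {ys : List B} {P : A → Set} {Q : B → Set} (P? : ∀ x → Dec (P x)) (Q? : ∀ y → Dec (Q y))
    (f : A → B) (g : B → A) → Unique xs → Unique ys →
    (∀ {x} → x ∈ xs → P x → f x ∈ ys × Q (f x) × g (f x) ≡ x) →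
    (∀ {y} → y ∈ ys → Q y → g y ∈ xs × P (g y) × f (g y) ≡ y) →
    length (filter P? xs) ≡ length (filter Q? ys)
  count-bijection {B} {xs} {ys} P? Q? f g ux uy to from = trans (sym (LP.length-map f (filter P? xs)))
    (↭P.↭-length (unique-↭ (unique-map f g (λ m → let m' , p = ∈P.∈-filter⁻ P? {xs = xs} m in proj₂ (proj₂ (to m' p))) (UniqueP.filter⁺ P? ux))
      (UniqueP.filter⁺ Q? uy) forth back))
    where
    forth : ∀ {z} → z ∈ map f (filter P? xs) → z ∈ filter Q? ys
    forth m with ∈P.∈-map⁻ f m
    ... | x , m' , refl = let m'' , p = ∈P.∈-filter⁻ P? {xs = xs} m' in
      ∈P.∈-filter⁺ Q? (proj₁ (to m'' p)) (proj₁ (proj₂ (to m'' p)))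
    back : ∀ {z} → z ∈ filter Q? ys → z ∈ map f (filter P? xs)
    back {z} m = let m' , q = ∈P.∈-filter⁻ Q? {xs = ys} m
                     a , p , e = from m' q
      in subst (_∈ map f (filter P? xs)) e (∈P.∈-map⁺ f (∈P.∈-filter⁺ P? a p))

  count-≐ : ∀ {P Q : A → Set} (P? : ∀ x → Dec (P x)) (Q? : ∀ x → Dec (Q x)) xs →
    (∀ {x} → x ∈ xs → P x → Q x) → (∀ {x} → x ∈ xs → Q x → P x) → length (filter P? xs) ≡ length (filter Q? xs)
  count-≐ P? Q? [] f g = refl
  count-≐ P? Q? (x ∷ xs) f g with P? x | Q? x
  ... | yes _ | yes _ = cong suc (count-≐ P? Q? xs (λ m → f (there m)) (λ m → g (there m)))
  ... | no _ | no _ = count-≐ P? Q? xs (λ m → f (there m)) (λ m → g (there m))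
  ... | yes p | no ¬q = ⊥-elim (¬q (f (here refl) p))
  ... | no ¬p | yes q = ⊥-elim (¬p (g (here refl) q))

  count-none : ∀ {P : A → Set} (P? : ∀ x → Dec (P x)) xs → (∀ {x} → x ∈ xs → ¬ P x) → length (filter P? xs) ≡ 0
  count-none P? xs h = cong length (LP.filter-none P? (All.tabulate h))

count : {P : Monomial → Set} → (∀ μ → Dec (P μ)) → ℕ → ℕ
count P? N = length (filter P? (basis₀ N))

-- `Q` is what `P` turns into when the particle at x is removed. Removal lowers the level by x, so
-- the monomials of level N with x occupied match those of level N - x satisfying `Q`. The
-- recurrence for sets of empty sites and the one for partitions with bounded parts are both
-- instances. Where one of the two levels would be negative there is nothing to match; `count-below`
-- and `count-negative` record this.
module ShiftCount (x : ℤ) {P Q : Monomial → Set} (P? : ∀ μ → Dec (P μ)) (Q? : ∀ μ → Dec (Q μ))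
  (P⇒Q : ∀ μ → occupied μ x ≡ true → P μ → Q (φ x μ))
  (Q⇒P : ∀ μ → occupied μ x ≡ true → Q (φ x μ) → P μ)
  (Q⇒empty : ∀ ν → Q ν → occupied ν (ℤ.suc x) ≡ false) where

  empty? : ∀ μ → Dec (P μ × occupied μ x ≡ false)
  empty? μ = P? μ ×-dec (occupied μ x BoolP.≟ false)

  full? : ∀ μ → Dec (P μ × occupied μ x ≡ true)
  full? μ = P? μ ×-dec (occupied μ x BoolP.≟ true)

  shell-φ : ∀ N μ → occupied μ x ≡ true → charge μ ≡ + 0 → 2L₀ μ ≡ 2 ℕ.* N → + 2 ℤ.* + N ≡ energy (φ x μ) ℤ.+ + 2 ℤ.* x
  shell-φ N μ o c0 e = trans (trans (sym (ℤP.pos-* 2 N)) (cong +_ (sym e))) (energy-φ x μ o c0)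

  shell-φ⁻¹ : ∀ M ν → Q ν → charge ν ≡ + 0 → 2L₀ ν ≡ 2 ℕ.* M → energy (φ⁻¹ x ν) ≡ + 2 ℤ.* (+ M ℤ.+ x)
  shell-φ⁻¹ M ν qν c0 e = trans (energy-φ x μ (occupied-fill-≡ x (down ν)) (trans (sym (charge-φ x μ (occupied-fill-≡ x (down ν)))) (trans (cong charge back) c0)))
    (trans (cong (ℤ._+ + 2 ℤ.* x) (trans (cong energy back) (trans (cong +_ e) (ℤP.pos-* 2 M)))) (sym (ℤP.*-distribˡ-+ (+ 2) (+ M) x)))
    where
    μ = φ⁻¹ x ν
    back : φ x μ ≡ ν
    back = φ-φ⁻¹ x ν (Q⇒empty ν qν)

  charge-φ⁻¹ : ∀ ν → Q ν → charge (φ⁻¹ x ν) ≡ charge ν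
  charge-φ⁻¹ ν qν = trans (sym (charge-φ x (φ⁻¹ x ν) (occupied-fill-≡ x (down ν)))) (cong charge (φ-φ⁻¹ x ν (Q⇒empty ν qν)))

  count-full : ∀ N M → + N ≡ + M ℤ.+ x → count full? N ≡ count Q? M
  count-full N M N≡M+x = count-bijection full? Q? (φ x) (φ⁻¹ x) (unique-basis N) (unique-basis M)
    (λ {μ} m (p , o) → let c0 , e = basis⁻ N m in
      basis⁺ M (trans (charge-φ x μ o) c0)
        (ℤP.+-injective (trans (+-cancelʳ (+ 2 ℤ.* x) (energy (φ x μ)) (+ 2 ℤ.* + M)
          (trans (sym (shell-φ N μ o c0 e)) (trans (cong (+ 2 ℤ.*_) N≡M+x) (ℤP.*-distribˡ-+ (+ 2) (+ M) x)))) (sym (ℤP.pos-* 2 M)))) ,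
      P⇒Q μ o p , φ⁻¹-φ x μ o)
    (λ {ν} m q → let c0 , e = basis⁻ M m
                     o = occupied-fill-≡ x (down ν)
                     back = φ-φ⁻¹ x ν (Q⇒empty ν q) in
      basis⁺ N (trans (charge-φ⁻¹ ν q) c0)
        (ℤP.+-injective (trans (shell-φ⁻¹ M ν q c0 e) (trans (cong (+ 2 ℤ.*_) (sym N≡M+x)) (sym (ℤP.pos-* 2 N))))) ,
      (Q⇒P (φ⁻¹ x ν) o (subst Q (sym back) q) , o) , back)

  count-shift : ∀ N M → + N ≡ + M ℤ.+ x → count P? N ≡ count empty? N ℕ.+ count Q? M
  count-shift N M e = trans (count-split P? (λ μ → occupied μ x) (basis₀ N)) (cong (count empty? N ℕ.+_) (count-full N M e))

  count-below : ∀ N → + N ℤ.< x → count P? N ≡ count empty? N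
  count-below N N<x = trans (count-split P? (λ μ → occupied μ x) (basis₀ N)) (trans (cong (count empty? N ℕ.+_)
    (count-none full? (basis₀ N) λ {μ} m (p , o) → let c0 , e = basis⁻ N m in
      ℤP.<-irrefl (shell-φ N μ o c0 e) (ℤP.<-≤-trans (ℤP.*-monoˡ-<-pos (+ 2) N<x)
        (ℤP.≤-trans (ℤP.≤-reflexive (sym (ℤP.+-identityˡ (+ 2 ℤ.* x)))) (ℤP.+-monoˡ-≤ (+ 2 ℤ.* x) (ℤ.+≤+ ℕ.z≤n))))))
    (ℕP.+-identityʳ _))

  count-negative : ∀ M → + M ℤ.+ x ℤ.< + 0 → count Q? M ≡ 0
  count-negative M h = count-none Q? (basis₀ M) λ {ν} m q → let c0 , e = basis⁻ M m in
    ℤP.<-irrefl (sym (shell-φ⁻¹ M ν q c0 e)) (ℤP.<-≤-trans (ℤP.*-monoˡ-<-pos (+ 2) h) (ℤ.+≤+ ℕ.z≤n))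

open ℚS.+-*-Solver using (solve; _:=_; _:+_; _:*_; _:-_; :-_; con)

-- Real numbers

-- Polynomial inequalities are proved by a certificate: the difference of the two sides is rewritten
-- by the ring solver as a sum of products of nonnegative factors.
≤-by : ∀ {p q} r → 0ℚ ℚ.≤ r → q ℚ.- p ≡ r → p ℚ.≤ q
≤-by {p} {q} r 0≤r eq = subst₂ ℚ._≤_ (ℚP.+-identityʳ p)
  (solve 2 (λ p q → p :+ (q :- p) := q) refl p q)
  (ℚP.+-monoʳ-≤ p (subst (0ℚ ℚ.≤_) (sym eq) 0≤r))

p≤q⇒0≤q-p : ∀ {p q} → p ℚ.≤ q → 0ℚ ℚ.≤ q ℚ.- p
p≤q⇒0≤q-p {p} {q} h = subst (ℚ._≤ q ℚ.- p) (ℚP.+-inverseʳ p) (ℚP.+-monoˡ-≤ (ℚ.- p) h)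

0≤* : ∀ {p q} → 0ℚ ℚ.≤ p → 0ℚ ℚ.≤ q → 0ℚ ℚ.≤ p ℚ.* q
0≤* {p} {q} hp hq = subst (ℚ._≤ p ℚ.* q) (ℚP.*-zeroˡ q) (ℚP.*-monoʳ-≤-nonNeg q {{ℚ.nonNegative hq}} hp)

0≤+ : ∀ {p q} → 0ℚ ℚ.≤ p → 0ℚ ℚ.≤ q → 0ℚ ℚ.≤ p ℚ.+ q
0≤+ hp hq = ℚP.+-mono-≤ hp hq

∣p∣≤⇒p≤ : ∀ {p c} → ℚ.∣ p ∣ ℚ.≤ c → p ℚ.≤ c
∣p∣≤⇒p≤ {p} h with ℚP.∣p∣≡p∨∣p∣≡-p p
... | inj₁ eq = subst (ℚ._≤ _) eq h
... | inj₂ eq with ℚP.≤-total 0ℚ p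
...   | inj₁ 0≤p = subst (ℚ._≤ _) (ℚP.0≤p⇒∣p∣≡p 0≤p) h
...   | inj₂ p≤0 = ℚP.≤-trans p≤0 (ℚP.≤-trans (ℚP.0≤∣p∣ p) h)

∣p∣≤⇒-p≤ : ∀ {p c} → ℚ.∣ p ∣ ℚ.≤ c → ℚ.- p ℚ.≤ c
∣p∣≤⇒-p≤ {p} {c} h = ∣p∣≤⇒p≤ {ℚ.- p} (subst (ℚ._≤ c) (sym (ℚP.∣-p∣≡∣p∣ p)) h)

≤⇒∣p∣≤ : ∀ {p c} → p ℚ.≤ c → ℚ.- p ℚ.≤ c → ℚ.∣ p ∣ ℚ.≤ c
≤⇒∣p∣≤ {p} h k with ℚP.∣p∣≡p∨∣p∣≡-p p
... | inj₁ eq = subst (ℚ._≤ _) (sym eq) h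
... | inj₂ eq = subst (ℚ._≤ _) (sym eq) k

/-mono : ∀ {a b} → a ℕ.≤ b → + a / 1 ℚ.≤ + b / 1
/-mono {a} {b} h = /-≤ a b 0 0 (ℕP.*-monoˡ-≤ 1 h)

suc*1/suc : ∀ b → (+ suc b / 1) ℚ.* (+ 1 / suc b) ≡ 1ℚ
suc*1/suc b = trans (/-* (suc b) b) (ℚP.≤-antisym
  (/-≤ (suc b) 1 b 0 (ℕP.≤-reflexive (ℕP.*-comm (suc b) 1)))
  (/-≤ 1 (suc b) 0 b (ℕP.≤-reflexive (ℕP.*-comm 1 (suc b)))))

-- `num (suc n)` unfolds to a sum that the ring solver can read, whereas `+ suc n / 1` is normalised
-- by a gcd.
num : ℕ → ℚ
num zero = 0ℚ
num (suc n) = num n ℚ.+ 1ℚ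

+/1 : ∀ n → num n ≡ + n / 1
+/1 zero = refl
+/1 (suc n) = trans (cong (ℚ._+ 1ℚ) (+/1 n)) (ℚP.toℚᵘ-injective
  (ℚᵘP.≃-trans (ℚP.toℚᵘ-homo-+ (+ n / 1) 1ℚ)
  (ℚᵘP.≃-trans (ℚᵘP.+-congˡ (mkℚᵘ (+ 1) 0) (ℚP.toℚᵘ-fromℚᵘ (mkℚᵘ (+ n) 0)))
  (ℚᵘP.≃-trans (ℚᵘ.*≡* (cong (ℤ._* + 1) (trans (cong (ℤ._+ + 1) (ℤP.*-identityʳ (+ n))) (cong +_ (ℕP.+-comm n 1)))))
    (ℚᵘP.≃-sym (ℚP.toℚᵘ-fromℚᵘ (mkℚᵘ (+ suc n) 0)))))))

0≤num : ∀ n → 0ℚ ℚ.≤ num n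
0≤num n = subst (0ℚ ℚ.≤_) (sym (+/1 n)) (0≤/ n 0)

num-mono : ∀ {m n} → m ℕ.≤ n → num m ℚ.≤ num n
num-mono {m} {n} h = subst₂ ℚ._≤_ (sym (+/1 m)) (sym (+/1 n)) (/-mono h)

-- A record, like `_≼_`, `Bd` and `_≈_`, so that unification finds the reals involved: unfolded, the
-- statement mentions only their sequences.
record Nonneg (x : ℝ) : Set where
  constructor nonneg
  field 0≤ : 0ℝ ≤ x

infix 4 _≼_ _≈_

record _≼_ (x y : ℝ) : Set where
  constructor le
  field diff : Nonneg (y - x)

-- Absolute value at most c, expressed by two linear inequalities that can be added and multiplied
-- by ring identities.
record Bd (x c : ℝ) : Set where
  constructor bd
  field
    lo : Nonneg (c + x)
    hi : Nonneg (c - x)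

record _≈_ (x y : ℝ) : Set where
  constructor antisym
  field
    above0 : Nonneg (x - y)
    below0 : Nonneg (y - x)

nn-intro : ∀ {x} → (∀ ε → 0ℚ ℚ.< ε → Σ[ N ∈ ℕ ] (∀ n → N ℕ.≤ n → ℚ.- ε ℚ.≤ seq x n)) → Nonneg x
nn-intro {x} h = nonneg λ ε 0<ε → let N , hN = h ε 0<ε in N , λ n N≤n →
  ≤-by (seq x n ℚ.- (ℚ.- ε)) (p≤q⇒0≤q-p (hN n N≤n))
    (solve 2 (λ x e → (x :+ e) :- con 0ℚ := x :- (:- e)) refl (seq x n) ε)

nn-elim : ∀ {x} → Nonneg x → ∀ ε → 0ℚ ℚ.< ε → Σ[ N ∈ ℕ ] (∀ n → N ℕ.≤ n → ℚ.- ε ℚ.≤ seq x n)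
nn-elim {x} (nonneg h) ε 0<ε = let N , hN = h ε 0<ε in N , λ n N≤n →
  ≤-by ((seq x n ℚ.+ ε) ℚ.- 0ℚ) (p≤q⇒0≤q-p (hN n N≤n))
    (solve 2 (λ x e → x :- (:- e) := (x :+ e) :- con 0ℚ) refl (seq x n) ε)

nn-≗ : ∀ {x y} → (∀ n → seq x n ≡ seq y n) → Nonneg x → Nonneg y
nn-≗ h nx = nn-intro λ ε 0<ε → let N , hN = nn-elim nx ε 0<ε in N , λ n N≤n →
  subst (ℚ.- ε ℚ.≤_) (h n) (hN n N≤n)

nn-eventually : ∀ {x} N → (∀ n → N ℕ.≤ n → 0ℚ ℚ.≤ seq x n) → Nonneg x
nn-eventually N h = nn-intro λ ε 0<ε → N , λ n N≤n →
  ℚP.≤-trans (ℚP.neg-antimono-≤ (ℚP.<⇒≤ 0<ε)) (h n N≤n)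

nn-const : ∀ {p} → 0ℚ ℚ.≤ p → Nonneg (fromℚ p)
nn-const h = nn-eventually 0 λ _ _ → h

nn-pointwise : ∀ {x} → (∀ n → 0ℚ ℚ.≤ seq x n) → Nonneg x
nn-pointwise h = nn-eventually 0 λ n _ → h n

nn-square : ∀ x → Nonneg (x * x)
nn-square x = nn-eventually 0 λ n _ → sq (seq x n)
  where
  sq : ∀ p → 0ℚ ℚ.≤ p ℚ.* p
  sq p with ℚP.≤-total 0ℚ p
  ... | inj₁ 0≤p = 0≤* 0≤p 0≤p
  ... | inj₂ p≤0 = subst (0ℚ ℚ.≤_) (solve 1 (λ p → (:- p) :* (:- p) := p :* p) refl p)
    (0≤* (ℚP.neg-antimono-≤ p≤0) (ℚP.neg-antimono-≤ p≤0))

infixl 6 _nn+_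
infixl 7 _nn*_

_nn+_ : ∀ {x y} → Nonneg x → Nonneg y → Nonneg (x + y)
_nn+_ {x} {y} nx ny = nn-intro λ ε 0<ε →
  let h , 0<h , hh = halving ε 0<ε
      N , hN = nn-elim nx h 0<h
      M , hM = nn-elim ny h 0<h
  in N ℕ.+ M , λ n p → subst (ℚ._≤ seq x n ℚ.+ seq y n)
       (trans (solve 1 (λ h → :- h :- h := :- (h :+ h)) refl h) (cong ℚ.-_ hh))
       (ℚP.+-mono-≤ (hN n (ℕP.m+n≤o⇒m≤o N p)) (hM n (ℕP.m+n≤o⇒n≤o N p)))

private
  -- u ≥ -h and v ≥ -h with |u|, |v| ≤ B give uv ≥ -hB, as at most one of u, v matters.
  product-bound : ∀ u v h B → 0ℚ ℚ.≤ h → ℚ.- h ℚ.≤ u → ℚ.- h ℚ.≤ v → ℚ.∣ u ∣ ℚ.≤ B → ℚ.∣ v ∣ ℚ.≤ B →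
    ℚ.- (h ℚ.* B) ℚ.≤ u ℚ.* v
  product-bound u v h B 0≤h hu hv bu bv with ℚP.≤-total 0ℚ u | ℚP.≤-total 0ℚ v
  ... | inj₁ 0≤u | _ = ≤-by (u ℚ.* (v ℚ.- (ℚ.- h)) ℚ.+ h ℚ.* (B ℚ.- u))
    (0≤+ (0≤* 0≤u (p≤q⇒0≤q-p hv)) (0≤* 0≤h (p≤q⇒0≤q-p (∣p∣≤⇒p≤ {u} bu))))
    (solve 4 (λ u v h B → u :* v :- (:- (h :* B)) := u :* (v :- (:- h)) :+ h :* (B :- u)) refl u v h B)
  ... | inj₂ _ | inj₁ 0≤v = ≤-by (v ℚ.* (u ℚ.- (ℚ.- h)) ℚ.+ h ℚ.* (B ℚ.- v))
    (0≤+ (0≤* 0≤v (p≤q⇒0≤q-p hu)) (0≤* 0≤h (p≤q⇒0≤q-p (∣p∣≤⇒p≤ {v} bv))))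
    (solve 4 (λ u v h B → u :* v :- (:- (h :* B)) := v :* (u :- (:- h)) :+ h :* (B :- v)) refl u v h B)
  ... | inj₂ u≤0 | inj₂ v≤0 = ≤-by ((ℚ.- u) ℚ.* (ℚ.- v) ℚ.+ h ℚ.* B)
    (0≤+ (0≤* (ℚP.neg-antimono-≤ u≤0) (ℚP.neg-antimono-≤ v≤0))
         (0≤* 0≤h (ℚP.≤-trans (ℚP.0≤∣p∣ u) bu)))
    (solve 4 (λ u v h B → u :* v :- (:- (h :* B)) := (:- u) :* (:- v) :+ h :* B) refl u v h B)

_nn*_ : ∀ {x y} → Nonneg x → Nonneg y → Nonneg (x * y)
_nn*_ {x} {y} nx ny = nn-intro λ ε 0<ε →
  let b , hb = bounded (seq x) (cauchy x)
      c , hc = bounded (seq y) (cauchy y)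
      B = + suc (b ℕ.+ c) / 1
      h = ε ℚ.* (+ 1 / suc (b ℕ.+ c))
      0<h = 0<* ε (+ 1 / suc (b ℕ.+ c)) 0<ε (0<1/suc (b ℕ.+ c))
      N , hN = nn-elim nx h 0<h
      M , hM = nn-elim ny h 0<h
      hB : h ℚ.* B ≡ ε
      hB = trans (solve 3 (λ e i B → e :* i :* B := e :* (B :* i)) refl ε (+ 1 / suc (b ℕ.+ c)) B)
             (trans (cong (ε ℚ.*_) (suc*1/suc (b ℕ.+ c))) (ℚP.*-identityʳ ε))
  in N ℕ.+ M , λ n p → subst (λ z → ℚ.- z ℚ.≤ seq x n ℚ.* seq y n) hB
       (product-bound (seq x n) (seq y n) h B (ℚP.<⇒≤ 0<h)
         (hN n (ℕP.m+n≤o⇒m≤o N p)) (hM n (ℕP.m+n≤o⇒n≤o N p))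
         (ℚP.≤-trans (hb n) (/-mono (ℕ.s≤s (ℕP.m≤m+n b c))))
         (ℚP.≤-trans (hc n) (/-mono (ℕ.s≤s (ℕP.m≤n+m c b)))))

nn-half : ∀ {x} → Nonneg (x + x) → Nonneg x
nn-half {x} h = nn-≗ (λ n → solve 1 (λ x → con ½ :* (x :+ x) := x) refl (seq x n))
  (nn-const (ℚP.<⇒≤ 0<½) nn* h)

nn-limit : ∀ {x} → (∀ ε → 0ℚ ℚ.< ε → Nonneg (x + fromℚ ε)) → Nonneg x
nn-limit {x} h = nn-intro λ ε 0<ε →
  let d , 0<d , dd = halving ε 0<ε
      N , hN = nn-elim (h d 0<d) d 0<d
  in N , λ n N≤n → ≤-by (seq x n ℚ.+ d ℚ.- (ℚ.- d)) (p≤q⇒0≤q-p (hN n N≤n))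
       (trans (cong (λ z → seq x n ℚ.- (ℚ.- z)) (sym dd))
         (solve 2 (λ x d → x :- (:- (d :+ d)) := x :+ d :- (:- d)) refl (seq x n) d))

nn-const⁻¹ : ∀ {p} → Nonneg (fromℚ p) → 0ℚ ℚ.≤ p
nn-const⁻¹ {p} h with ℚP.<-cmp p 0ℚ
... | tri≈ _ e _ = ℚP.≤-reflexive (sym e)
... | tri> _ _ g = ℚP.<⇒≤ g
... | tri< l _ _ = ⊥-elim (ℚP.<-irrefl refl (ℚP.<-≤-trans d<-p -p≤d))
  where
  half = halving (ℚ.- p) (ℚP.neg-antimono-< l)
  d = proj₁ half
  0<d = proj₁ (proj₂ half)
  dd = proj₂ (proj₂ half)
  d<-p : d ℚ.< ℚ.- p
  d<-p = subst₂ ℚ._<_ (ℚP.+-identityʳ d) dd (ℚP.+-monoʳ-< d 0<d)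
  -p≤d : ℚ.- p ℚ.≤ d
  -p≤d = let N , hN = nn-elim h d 0<d in ≤-by (p ℚ.- (ℚ.- d)) (p≤q⇒0≤q-p (hN N ℕP.≤-refl))
    (solve 2 (λ p d → d :- (:- p) := p :- (:- d)) refl p d)

≼-pt : ∀ {x y r} → Nonneg r → (∀ n → seq y n ℚ.- seq x n ≡ seq r n) → x ≼ y
≼-pt nr h = le (nn-≗ (λ n → sym (h n)) nr)

≼-pointwise : ∀ {x y} → (∀ n → seq x n ℚ.≤ seq y n) → x ≼ y
≼-pointwise h = le (nn-pointwise λ n → p≤q⇒0≤q-p (h n))

≼-refl : ∀ {x} → x ≼ x
≼-refl {x} = ≼-pt (nn-const ℚP.≤-refl) (λ n → ℚP.+-inverseʳ (seq x n))

≼-trans : ∀ {x y z} → x ≼ y → y ≼ z → x ≼ z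
≼-trans {x} {y} {z} (le a) (le b) = le (nn-≗
  (λ n → solve 3 (λ x y z → (y :- x) :+ (z :- y) := z :- x) refl (seq x n) (seq y n) (seq z n)) (a nn+ b))

≼⇒≤ : ∀ {x y} → x ≼ y → x ≤ y
≼⇒≤ {x} {y} (le h) ε 0<ε = let N , hN = nn-elim h ε 0<ε in N , λ n N≤n →
  ≤-by (seq y n ℚ.- seq x n ℚ.- (ℚ.- ε)) (p≤q⇒0≤q-p (hN n N≤n))
    (solve 3 (λ x y e → y :+ e :- x := y :- x :- (:- e)) refl (seq x n) (seq y n) ε)

nn⇒≼ : ∀ {x} → Nonneg x → 0ℝ ≼ x
nn⇒≼ {x} h = le (nn-≗ (λ n → sym (ℚP.+-identityʳ (seq x n))) h)

nn-≼ : ∀ {x y} → Nonneg x → x ≼ y → Nonneg y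
nn-≼ {x} {y} a (le b) = nn-≗ (λ n → solve 2 (λ x y → x :+ (y :- x) := y) refl (seq x n) (seq y n)) (a nn+ b)

≈-pt : ∀ {x y} → (∀ n → seq x n ≡ seq y n) → x ≈ y
≈-pt {x} {y} h = antisym
  (nn-≗ (λ n → sym (trans (cong (ℚ._- seq y n) (h n)) (ℚP.+-inverseʳ (seq y n)))) (nn-const ℚP.≤-refl))
  (nn-≗ (λ n → sym (trans (cong (λ z → seq y n ℚ.- z) (h n)) (ℚP.+-inverseʳ (seq y n)))) (nn-const ℚP.≤-refl))

≈-refl : ∀ {x} → x ≈ x
≈-refl = ≈-pt λ _ → refl

≈-sym : ∀ {x y} → x ≈ y → y ≈ x
≈-sym (antisym a b) = antisym b a

≈⇒≼ : ∀ {x y} → x ≈ y → x ≼ y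
≈⇒≼ (antisym a b) = le b

≼-antisym : ∀ {x y} → x ≼ y → y ≼ x → x ≈ y
≼-antisym (le a) (le b) = antisym b a

≈-trans : ∀ {x y z} → x ≈ y → y ≈ z → x ≈ z
≈-trans p q = ≼-antisym (≼-trans (≈⇒≼ p) (≈⇒≼ q)) (≼-trans (≈⇒≼ (≈-sym q)) (≈⇒≼ (≈-sym p)))

+-cong : ∀ {x x' y y'} → x ≈ x' → y ≈ y' → x + y ≈ x' + y'
+-cong {x} {x'} {y} {y'} (antisym a b) (antisym c d) = antisym (nn-≗ (λ n → lem (seq x n) (seq x' n) (seq y n) (seq y' n)) (a nn+ c))
  (nn-≗ (λ n → lem (seq x' n) (seq x n) (seq y' n) (seq y n)) (b nn+ d))
  where
  lem : ∀ x x' y y' → (x ℚ.- x') ℚ.+ (y ℚ.- y') ≡ (x ℚ.+ y) ℚ.- (x' ℚ.+ y')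
  lem = solve 4 (λ x x' y y' → (x :- x') :+ (y :- y') := (x :+ y) :- (x' :+ y')) refl

neg-cong : ∀ {x x'} → x ≈ x' → - x ≈ - x'
neg-cong {x} {x'} (antisym a b) = antisym (nn-≗ (λ n → lem (seq x n) (seq x' n)) b) (nn-≗ (λ n → lem (seq x' n) (seq x n)) a)
  where
  lem : ∀ x x' → x' ℚ.- x ≡ ℚ.- x ℚ.- (ℚ.- x')
  lem = solve 2 (λ x x' → x' :- x := :- x :- (:- x')) refl

sub-cong : ∀ {x x' y y'} → x ≈ x' → y ≈ y' → x - y ≈ x' - y'
sub-cong p q = +-cong p (neg-cong q)

abs-bound : ∀ x → Σ[ b ∈ ℕ ] Bd x (fromℚ (+ b / 1))
abs-bound x with bounded (seq x) (cauchy x)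
... | b , hb = suc b , bd
  (nn-eventually 0 λ n _ → ≤-by' (∣p∣≤⇒-p≤ {seq x n} (hb n)) (solve 2 (λ B x → B :- (:- x) := B :+ x) refl (+ suc b / 1) (seq x n)))
  (nn-eventually 0 λ n _ → p≤q⇒0≤q-p (∣p∣≤⇒p≤ {seq x n} (hb n)))
  where
  ≤-by' : ∀ {p q r} → p ℚ.≤ q → q ℚ.- p ≡ r → 0ℚ ℚ.≤ r
  ≤-by' h e = subst (0ℚ ℚ.≤_) e (p≤q⇒0≤q-p h)

-- With d = x - x' both d and -d are nonnegative, and so are d(B ± y) and -d(B ± y).
*-congʳ : ∀ {x x'} y → x ≈ x' → x * y ≈ x' * y
*-congʳ {x} {x'} y (antisym a b) = let B , bd lo hi = abs-bound y in antisym
  (nn-half (nn-≗ (λ n → lem (seq x n) (seq x' n) (seq y n) (+ B / 1)) (b nn* hi nn+ a nn* lo)))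
  (nn-half (nn-≗ (λ n → lem (seq x' n) (seq x n) (seq y n) (+ B / 1)) (a nn* hi nn+ b nn* lo)))
  where
  lem : ∀ x x' y B → (x' ℚ.- x) ℚ.* (B ℚ.- y) ℚ.+ (x ℚ.- x') ℚ.* (B ℚ.+ y)
                     ≡ (x ℚ.* y ℚ.- x' ℚ.* y) ℚ.+ (x ℚ.* y ℚ.- x' ℚ.* y)
  lem = solve 4 (λ x x' y B → (x' :- x) :* (B :- y) :+ (x :- x') :* (B :+ y)
                              := (x :* y :- x' :* y) :+ (x :* y :- x' :* y)) refl

*-comm : ∀ x y → x * y ≈ y * x
*-comm x y = ≈-pt λ n → ℚP.*-comm (seq x n) (seq y n)

*-cong : ∀ {x x' y y'} → x ≈ x' → y ≈ y' → x * y ≈ x' * y'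
*-cong {x} {x'} {y} {y'} p q = ≈-trans (*-congʳ y p) (≈-trans (*-comm x' y) (≈-trans (*-congʳ x' q) (*-comm y' x')))

nn-≈ : ∀ {x y} → x ≈ y → Nonneg x → Nonneg y
nn-≈ p nx = nn-≼ nx (≈⇒≼ p)

bd-resp : ∀ {x y c d} → x ≈ y → c ≈ d → Bd x c → Bd y d
bd-resp p r (bd a b) = bd (nn-≈ (+-cong r p) a) (nn-≈ (sub-cong r p) b)

bd-≈ : ∀ {x y c} → x ≈ y → Bd x c → Bd y c
bd-≈ p = bd-resp p ≈-refl

bd-≼ : ∀ {x c d} → c ≼ d → Bd x c → Bd x d
bd-≼ {x} {c} {d} (le h) (bd a b) = bd
  (nn-≗ (λ n → solve 3 (λ x c d → c :+ x :+ (d :- c) := d :+ x) refl (seq x n) (seq c n) (seq d n)) (a nn+ h))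
  (nn-≗ (λ n → solve 3 (λ x c d → c :- x :+ (d :- c) := d :- x) refl (seq x n) (seq c n) (seq d n)) (b nn+ h))

bd-+ : ∀ {x y c d} → Bd x c → Bd y d → Bd (x + y) (c + d)
bd-+ {x} {y} {c} {d} (bd a b) (bd a' b') = bd
  (nn-≗ (λ n → solve 4 (λ x y c d → c :+ x :+ (d :+ y) := c :+ d :+ (x :+ y)) refl (seq x n) (seq y n) (seq c n) (seq d n)) (a nn+ a'))
  (nn-≗ (λ n → solve 4 (λ x y c d → c :- x :+ (d :- y) := c :+ d :- (x :+ y)) refl (seq x n) (seq y n) (seq c n) (seq d n)) (b nn+ b'))

bd-neg : ∀ {x c} → Bd x c → Bd (- x) c
bd-neg {x} {c} (bd a b) = bd b
  (nn-≗ (λ n → solve 2 (λ x c → c :+ x := c :- (:- x)) refl (seq x n) (seq c n)) a)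

-- Twice cd + xy is (c + x)(d + y) + (c - x)(d - y), and twice cd - xy is (c + x)(d - y) + (c - x)(d
-- + y).
bd-* : ∀ {x y c d} → Bd x c → Bd y d → Bd (x * y) (c * d)
bd-* {x} {y} {c} {d} (bd a b) (bd a' b') = bd
  (nn-half (nn-≗ (λ n → solve 4 (λ x y c d → (c :+ x) :* (d :+ y) :+ (c :- x) :* (d :- y)
                                          := (c :* d :+ x :* y) :+ (c :* d :+ x :* y)) refl
    (seq x n) (seq y n) (seq c n) (seq d n)) (a nn* a' nn+ b nn* b')))
  (nn-half (nn-≗ (λ n → solve 4 (λ x y c d → (c :+ x) :* (d :- y) :+ (c :- x) :* (d :+ y)
                                          := (c :* d :- x :* y) :+ (c :* d :- x :* y)) refl
    (seq x n) (seq y n) (seq c n) (seq d n)) (a nn* b' nn+ b nn* a')))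

bd-nn : ∀ {x c} → Nonneg x → x ≼ c → Bd x c
bd-nn {x} {c} nx (le h) = bd
  (nn-≗ (λ n → solve 2 (λ x c → x :+ (c :- x) :+ x := c :+ x) refl (seq x n) (seq c n)) (nx nn+ h nn+ nx)) h

bd-0≤ : ∀ {x c} → Bd x c → Nonneg c
bd-0≤ {x} {c} (bd a b) = nn-half (nn-≗ (λ n → solve 2 (λ x c → c :+ x :+ (c :- x) := c :+ c) refl (seq x n) (seq c n)) (a nn+ b))

≈⇒bd-0 : ∀ {x y} → x ≈ y → Bd (x - y) 0ℝ
≈⇒bd-0 {x} {y} (antisym a b) = bd
  (nn-≗ (λ n → sym (ℚP.+-identityˡ _)) a)
  (nn-≗ (λ n → solve 2 (λ x y → y :- x := con 0ℚ :- (x :- y)) refl (seq x n) (seq y n)) b)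

bd-const : ∀ {p c} → ℚ.∣ p ∣ ℚ.≤ c → Bd (fromℚ p) (fromℚ c)
bd-const {p} {c} h = bd
  (nn-pointwise λ _ → subst (0ℚ ℚ.≤_) (solve 2 (λ p c → c :- (:- p) := c :+ p) refl p c) (p≤q⇒0≤q-p (∣p∣≤⇒-p≤ {p} h)))
  (nn-pointwise λ _ → p≤q⇒0≤q-p (∣p∣≤⇒p≤ {p} h))

bd-const⁻¹ : ∀ {p c} → Bd (fromℚ p) (fromℚ c) → ℚ.∣ p ∣ ℚ.≤ c
bd-const⁻¹ {p} {c} (bd a b) = ≤⇒∣p∣≤ {p}
  (≤-by (c ℚ.- p) (nn-const⁻¹ (nn-≗ (λ _ → refl) b)) refl)
  (≤-by (c ℚ.+ p) (nn-const⁻¹ (nn-≗ (λ _ → refl) a)) (solve 2 (λ p c → c :- (:- p) := c :+ p) refl p c))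

bd-limit : ∀ {x c} → (∀ ε → 0ℚ ℚ.< ε → Bd x (c + fromℚ ε)) → Bd x c
bd-limit {x} {c} h = bd
  (nn-limit λ ε 0<ε → nn-≗ (λ n → solve 3 (λ c x e → c :+ e :+ x := c :+ x :+ e) refl (seq c n) (seq x n) ε) (Bd.lo (h ε 0<ε)))
  (nn-limit λ ε 0<ε → nn-≗ (λ n → solve 3 (λ c x e → c :+ e :- x := c :- x :+ e) refl (seq c n) (seq x n) ε) (Bd.hi (h ε 0<ε)))

bd-triangle : ∀ {x y z c d} → Bd (x - y) c → Bd (y - z) d → Bd (x - z) (c + d)
bd-triangle {x} {y} {z} p r = bd-≈ (≈-pt λ n →
  solve 3 (λ x y z → (x :- y) :+ (y :- z) := x :- z) refl (seq x n) (seq y n) (seq z n)) (bd-+ p r)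

bd-swap : ∀ {x y c} → Bd (x - y) c → Bd (y - x) c
bd-swap {x} {y} p = bd-≈ (≈-pt λ n → solve 2 (λ x y → :- (x :- y) := y :- x) refl (seq x n) (seq y n)) (bd-neg p)

Vanishing : (ℕ → ℚ) → Set
Vanishing e = ∀ ε → 0ℚ ℚ.< ε → Σ[ K ∈ ℕ ] (∀ k → K ℕ.≤ k → e k ℚ.≤ ε)

bd-tail : ∀ {x c ε} N → (∀ n → N ℕ.≤ n → ℚ.∣ seq x n ℚ.- c ∣ ℚ.≤ ε) → Bd (x - fromℚ c) (fromℚ ε)
bd-tail {x} {c} {ε} N h = bd
  (nn-eventually N λ n N≤n → subst (0ℚ ℚ.≤_)
    (solve 2 (λ p c → c :- (:- p) := c :+ p) refl (seq x n ℚ.- c) ε) (p≤q⇒0≤q-p (∣p∣≤⇒-p≤ {seq x n ℚ.- c} (h n N≤n))))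
  (nn-eventually N λ n N≤n → p≤q⇒0≤q-p (∣p∣≤⇒p≤ {seq x n ℚ.- c} (h n N≤n)))

-- Each S n is itself a Cauchy sequence, so the limit is a diagonal whose n-th entry is a rational
-- within 1/(n + 1) of S n. The rate `e` passes to the limit unchanged because these approximation
-- errors tend to 0.
module Completeness (S : ℕ → ℝ) (e : ℕ → ℚ) (vanishing : Vanishing e)
  (close : ∀ K j → Bd (S (K ℕ.+ j) - S K) (fromℚ (e K))) where

  approx : ℕ → ℚ
  approx n = seq (S n) (proj₁ (cauchy (S n) (+ 1 / suc n) (0<1/suc n)))

  approx-close : ∀ n → Bd (S n - fromℚ (approx n)) (fromℚ (+ 1 / suc n))
  approx-close n = let N , hN = cauchy (S n) (+ 1 / suc n) (0<1/suc n) in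
    bd-tail {S n} N λ m N≤m → hN m N N≤m ℕP.≤-refl

  close' : ∀ K n → K ℕ.≤ n → Bd (S n - S K) (fromℚ (e K))
  close' K n K≤n = subst (λ m → Bd (S m - S K) (fromℚ (e K))) (ℕP.m+[n∸m]≡n K≤n) (close K (n ℕ.∸ K))

  near : ∀ K J n → K ℕ.≤ n → J ℕ.≤ n → Bd (S K - fromℚ (approx n)) (fromℚ (e K ℚ.+ (+ 1 / suc J)))
  near K J n K≤n J≤n = bd-≼ (≼-pointwise λ _ → ℚP.+-monoʳ-≤ (e K)
      (/-≤ 1 1 n J (ℕP.*-monoʳ-≤ 1 (ℕ.s≤s J≤n))))
    (bd-triangle {S K} {S n} (bd-swap {S n} (close' K n K≤n)) (approx-close n))

  approx-cauchy : Cauchy approx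
  approx-cauchy ε 0<ε =
    let h , 0<h , hh = halving ε 0<ε
        d , 0<d , dd = halving h 0<h
        K , hK = vanishing d 0<d
        J , hJ = archimedean 1 d 0<d
        small : e K ℚ.+ (+ 1 / suc J) ℚ.≤ h
        small = subst (e K ℚ.+ (+ 1 / suc J) ℚ.≤_) dd (ℚP.+-mono-≤ (hK K ℕP.≤-refl) hJ)
    in K ℕ.+ J , λ m n p q → ℚP.≤-trans
        (bd-const⁻¹ {approx m ℚ.- approx n} (bd-resp (≈-pt λ _ → refl) (≈-pt λ _ → refl)
          (bd-triangle {fromℚ (approx m)} {S K} {fromℚ (approx n)}
            (bd-swap {S K} (near K J m (ℕP.m+n≤o⇒m≤o K p) (ℕP.m+n≤o⇒n≤o K p)))
            (near K J n (ℕP.m+n≤o⇒m≤o K q) (ℕP.m+n≤o⇒n≤o K q)))))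
        (ℚP.≤-trans (ℚP.+-mono-≤ small small) (ℚP.≤-reflexive hh))

  limit : ℝ
  limit = mkℝ approx approx-cauchy

  limit-close : ∀ K → Bd (S K - limit) (fromℚ (e K))
  limit-close K = bd-limit λ ε 0<ε →
    let h , 0<h , hh = halving ε 0<ε
        J , hJ = archimedean 1 h 0<h
        N , hN = approx-cauchy h 0<h
        M = N ℕ.+ (K ℕ.+ J)
        N≤M = ℕP.m≤m+n N (K ℕ.+ J)
        K≤M = ℕP.≤-trans (ℕP.m≤m+n K J) (ℕP.m≤n+m (K ℕ.+ J) N)
        J≤M = ℕP.≤-trans (ℕP.m≤n+m J K) (ℕP.m≤n+m (K ℕ.+ J) N)
    in bd-≼ (≼-pointwise λ _ → subst (e K ℚ.+ (+ 1 / suc J) ℚ.+ h ℚ.≤_)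
           (trans (ℚP.+-assoc (e K) h h) (cong (e K ℚ.+_) hh))
           (ℚP.+-monoˡ-≤ h (ℚP.+-monoʳ-≤ (e K) hJ)))
         (bd-triangle {S K} {fromℚ (approx M)} {limit} (near K J M K≤M J≤M)
           (bd-swap {limit} (bd-tail {limit} N λ n N≤n → hN n M N≤n N≤M)))

-- Power series

infixr 9 _↑_

_↑_ : ℚ → ℕ → ℚ
x ↑ zero = 1ℚ
x ↑ suc n = x ↑ n ℚ.* x

0≤↑ : ∀ {x} → 0ℚ ℚ.≤ x → ∀ n → 0ℚ ℚ.≤ x ↑ n
0≤↑ h zero = 0≤/ 1 0
0≤↑ h (suc n) = 0≤* (0≤↑ h n) h

Coefficients : Set
Coefficients = ℕ → ℚ

conv : Coefficients → Coefficients → Coefficients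
conv a b zero = a 0 ℚ.* b 0
conv a b (suc n) = a 0 ℚ.* b (suc n) ℚ.+ conv (a ∘ suc) b n

δ : Coefficients
δ zero = 1ℚ
δ (suc _) = 0ℚ

delay : Coefficients → Coefficients
delay a zero = 0ℚ
delay a (suc n) = a n

delays : ℕ → Coefficients → Coefficients
delays zero a = a
delays (suc k) a = delay (delays k a)

Converges : (ℕ → ℝ) → ℝ → Set
Converges S L = ∀ ε → 0ℚ ℚ.< ε → Σ[ K ∈ ℕ ] (∀ k → K ℕ.≤ k → Bd (S k - L) (fromℚ ε))

converges-≈ : ∀ {S S' L} → (∀ k → S k ≈ S' k) → Converges S L → Converges S' L
converges-≈ h conv ε 0<ε = let K , hK = conv ε 0<ε in K , λ k K≤k →
  bd-≈ (sub-cong (h k) ≈-refl) (hK k K≤k)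

converges-+ : ∀ {S S' L L'} → Converges S L → Converges S' L' → Converges (λ k → S k + S' k) (L + L')
converges-+ {S} {S'} {L} {L'} c c' ε 0<ε =
  let h , 0<h , hh = halving ε 0<ε
      K , hK = c h 0<h
      K' , hK' = c' h 0<h
  in K ℕ.+ K' , λ k le → bd-resp
    (≈-pt λ n → solve 4 (λ s s' l l' → (s :- l) :+ (s' :- l') := s :+ s' :- (l :+ l')) refl
      (seq (S k) n) (seq (S' k) n) (seq L n) (seq L' n))
    (≈-pt λ n → hh)
    (bd-+ (hK k (ℕP.m+n≤o⇒m≤o K le)) (hK' k (ℕP.m+n≤o⇒n≤o K le)))

converges-* : ∀ {S L} x → Converges S L → Converges (λ k → x * S k) (x * L)
converges-* {S} {L} x c ε 0<ε =
  let b , hb = abs-bound x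
      i = + 1 / suc b
      K , hK = c (ε ℚ.* i) (0<* ε i 0<ε (0<1/suc b))
  in K , λ k K≤k → bd-≼ (≼-pointwise λ n → ℚP.≤-trans
      (ℚP.*-monoʳ-≤-nonNeg (ε ℚ.* i) {{ℚ.nonNegative (0≤* (ℚP.<⇒≤ 0<ε) (0≤/ 1 b))}} (/-≤ b (suc b) 0 0 (ℕP.*-monoˡ-≤ 1 (ℕP.n≤1+n b))))
      (ℚP.≤-reflexive (trans (solve 3 (λ B e i → B :* (e :* i) := (B :* i) :* e) refl (+ suc b / 1) ε i)
        (trans (cong (ℚ._* ε) (suc*1/suc b)) (ℚP.*-identityˡ ε)))))
    (bd-≈ (≈-pt λ n → solve 3 (λ x s l → x :* (s :- l) := x :* s :- x :* l) refl (seq x n) (seq (S k) n) (seq L n))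
      (bd-* hb (hK k K≤k)))

converges-tail : ∀ {S S' L} → (∀ k → S' (suc k) ≈ S k) → Converges S L → Converges S' L
converges-tail {S} {S'} {L} h c ε 0<ε = let K , hK = c ε 0<ε in suc K , λ { (suc k) (ℕ.s≤s K≤k) →
  bd-≈ (sub-cong (≈-sym (h k)) ≈-refl) (hK k K≤k) }

converges-nonneg : ∀ {S L} → (∀ k → Nonneg (S k)) → Converges S L → Nonneg L
converges-nonneg {S} {L} h c = nn-limit λ ε 0<ε → let K , hK = c ε 0<ε in
  nn-≗ (λ n → solve 3 (λ s l e → e :- (s :- l) :+ s := l :+ e) refl (seq (S K) n) (seq L n) ε)
    (Bd.hi (hK K ℕP.≤-refl) nn+ h K)

converges-≼ : ∀ {S S' L L'} → (∀ k → S k ≼ S' k) → Converges S L → Converges S' L' → L ≼ L'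
converges-≼ {S} {S'} {L} {L'} h c c' = le (nn-≗ (λ n → solve 2 (λ l l' → l' :+ con (ℚ.- 1ℚ) :* l := l' :- l) refl (seq L n) (seq L' n))
  (converges-nonneg
    (λ k → nn-≗ (λ n → solve 2 (λ l l' → l' :- l := l' :+ con (ℚ.- 1ℚ) :* l) refl (seq (S k) n) (seq (S' k) n)) (_≼_.diff (h k)))
    (converges-+ c' (converges-* (fromℚ (ℚ.- 1ℚ)) c))))

converges-unique : ∀ {S L L'} → Converges S L → Converges S L' → L ≈ L'
converges-unique c c' = ≼-antisym (converges-≼ (λ k → ≼-refl) c c') (converges-≼ (λ k → ≼-refl) c' c)

-- Partial sums in nested form. Splitting off the constant term leaves the shifted coefficients, as
-- in `conv`, so estimates run by induction with `a ∘ suc` in place of `a`.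
horner : ℝ → Coefficients → ℕ → ℝ
horner q a zero = 0ℝ
horner q a (suc K) = fromℚ (a 0) + q * horner q (a ∘ suc) K

horner-linear : ∀ q s a b K n →
  seq (horner q (λ k → s ℚ.* a k ℚ.+ b k) K) n ≡ s ℚ.* seq (horner q a K) n ℚ.+ seq (horner q b K) n
horner-linear q s a b zero n = solve 1 (λ s → con 0ℚ := s :* con 0ℚ :+ con 0ℚ) refl s
horner-linear q s a b (suc K) n = trans
  (cong (λ t → s ℚ.* a 0 ℚ.+ b 0 ℚ.+ seq q n ℚ.* t) (horner-linear q s (a ∘ suc) (b ∘ suc) K n))
  (solve 6 (λ s a b q x y → s :* a :+ b :+ q :* (s :* x :+ y) := s :* (a :+ q :* x) :+ (b :+ q :* y)) refl
    s (a 0) (b 0) (seq q n) (seq (horner q (a ∘ suc) K) n) (seq (horner q (b ∘ suc) K) n))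

horner-cong : ∀ q {a b} → (∀ k → a k ≡ b k) → ∀ K n → seq (horner q a K) n ≡ seq (horner q b K) n
horner-cong q h zero n = refl
horner-cong q h (suc K) n = cong₂ (λ s t → s ℚ.+ seq q n ℚ.* t) (h 0) (horner-cong q (λ k → h (suc k)) K n)

horner-0 : ∀ q K n → seq (horner q (λ _ → 0ℚ) K) n ≡ 0ℚ
horner-0 q zero n = refl
horner-0 q (suc K) n = trans (cong (λ t → 0ℚ ℚ.+ seq q n ℚ.* t) (horner-0 q K n))
  (solve 1 (λ q → con 0ℚ :+ q :* con 0ℚ := con 0ℚ) refl (seq q n))

horner-nonneg : ∀ q a → Nonneg q → (∀ k → 0ℚ ℚ.≤ a k) → ∀ K → Nonneg (horner q a K)
horner-nonneg q a hq h zero = nn-const ℚP.≤-refl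
horner-nonneg q a hq h (suc K) = nn-const (h 0) nn+ hq nn* horner-nonneg q (a ∘ suc) hq (λ k → h (suc k)) K

Sum : ℝ → Coefficients → ℝ → Set
Sum q a L = Converges (horner q a) L

sum-cong : ∀ {q a b L} → (∀ k → a k ≡ b k) → Sum q a L → Sum q b L
sum-cong {q} h = converges-≈ λ k → ≈-pt (horner-cong q h k)

sum-δ : ∀ q → Sum q δ 1ℝ
sum-δ q ε 0<ε = 1 , λ { (suc k) _ → bd-≼ (≼-pointwise λ _ → ℚP.<⇒≤ 0<ε)
  (≈⇒bd-0 (≈-pt λ n → trans (cong (λ t → 1ℚ ℚ.+ seq q n ℚ.* t) (horner-0 q k n))
    (solve 1 (λ q → con 1ℚ :+ q :* con 0ℚ := con 1ℚ) refl (seq q n)))) }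

sum-+ : ∀ {q a b L L'} → Sum q a L → Sum q b L' → Sum q (λ k → a k ℚ.+ b k) (L + L')
sum-+ {q} {a} {b} s s' = converges-≈
  (λ K → ≈-pt λ n → trans (cong (ℚ._+ _) (sym (ℚP.*-identityˡ (seq (horner q a K) n))))
    (trans (sym (horner-linear q 1ℚ a b K n)) (horner-cong q (λ k → cong (ℚ._+ b k) (ℚP.*-identityˡ (a k))) K n)))
  (converges-+ s s')

sum-delays : ∀ {q a L} k → Sum q a L → Sum q (delays k a) (q ^ k * L)
sum-delays {q} {a} {L} zero s = sum-1 s
  where
  sum-1 : Sum q a L → Sum q a (1ℝ * L)
  sum-1 s = converges-≈ (λ K → ≈-pt λ n → ℚP.*-identityˡ _) (converges-* 1ℝ s)
sum-delays {q} {a} {L} (suc k) s ε 0<ε =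
  let K , hK = converges-tail {λ j → q * horner q (delays k a) j} {horner q (delays (suc k) a)}
                 (λ j → ≈-pt λ n → ℚP.+-identityˡ _) (converges-* q (sum-delays k s)) ε 0<ε
  in K , λ j K≤j → bd-≈ (sub-cong ≈-refl (≈-pt λ n →
       solve 3 (λ q p l → q :* (p :* l) := p :* q :* l) refl (seq q n) (seq (q ^ k) n) (seq L n))) (hK j K≤j)

sum-≼ : ∀ {q a b L L'} → Nonneg q → (∀ k → a k ℚ.≤ b k) → Sum q a L → Sum q b L' → L ≼ L'
sum-≼ {q} {a} {b} hq h = converges-≼ (go a b h)
  where
  go : ∀ a b → (∀ k → a k ℚ.≤ b k) → ∀ K → horner q a K ≼ horner q b K
  go a b h zero = ≼-refl
  go a b h (suc K) = ≼-pt (nn-const (p≤q⇒0≤q-p (h 0)) nn+ hq nn* _≼_.diff (go (a ∘ suc) (b ∘ suc) (λ k → h (suc k)) K))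
    (λ n → solve 5 (λ a b q x y → b :+ q :* y :- (a :+ q :* x) := b :- a :+ q :* (y :- x)) refl
      (a 0) (b 0) (seq q n) (seq (horner q (a ∘ suc) K) n) (seq (horner q (b ∘ suc) K) n))

-- v = 1/c < 1 is a ratio with q ≤ v³, and g = 1/(1 - v).
module Geometric (v c g : ℚ) (0≤v : 0ℚ ℚ.≤ v) (v≤1 : v ℚ.≤ 1ℚ) (0≤c : 0ℚ ℚ.≤ c) (0≤g : 0ℚ ℚ.≤ g)
  (vc : v ℚ.* c ≡ 1ℚ) (vg : 1ℚ ℚ.+ v ℚ.* g ≡ g) where

  -- The sum of the first K powers of v is g(1 - v^K), and each of these powers is at least v^K.
  geometric-sum : ∀ K → num K ℚ.* v ↑ K ℚ.+ v ↑ K ℚ.* g ℚ.≤ g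
  geometric-sum zero = ℚP.≤-reflexive (solve 1 (λ g → con 0ℚ :* con 1ℚ :+ con 1ℚ :* g := g) refl g)
  geometric-sum (suc K) = ℚP.≤-trans
    (≤-by (num (suc K) ℚ.* v ↑ K ℚ.* (1ℚ ℚ.- v)) (0≤* (0≤* (0≤num (suc K)) (0≤↑ 0≤v K)) (p≤q⇒0≤q-p v≤1))
      (trans (cong (λ t → num K ℚ.* v ↑ K ℚ.+ v ↑ K ℚ.* t ℚ.- (num (suc K) ℚ.* v ↑ suc K ℚ.+ v ↑ suc K ℚ.* g)) (sym vg))
        (solve 4 (λ n V v g → n :* V :+ V :* (con 1ℚ :+ v :* g) :- ((n :+ con 1ℚ) :* (V :* v) :+ V :* v :* g)
                              := (n :+ con 1ℚ) :* V :* (con 1ℚ :- v)) refl (num K) (v ↑ K) v g)))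
    (geometric-sum K)

  -- By `geometric-sum`, k v^k is at most g. Hence B v^k is at most B g/k, and an archimedean choice
  -- of k suffices.
  v-vanishes : ∀ {B} → 0ℚ ℚ.≤ B → Vanishing (λ K → B ℚ.* v ↑ K)
  v-vanishes {B} 0≤B ε 0<ε =
    let b , hb = ∣p∣≤ℕ (B ℚ.* g)
        j , hj = archimedean b ε 0<ε
        i = + 1 / suc j
    in suc j , λ k j<k → ℚP.≤-trans
      (≤-by (i ℚ.* ((+ b / 1 ℚ.- B ℚ.* g) ℚ.+ B ℚ.* (g ℚ.- (num k ℚ.* v ↑ k ℚ.+ v ↑ k ℚ.* g) ℚ.+ v ↑ k ℚ.* g ℚ.+ (num k ℚ.- num (suc j)) ℚ.* v ↑ k)))
        (0≤* (0≤/ 1 j) (0≤+ (p≤q⇒0≤q-p (∣p∣≤⇒p≤ {B ℚ.* g} hb)) (0≤* 0≤B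
          (0≤+ (0≤+ (p≤q⇒0≤q-p (geometric-sum k)) (0≤* (0≤↑ 0≤v k) 0≤g)) (0≤* (p≤q⇒0≤q-p (num-mono j<k)) (0≤↑ 0≤v k))))))
        (trans (cong (λ t → (+ b / 1) ℚ.* i ℚ.- t) (trans (sym (ℚP.*-identityˡ (B ℚ.* v ↑ k)))
                 (cong (ℚ._* (B ℚ.* v ↑ k)) (trans (sym (suc*1/suc j)) (cong (ℚ._* i) (sym (+/1 (suc j))))))))
          (solve 7 (λ b i B g n m V → b :* i :- (m :* i) :* (B :* V)
             := i :* ((b :- B :* g) :+ B :* (g :- (n :* V :+ V :* g) :+ V :* g :+ (n :- m) :* V))) refl
            (+ b / 1) i B g (num k) (num (suc j)) (v ↑ k))))
      (subst (ℚ._≤ ε) (sym (/-* b j)) hj)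

  Growth : Coefficients → ℚ → Set
  Growth a B = ∀ k → ℚ.∣ a k ∣ ℚ.≤ B ℚ.* c ↑ k

  growth-suc : ∀ {a B} → Growth a B → Growth (a ∘ suc) (B ℚ.* c)
  growth-suc {a} {B} h k = subst (ℚ.∣ a (suc k) ∣ ℚ.≤_)
    (solve 3 (λ B c C → B :* (C :* c) := B :* c :* C) refl B c (c ↑ k)) (h (suc k))

  growth-0 : ∀ {a B} → Growth a B → Bd (fromℚ (a 0)) (fromℚ B)
  growth-0 {a} {B} h = bd-const {a 0} (subst (ℚ.∣ a 0 ∣ ℚ.≤_) (ℚP.*-identityʳ B) (h 0))

  -- The three factors v in the bound for `q` have separate tasks: one cancels the growth c of the
  -- coefficients, one gives the error its decay v^K, and one makes the errors of a product
  -- summable, with total factor g.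
  module Evaluate (q : ℝ) (q-small : Bd q (fromℚ (v ℚ.* v ℚ.* v))) where

    private
      -- The inductive steps multiply a bound with constant B c by q ≤ v³ and use v c = 1.
      absorb : ∀ {x} B → Bd x (fromℚ (B ℚ.* c)) → Bd (q * x) (fromℚ (v ℚ.* v ℚ.* B))
      absorb B h = bd-resp ≈-refl (≈-pt λ _ → trans
        (solve 3 (λ v c B → v :* v :* v :* (B :* c) := v :* v :* B :* (v :* c)) refl v c B)
        (trans (cong (v ℚ.* v ℚ.* B ℚ.*_) vc) (ℚP.*-identityʳ _))) (bd-* q-small h)

      scale-c : ∀ {x} a b d → Bd x (fromℚ (a ℚ.* c ℚ.* b ℚ.* d)) → Bd x (fromℚ (a ℚ.* b ℚ.* d ℚ.* c))
      scale-c a b d = bd-resp ≈-refl (≈-pt λ _ →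
        solve 4 (λ a b d c → a :* c :* b :* d := a :* b :* d :* c) refl a b d c)

      bd-≤ : ∀ {x s t} → s ℚ.≤ t → Bd x (fromℚ s) → Bd x (fromℚ t)
      bd-≤ h = bd-≼ (≼-pointwise λ _ → h)

    -- The factor 1 stands for v^0: this is the start K = 0 of the induction in `horner-close`.
    horner-bound : ∀ a {B} → 0ℚ ℚ.≤ B → Growth a B → ∀ K → Bd (horner q a K) (fromℚ (B ℚ.* g ℚ.* 1ℚ))
    horner-bound a {B} 0≤B h zero = bd-const {0ℚ} (0≤* (0≤* 0≤B 0≤g) (0≤/ 1 0))
    horner-bound a {B} 0≤B h (suc K) =
      (bd-≼ (≼-pointwise λ _ → ≤-by (v ℚ.* (1ℚ ℚ.- v) ℚ.* (B ℚ.* g)) (0≤* (0≤* 0≤v (p≤q⇒0≤q-p v≤1)) (0≤* 0≤B 0≤g))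
          (trans (cong (λ t → B ℚ.* t ℚ.* 1ℚ ℚ.- (B ℚ.+ v ℚ.* v ℚ.* (B ℚ.* g ℚ.* 1ℚ))) (sym vg))
            (solve 3 (λ B v g → B :* (con 1ℚ :+ v :* g) :* con 1ℚ :- (B :+ v :* v :* (B :* g :* con 1ℚ)) := v :* (con 1ℚ :- v) :* (B :* g)) refl B v g)))
        (bd-+ (growth-0 {a} {B} h) (absorb (B ℚ.* g ℚ.* 1ℚ) (scale-c B g 1ℚ (horner-bound (a ∘ suc) (0≤* 0≤B 0≤c) (growth-suc {a} {B} h) K)))))

    horner-close : ∀ a {B} → 0ℚ ℚ.≤ B → Growth a B → ∀ K j → Bd (horner q a (K ℕ.+ j) - horner q a K) (fromℚ (B ℚ.* g ℚ.* v ↑ K))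
    horner-close a 0≤B h zero j = bd-≈ (≈-pt λ n → sym (ℚP.+-identityʳ _)) (horner-bound a 0≤B h j)
    horner-close a {B} 0≤B h (suc K) j = bd-≈
      (≈-pt λ n → solve 4 (λ a q x y → q :* (x :- y) := a :+ q :* x :- (a :+ q :* y)) refl
        (a 0) (seq q n) (seq (horner q (a ∘ suc) (K ℕ.+ j)) n) (seq (horner q (a ∘ suc) K) n))
      (bd-≤ (≤-by (v ℚ.* (1ℚ ℚ.- v) ℚ.* (B ℚ.* g ℚ.* v ↑ K))
          (0≤* (0≤* 0≤v (p≤q⇒0≤q-p v≤1)) (0≤* (0≤* 0≤B 0≤g) (0≤↑ 0≤v K)))
          (solve 4 (λ B v g V → B :* g :* (V :* v) :- v :* v :* (B :* g :* V) := v :* (con 1ℚ :- v) :* (B :* g :* V)) refl B v g (v ↑ K)))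
        (absorb (B ℚ.* g ℚ.* v ↑ K) (scale-c B g (v ↑ K) (horner-close (a ∘ suc) (0≤* 0≤B 0≤c) (growth-suc {a} {B} h) K j))))

    sum-exists : ∀ a {B} → 0ℚ ℚ.≤ B → Growth a B → Σ[ L ∈ ℝ ] Sum q a L
    sum-exists a {B} 0≤B h = limit , λ ε 0<ε → let K , hK = vanish ε 0<ε in K , λ k K≤k → bd-≤ (hK k K≤k) (limit-close k)
      where
      vanish : Vanishing (λ K → B ℚ.* g ℚ.* v ↑ K)
      vanish = v-vanishes (0≤* 0≤B 0≤g)
      open Completeness (horner q a) (λ K → B ℚ.* g ℚ.* v ↑ K) vanish (horner-close a 0≤B h)

    sum-close : ∀ a {B L} → 0ℚ ℚ.≤ B → Growth a B → Sum q a L → ∀ K → Bd (horner q a K - L) (fromℚ (B ℚ.* g ℚ.* v ↑ K))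
    sum-close a {B} {L} 0≤B h s K = bd-limit λ ε 0<ε → let J , hJ = s ε 0<ε in
      bd-triangle {horner q a K} {horner q a (K ℕ.+ J)} {L} (bd-swap {horner q a (K ℕ.+ J)} (horner-close a 0≤B h K J)) (hJ (K ℕ.+ J) (ℕP.m≤n+m J K))

    -- conv a b (suc K) = a 0 · b (suc K) + conv (a ∘ suc) b K turns the discrepancy into a Horner scheme in a.
    product-close : ∀ a b {B R L} → 0ℚ ℚ.≤ B → 0ℚ ℚ.≤ R → Growth a B → (∀ K → Bd (horner q b K - L) (fromℚ (R ℚ.* v ↑ K))) →
      ∀ K → Bd (horner q (conv a b) K - horner q a K * L) (fromℚ (B ℚ.* (R ℚ.* g) ℚ.* v ↑ K))
    product-close a b {B} {R} {L} 0≤B 0≤R h hb zero = bd-≈ (≈-pt λ n → solve 1 (λ l → con 0ℚ := con 0ℚ :- con 0ℚ :* l) refl (seq L n))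
      (bd-const {0ℚ} (0≤* (0≤* 0≤B (0≤* 0≤R 0≤g)) (0≤/ 1 0)))
    product-close a b {B} {R} {L} 0≤B 0≤R h hb (suc K) = bd-≈
      (≈-pt λ n → sym (trans
        (cong (λ t → a 0 ℚ.* b 0 ℚ.+ seq q n ℚ.* t ℚ.- (a 0 ℚ.+ seq q n ℚ.* seq (horner q (a ∘ suc) K) n) ℚ.* seq L n)
          (horner-linear q (a 0) (b ∘ suc) (conv (a ∘ suc) b) K n))
        (solve 7 (λ a b q x y z l → a :* b :+ q :* (a :* x :+ y) :- (a :+ q :* z) :* l := a :* (b :+ q :* x :- l) :+ q :* (y :- z :* l)) refl
          (a 0) (b 0) (seq q n) (seq (horner q (b ∘ suc) K) n) (seq (horner q (conv (a ∘ suc) b) K) n) (seq (horner q (a ∘ suc) K) n) (seq L n))))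
      -- After 1 + v g = g both sides agree exactly, so the certificate vanishes through its factor
      -- 1 - 1.
      (bd-≼ (≼-pointwise λ _ → ≤-by (v ℚ.* v ↑ K ℚ.* B ℚ.* R ℚ.* v ℚ.* g ℚ.* (1ℚ ℚ.- 1ℚ))
            (ℚP.≤-reflexive (sym (ℚP.*-zeroʳ (v ℚ.* v ↑ K ℚ.* B ℚ.* R ℚ.* v ℚ.* g))))
          (trans (cong (λ t → B ℚ.* (R ℚ.* t) ℚ.* (v ↑ K ℚ.* v) ℚ.- (B ℚ.* (R ℚ.* (v ↑ K ℚ.* v)) ℚ.+ v ℚ.* v ℚ.* (B ℚ.* (R ℚ.* g) ℚ.* v ↑ K))) (sym vg))
            (solve 5 (λ B R V v g → B :* (R :* (con 1ℚ :+ v :* g)) :* (V :* v) :- (B :* (R :* (V :* v)) :+ v :* v :* (B :* (R :* g) :* V))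
               := v :* V :* B :* R :* v :* g :* (con 1ℚ :- con 1ℚ)) refl B R (v ↑ K) v g)))
        (bd-+ (bd-* (growth-0 {a} {B} h) (hb (suc K)))
              (absorb (B ℚ.* (R ℚ.* g) ℚ.* v ↑ K) (scale-c B (R ℚ.* g) (v ↑ K) (product-close (a ∘ suc) b (0≤* 0≤B 0≤c) 0≤R (growth-suc {a} {B} h) hb K)))))

    sum-product : ∀ {a b A B L M} → 0ℚ ℚ.≤ A → 0ℚ ℚ.≤ B → Growth a A → Growth b B → Sum q a L → Sum q b M → Sum q (conv a b) (L * M)
    sum-product {a} {b} {A} {B} {L} {M} 0≤A 0≤B ha hb sa sb ε 0<ε =
      let K , hK = converges-+ discrepancy (converges-* M sa) ε 0<ε in K , λ k K≤k → bd-≈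
        (≈-pt λ n → solve 4 (λ x y l m → x :- y :* m :+ m :* y :- (con 0ℚ :+ m :* l) := x :- l :* m) refl
          (seq (horner q (conv a b) k) n) (seq (horner q a k) n) (seq L n) (seq M n)) (hK k K≤k)
      where
      discrepancy : Converges (λ K → horner q (conv a b) K - horner q a K * M) 0ℝ
      discrepancy ε 0<ε = let K , hK = v-vanishes (0≤* 0≤A (0≤* (0≤* 0≤B 0≤g) 0≤g)) ε 0<ε in K , λ k K≤k →
        bd-≈ (≈-pt λ n → sym (ℚP.+-identityʳ _))
          (bd-≤ (hK k K≤k) (product-close a b 0≤A (0≤* 0≤B 0≤g) ha (sum-close b 0≤B hb sb) k))

-- The gas and its recurrence

shift : List ℤ → List ℤ
shift = map ℤ.suc

-- x is `pos x` minus `neg⁻ x`. Multiplying the recurrence by `q ^ neg⁻ x` replaces the factor q^x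
-- by natural powers for both signs of x.
pos neg⁻ : ℤ → ℕ
pos (+ n) = n
pos -[1+ n ] = 0
neg⁻ (+ n) = 0
neg⁻ -[1+ n ] = suc n

-- p X is the probability that all sites of X are empty, z = 2πy and q = e⁻ᶻ.
record Gas : Set where
  field
    z q : ℝ
    0≤z : Nonneg z
    z≤1 : z ≼ 1ℝ
    -- All that the asymptotic part keeps of q = exp(-z); the error has the same constant 1 for
    -- every gas.
    q-expansion : Bd (q - (1ℝ - z)) (z * z)
    p : List ℤ → ℝ
    p-bounded : ∀ X → Bd (p X) 1ℝ
    p-[] : p [] ≈ 1ℝ
    p-↭ : ∀ {X Y} → X ↭ Y → p X ≈ p Y
    recurrence : ∀ x A → x ∉ A →
      q ^ neg⁻ x * p A ≈ q ^ neg⁻ x * p (x ∷ A) + q ^ pos x * p (shift (x ∷ A))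

num-+ : ∀ m n → num (m ℕ.+ n) ≡ num m ℚ.+ num n
num-+ zero n = sym (ℚP.+-identityˡ (num n))
num-+ (suc m) n = trans (cong (ℚ._+ 1ℚ) (num-+ m n)) (solve 2 (λ m n → m :+ n :+ con 1ℚ := m :+ con 1ℚ :+ n) refl (num m) (num n))

delays-+ : ∀ k a M → delays k a (k ℕ.+ M) ≡ a M
delays-+ zero a M = refl
delays-+ (suc k) a M = delays-+ k a M

delays-< : ∀ k a {N} → N ℕ.< k → delays k a N ≡ 0ℚ
delays-< (suc k) a {zero} _ = refl
delays-< (suc k) a {suc N} (ℕ.s≤s h) = delays-< k a h

EmptyOn : List ℤ → Monomial → Set
EmptyOn X μ = All (λ x → occupied μ x ≡ false) X

emptyOn? : ∀ X μ → Dec (EmptyOn X μ)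
emptyOn? X μ = All.all? (λ x → occupied μ x BoolP.≟ false) X

-- `T [] N` is the number of partitions of N: entries of `ns` and `ms` at charge 0 are Frobenius
-- coordinates.
T : List ℤ → Coefficients
T X N = num (count (emptyOn? X) N)

T-nonneg : ∀ X N → 0ℚ ℚ.≤ T X N
T-nonneg X N = 0≤num (count (emptyOn? X) N)

T-≤ : ∀ X N → T X N ℚ.≤ T [] N
T-≤ X N = num-mono (ℕP.≤-trans (LP.length-filter (emptyOn? X) (basis₀ N))
  (ℕP.≤-reflexive (cong length (sym (LP.filter-all (emptyOn? []) {xs = basis₀ N} (All.tabulate λ _ → []))))))

T-↭ : ∀ {X Y} → X ↭ Y → ∀ N → T X N ≡ T Y N
T-↭ {X} {Y} p N = cong num (count-≐ (emptyOn? X) (emptyOn? Y) (basis₀ N)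
  (λ _ → ↭P.All-resp-↭ p) (λ _ → ↭P.All-resp-↭ (↭-sym p)))

module _ (x : ℤ) (A : List ℤ) (x∉A : x ∉ A) where

  private
    away : ∀ {y} → y ∈ A → y ≢ x
    away m refl = x∉A m

    empty-φ : ∀ μ → occupied μ x ≡ true → EmptyOn A μ → EmptyOn (shift (x ∷ A)) (φ x μ)
    empty-φ μ o p = occupied-φ-≡ x μ ∷ AllP.map⁺ (All.tabulate λ {y} m →
      trans (occupied-φ-≢ x y μ (away m)) (All.lookup p m))

    empty-φ⁻ : ∀ μ → occupied μ x ≡ true → EmptyOn (shift (x ∷ A)) (φ x μ) → EmptyOn A μ
    empty-φ⁻ μ o q = All.tabulate λ {y} m →
      trans (sym (occupied-φ-≢ x y μ (away m))) (All.lookup (AllP.map⁻ (All.tail q)) m)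

    open ShiftCount x {EmptyOn A} {EmptyOn (shift (x ∷ A))} (emptyOn? A) (emptyOn? (shift (x ∷ A)))
      empty-φ empty-φ⁻ (λ ν q → All.head q)

    count-empty : ∀ N → count empty? N ≡ count (emptyOn? (x ∷ A)) N
    count-empty N = count-≐ empty? (emptyOn? (x ∷ A)) (basis₀ N)
      (λ _ (p , o) → o ∷ p) (λ { _ (o ∷ p) → p , o })

    T-shift : ∀ N M → + N ≡ + M ℤ.+ x → T A N ≡ T (x ∷ A) N ℚ.+ T (shift (x ∷ A)) M
    T-shift N M e = trans (cong num (trans (count-shift N M e) (cong (ℕ._+ count (emptyOn? (shift (x ∷ A))) M) (count-empty N))))
      (num-+ (count (emptyOn? (x ∷ A)) N) _)

    T-below : ∀ N → + N ℤ.< x → T A N ≡ T (x ∷ A) N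
    T-below N h = cong num (trans (count-below N h) (count-empty N))

    T-negative : ∀ M → + M ℤ.+ x ℤ.< + 0 → T (shift (x ∷ A)) M ≡ 0ℚ
    T-negative M h = cong num (count-negative M h)

  -- The recurrence coefficient by coefficient, before normalisation. Particle removal changes the
  -- level by x; a negative x delays the two unshifted series instead of the shifted one.
  T-recurrence : ∀ N → delays (neg⁻ x) (T A) N ≡ delays (neg⁻ x) (T (x ∷ A)) N ℚ.+ delays (pos x) (T (shift (x ∷ A))) N
  T-recurrence = go x refl
    where
    -- The sign is inspected on a copy y, since x itself is a parameter of the counting lemmas.
    go : ∀ y → y ≡ x → ∀ N → delays (neg⁻ y) (T A) N ≡ delays (neg⁻ y) (T (x ∷ A)) N ℚ.+ delays (pos y) (T (shift (x ∷ A))) N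
    go (+ k) y≡x N with k ℕP.≤? N
    ... | no k≰N = trans (T-below N (subst (+ N ℤ.<_) y≡x (ℤ.+<+ (ℕP.≰⇒> k≰N)))) (sym (trans
      (cong (T (x ∷ A) N ℚ.+_) (delays-< k (T (shift (x ∷ A))) (ℕP.≰⇒> k≰N))) (ℚP.+-identityʳ _)))
    ... | yes k≤N = subst (λ N → T A N ≡ T (x ∷ A) N ℚ.+ delays k (T (shift (x ∷ A))) N) (ℕP.m+[n∸m]≡n k≤N)
      (trans (T-shift (k ℕ.+ M) M (trans (cong +_ (ℕP.+-comm k M)) (trans (ℤP.pos-+ M k) (cong (λ z → + M ℤ.+ z) y≡x))))
        (cong (T (x ∷ A) (k ℕ.+ M) ℚ.+_) (sym (delays-+ k _ M))))
      where M = N ℕ.∸ k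
    go -[1+ j ] y≡x N with suc j ℕP.≤? N
    ... | no k≰N = trans (delays-< (suc j) (T A) (ℕP.≰⇒> k≰N)) (sym (trans
      (cong₂ ℚ._+_ (delays-< (suc j) (T (x ∷ A)) (ℕP.≰⇒> k≰N))
        (T-negative N (subst (λ z → + N ℤ.+ z ℤ.< + 0) y≡x (subst (ℤ._< + 0) (sym (ℤP.⊖-< (ℕP.≰⇒> k≰N)))
          (ℤP.neg-mono-< (ℤ.+<+ (ℕP.m<n⇒0<n∸m (ℕP.≰⇒> k≰N))))))))
      (ℚP.+-identityʳ 0ℚ)))
    ... | yes k≤N = subst (λ N → delays (suc j) (T A) N ≡ delays (suc j) (T (x ∷ A)) N ℚ.+ T (shift (x ∷ A)) N) (ℕP.m+[n∸m]≡n k≤N)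
      (trans (delays-+ (suc j) (T A) M) (trans (T-shift M (suc j ℕ.+ M)
          (subst (λ z → + M ≡ + (suc j ℕ.+ M) ℤ.+ z) y≡x (sym (trans (ℤP.⊖-≥ (ℕP.m≤m+n (suc j) M)) (cong +_ (ℕP.m+n∸m≡n (suc j) M))))))
        (cong (ℚ._+ T (shift (x ∷ A)) (suc j ℕ.+ M)) (sym (delays-+ (suc j) (T (x ∷ A)) M)))))
      where M = N ℕ.∸ suc j

-- Partition counts and Euler's product

below? : ∀ N μ → Dec (All (ℕ._< N) (list (ns μ)))
below? N μ = All.all? (ℕP._<? N) (list (ns μ))

-- u N is the generating function of the partitions with parts at most N.
u : ℕ → Coefficients
u N M = num (count (below? N) M)

-- Particle removal at the highest allowed site N + 1. If that site is empty, the bound drops to N.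
-- If it is occupied, the other particles lie at N or below and move to N + 1 or below, so the same
-- condition holds at a level lower by N + 1. As series, (1 - q^(N+1)) u(N+1) = u(N).
u-step : ∀ N M → u (suc N) M ≡ u N M ℚ.+ delays (suc N) (u (suc N)) M
u-step N M = step (suc N ℕP.≤? M)
  where
  x : ℤ
  x = + suc N
  top-vacant : ∀ μ {m} → All (ℕ._< suc N) (list (ns μ)) → m ∈ list (ns μ) → m ≢ N → m ℕ.< N
  top-vacant μ p m∈ m≢N = ℕP.≤∧≢⇒< (ℕP.≤-pred (All.lookup p m∈)) m≢N
  up-bounded : ∀ μ → occupied μ x ≡ true → All (ℕ._< suc N) (list (ns μ)) → All (ℕ._< suc N) (list (ns (φ x μ)))
  up-bounded μ o p = All.tabulate bound
    where
    bound : ∀ {m} → m ∈ list (ns (φ x μ)) → m ℕ.< suc N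
    bound {zero} _ = ℕ.s≤s ℕ.z≤n
    bound {suc m} m∈ with m ℕP.≟ N
    ... | yes refl = ⊥-elim (false-mem {suc m} {ns (φ x μ)} (occupied-φ-≡ x μ) m∈)
    ... | no m≢N = ℕ.s≤s (top-vacant μ p (true-mem {m} {ns μ}
      (trans (sym (occupied-φ-≢ x (+ suc m) μ (λ e → m≢N (ℕP.suc-injective (ℤP.+-injective e))))) (mem-true {suc m} {ns (φ x μ)} m∈))) m≢N)
  down-bounded : ∀ μ → occupied μ x ≡ true → All (ℕ._< suc N) (list (ns (φ x μ))) → All (ℕ._< suc N) (list (ns μ))
  down-bounded μ o q = All.tabulate bound
    where
    bound : ∀ {m} → m ∈ list (ns μ) → m ℕ.< suc N
    bound {m} m∈ with m ℕP.≟ N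
    ... | yes refl = ℕP.≤-refl
    ... | no m≢N = ℕP.<-trans (ℕP.n<1+n m) (All.lookup q (true-mem {suc m} {ns (φ x μ)}
      (trans (occupied-φ-≢ x (+ suc m) μ (λ e → m≢N (ℕP.suc-injective (ℤP.+-injective e)))) (mem-true {m} {ns μ} m∈))))
  open ShiftCount x (below? (suc N)) (below? (suc N)) up-bounded down-bounded
    (λ ν q → mem-false {suc N} {ns ν} (λ m → ℕP.<-irrefl refl (All.lookup q m)))
  count-empty : count empty? M ≡ count (below? N) M
  count-empty = count-≐ empty? (below? N) (basis₀ M)
    (λ { {μ} _ (p , o) → All.tabulate λ {m} m∈ → top-vacant μ p m∈ (λ { refl → false-mem {m} {ns μ} o m∈ }) })
    (λ { {μ} _ p → All.map ℕP.m<n⇒m<1+n p , mem-false {N} {ns μ} (λ m → ℕP.<-irrefl refl (All.lookup p m)) })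
  step : Dec (suc N ℕ.≤ M) → u (suc N) M ≡ u N M ℚ.+ delays (suc N) (u (suc N)) M
  step (no k≰M) = trans (cong num (trans (count-below M (ℤ.+<+ (ℕP.≰⇒> k≰M))) count-empty))
    (sym (trans (cong (u N M ℚ.+_) (delays-< (suc N) (u (suc N)) (ℕP.≰⇒> k≰M))) (ℚP.+-identityʳ _)))
  step (yes k≤M) = trans (cong num (trans (count-shift M K (trans (cong +_ (sym (ℕP.m∸n+n≡m k≤M))) (ℤP.pos-+ K (suc N))))
      (cong (ℕ._+ count (below? (suc N)) K) count-empty)))
    (trans (num-+ (count (below? N) M) _) (cong (u N M ℚ.+_)
      (sym (trans (cong (delays (suc N) (u (suc N))) (sym (ℕP.m+[n∸m]≡n k≤M))) (delays-+ (suc N) (u (suc N)) K)))))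
    where
    K : ℕ
    K = M ℕ.∸ suc N

u-0 : ∀ M → u 0 M ≡ δ M
u-0 zero = refl
u-0 (suc M) = cong num (count-none (below? 0) (basis₀ (suc M)) λ {μ} m p → let c0 , e = basis⁻ (suc M) m in vacuum μ c0 e p)
  where
  vacuum : ∀ μ → charge μ ≡ + 0 → 2L₀ μ ≡ 2 ℕ.* suc M → ¬ All (ℕ._< 0) (list (ns μ))
  vacuum (descending [] _ ∙ descending [] _) c0 () []
  vacuum (descending [] _ ∙ descending (_ ∷ _) _) () e []
  vacuum (descending (_ ∷ _) _ ∙ _) c0 e (() ∷ _)

-- By `entries-<` all entries at level M are already below M.
u-stable : ∀ N M → M ℕ.≤ N → u N M ≡ T [] M
u-stable N M M≤N = cong num (count-≐ (below? N) (emptyOn? []) (basis₀ M) (λ _ _ → [])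
  (λ {μ} m _ → let c0 , e = basis⁻ M m in All.map (λ n<M → ℕP.<-≤-trans n<M M≤N) (proj₁ (entries-< M μ c0 e))))

u-nonneg : ∀ N M → 0ℚ ℚ.≤ u N M
u-nonneg N M = 0≤num (count (below? N) M)

delays-mono : ∀ k {a b} → (∀ n → a n ℚ.≤ b n) → ∀ n → delays k a n ℚ.≤ delays k b n
delays-mono zero h n = h n
delays-mono (suc k) h zero = ℚP.≤-refl
delays-mono (suc k) h (suc n) = delays-mono k h n

∣delays∣ : ∀ k a n → ℚ.∣ delays k a n ∣ ≡ delays k (λ n → ℚ.∣ a n ∣) n
∣delays∣ zero a n = refl
∣delays∣ (suc k) a zero = refl
∣delays∣ (suc k) a (suc n) = ∣delays∣ k a n

delays-nonneg : ∀ k {a} → (∀ n → 0ℚ ℚ.≤ a n) → ∀ n → 0ℚ ℚ.≤ delays k a n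
delays-nonneg zero h n = h n
delays-nonneg (suc k) h zero = ℚP.≤-refl
delays-nonneg (suc k) h (suc n) = delays-nonneg k h n

euler : ℕ → Coefficients
euler zero = δ
euler (suc M) N = euler M N ℚ.- delays (suc M) (euler M) N

E : Coefficients
E N = euler N N

euler-stable : ∀ N k → k ℕ.≤ N → euler N k ≡ E k
euler-stable zero zero _ = refl
euler-stable (suc N) k k≤1+N with ℕP.m≤n⇒m<n∨m≡n k≤1+N
... | inj₂ refl = refl
... | inj₁ k<1+N = trans (cong (λ t → euler N k ℚ.- t) (delays-< (suc N) (euler N) k<1+N))
  (trans (ℚP.+-identityʳ (euler N k)) (euler-stable N k (ℕP.≤-pred k<1+N)))

-- The triangle inequality replaces the factor 1 - q^(N+1) by 1 + q^(N+1), which is dominated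
-- coefficientwise by the geometric series that `u-step` multiplies in. Thus Euler's product
-- inherits the growth bound of the partition counts.
∣euler∣≤u : ∀ N k → ℚ.∣ euler N k ∣ ℚ.≤ u N k
∣euler∣≤u zero k = ℚP.≤-reflexive (trans (ℚP.0≤p⇒∣p∣≡p (δ-nonneg k)) (sym (u-0 k)))
  where
  δ-nonneg : ∀ k → 0ℚ ℚ.≤ δ k
  δ-nonneg zero = 0≤/ 1 0
  δ-nonneg (suc k) = ℚP.≤-refl
∣euler∣≤u (suc N) k = ℚP.≤-trans (ℚP.∣p-q∣≤∣p∣+∣q∣ (euler N k) (delays (suc N) (euler N) k))
  (ℚP.≤-trans (ℚP.+-mono-≤ (∣euler∣≤u N k) (ℚP.≤-trans (ℚP.≤-reflexive (∣delays∣ (suc N) (euler N) k))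
      (delays-mono (suc N) (λ n → ℚP.≤-trans (∣euler∣≤u N n) (u-mono n)) k)))
    (ℚP.≤-reflexive (sym (u-step N k))))
  where
  u-mono : ∀ n → u N n ℚ.≤ u (suc N) n
  u-mono n = subst (u N n ℚ.≤_) (sym (u-step N n)) (subst (ℚ._≤ u N n ℚ.+ delays (suc N) (u (suc N)) n) (ℚP.+-identityʳ (u N n))
    (ℚP.+-monoʳ-≤ (u N n) (delays-nonneg (suc N) (u-nonneg (suc N)) n)))

∣E∣≤T : ∀ k → ℚ.∣ E k ∣ ℚ.≤ T [] k
∣E∣≤T k = subst (ℚ.∣ E k ∣ ℚ.≤_) (u-stable k k ℕP.≤-refl) (∣euler∣≤u k k)

conv-local : ∀ {a a' b b'} n → (∀ k → k ℕ.≤ n → a k ≡ a' k) → (∀ k → k ℕ.≤ n → b k ≡ b' k) → conv a b n ≡ conv a' b' n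
conv-local zero h g = cong₂ ℚ._*_ (h 0 ℕ.z≤n) (g 0 ℕ.z≤n)
conv-local (suc n) h g = cong₂ ℚ._+_ (cong₂ ℚ._*_ (h 0 ℕ.z≤n) (g (suc n) ℕP.≤-refl))
  (conv-local n (λ k le → h (suc k) (ℕ.s≤s le)) (λ k le → g k (ℕP.m≤n⇒m≤1+n le)))

conv-subˡ : ∀ a b c n → conv (λ k → a k ℚ.- b k) c n ≡ conv a c n ℚ.- conv b c n
conv-subˡ a b c zero = solve 3 (λ a b c → (a :- b) :* c := a :* c :- b :* c) refl (a 0) (b 0) (c 0)
conv-subˡ a b c (suc n) = trans (cong ((a 0 ℚ.- b 0) ℚ.* c (suc n) ℚ.+_) (conv-subˡ (a ∘ suc) (b ∘ suc) c n))
  (solve 5 (λ a b c x y → (a :- b) :* c :+ (x :- y) := a :* c :+ x :- (b :* c :+ y)) refl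
    (a 0) (b 0) (c (suc n)) (conv (a ∘ suc) c n) (conv (b ∘ suc) c n))

conv-addʳ : ∀ a b c n → conv a (λ k → b k ℚ.+ c k) n ≡ conv a b n ℚ.+ conv a c n
conv-addʳ a b c zero = ℚP.*-distribˡ-+ (a 0) (b 0) (c 0)
conv-addʳ a b c (suc n) = trans (cong (a 0 ℚ.* (b (suc n) ℚ.+ c (suc n)) ℚ.+_) (conv-addʳ (a ∘ suc) b c n))
  (solve 5 (λ a b c x y → a :* (b :+ c) :+ (x :+ y) := a :* b :+ x :+ (a :* c :+ y)) refl
    (a 0) (b (suc n)) (c (suc n)) (conv (a ∘ suc) b n) (conv (a ∘ suc) c n))

delay-cong : ∀ {a b} → (∀ n → a n ≡ b n) → ∀ n → delay a n ≡ delay b n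
delay-cong h zero = refl
delay-cong h (suc n) = h n

conv-delayˡ : ∀ a b n → conv (delay a) b n ≡ delay (conv a b) n
conv-delayˡ a b zero = ℚP.*-zeroˡ (b 0)
conv-delayˡ a b (suc n) = trans (cong (ℚ._+ conv a b n) (ℚP.*-zeroˡ (b (suc n)))) (ℚP.+-identityˡ _)

conv-delayʳ : ∀ a b n → conv a (delay b) n ≡ delay (conv a b) n
conv-delayʳ a b zero = ℚP.*-zeroʳ (a 0)
conv-delayʳ a b (suc zero) = trans (cong (a 0 ℚ.* b 0 ℚ.+_) (ℚP.*-zeroʳ (a 1))) (ℚP.+-identityʳ _)
conv-delayʳ a b (suc (suc n)) = cong (a 0 ℚ.* b (suc n) ℚ.+_) (conv-delayʳ (a ∘ suc) b (suc n))

conv-delays : ∀ k a b n → conv (delays k a) b n ≡ conv a (delays k b) n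
conv-delays zero a b n = refl
conv-delays (suc k) a b n = trans (conv-delayˡ (delays k a) b n)
  (trans (delay-cong (conv-delays k a b) n) (sym (conv-delayʳ a (delays k b) n)))

-- Passing from N to N + 1 subtracts a delayed copy in the first factor and adds one in the second.
-- `conv-delays` moves the delay across the product, and the two copies cancel.
conv-euler-u : ∀ N n → conv (euler N) (u N) n ≡ δ n
conv-euler-u zero n = trans (conv-local n (λ _ _ → refl) (λ k _ → u-0 k)) (δ-unit n)
  where
  zeros : ∀ n → conv (λ _ → 0ℚ) δ n ≡ 0ℚ
  zeros zero = refl
  zeros (suc n) = trans (ℚP.+-identityˡ _) (zeros n)
  δ-unit : ∀ n → conv δ δ n ≡ δ n
  δ-unit zero = refl
  δ-unit (suc n) = trans (ℚP.+-identityˡ _) (zeros n)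
conv-euler-u (suc N) n = trans (conv-subˡ (euler N) (delays (suc N) (euler N)) (u (suc N)) n)
  (trans (cong₂ (λ s t → s ℚ.- t)
      (trans (conv-local n (λ _ _ → refl) (λ k _ → u-step N k)) (conv-addʳ (euler N) (u N) (delays (suc N) (u (suc N))) n))
      (conv-delays (suc N) (euler N) (u (suc N)) n))
    (trans (solve 2 (λ a b → a :+ b :- b := a) refl (conv (euler N) (u N) n) (conv (euler N) (delays (suc N) (u (suc N))) n))
      (conv-euler-u N n)))

conv-E-T : ∀ n → conv E (T []) n ≡ δ n
conv-E-T n = trans (conv-local n (λ k le → sym (euler-stable n k le)) (λ k le → sym (u-stable n k le))) (conv-euler-u n n)

-- Growth of the partition counts

module PartitionGrowth (v c g : ℚ) (0≤v : 0ℚ ℚ.≤ v) (v≤1 : v ℚ.≤ 1ℚ) (0≤c : 0ℚ ℚ.≤ c) (0≤g : 0ℚ ℚ.≤ g)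
  (vc : v ℚ.* c ≡ 1ℚ) (vg : 1ℚ ℚ.+ v ℚ.* g ≡ g) where

  open Geometric v c g 0≤v v≤1 0≤c 0≤g vc vg using (v-vanishes)

  cancel : ∀ k j → c ↑ (k ℕ.+ j) ℚ.* v ↑ k ≡ c ↑ j
  cancel zero j = ℚP.*-identityʳ (c ↑ j)
  cancel (suc k) j = trans (solve 4 (λ C c V v → C :* c :* (V :* v) := C :* V :* (v :* c)) refl (c ↑ (k ℕ.+ j)) c (v ↑ k) v)
    (trans (cong (c ↑ (k ℕ.+ j) ℚ.* v ↑ k ℚ.*_) vc) (trans (ℚP.*-identityʳ _) (cancel k j)))

  -- Strong induction on k, by fuel, along `u-step`. Lowering the level by N + 1 multiplies c^k by
  -- v^(N+1), so the assumption relating A and B is exactly what closes the induction.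
  u-growth-step : ∀ N A B → 0ℚ ℚ.≤ B → A ℚ.+ B ℚ.* v ↑ suc N ℚ.≤ B →
    (∀ k → u N k ℚ.≤ A ℚ.* c ↑ k) → ∀ k → u (suc N) k ℚ.≤ B ℚ.* c ↑ k
  u-growth-step N A B 0≤B h hA k = go (suc k) k ℕP.≤-refl
    where
    go : ∀ fuel k → k ℕ.< fuel → u (suc N) k ℚ.≤ B ℚ.* c ↑ k
    go (suc fuel) k (ℕ.s≤s k≤fuel) with suc N ℕP.≤? k
    ... | no ≰ = ℚP.≤-trans (ℚP.≤-reflexive (trans (u-step N k) (trans (cong (u N k ℚ.+_) (delays-< (suc N) (u (suc N)) (ℕP.≰⇒> ≰))) (ℚP.+-identityʳ _))))
      (ℚP.≤-trans (hA k) (ℚP.*-monoʳ-≤-nonNeg (c ↑ k) {{ℚ.nonNegative (0≤↑ 0≤c k)}}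
        (ℚP.≤-trans (≤-by (B ℚ.* v ↑ suc N) (0≤* 0≤B (0≤↑ 0≤v (suc N))) (solve 2 (λ a b → a :+ b :- a := b) refl A (B ℚ.* v ↑ suc N))) h)))
    ... | yes ≤k = subst (λ k → u (suc N) k ℚ.≤ B ℚ.* c ↑ k) (ℕP.m+[n∸m]≡n ≤k)
      (ℚP.≤-trans (ℚP.≤-reflexive (trans (u-step N (suc N ℕ.+ j)) (cong (u N (suc N ℕ.+ j) ℚ.+_) (delays-+ (suc N) (u (suc N)) j))))
      (ℚP.≤-trans (ℚP.+-mono-≤ (hA (suc N ℕ.+ j)) (go fuel j (ℕP.<-≤-trans (ℕP.∸-monoʳ-< (ℕ.s≤s ℕ.z≤n) ≤k) k≤fuel)))
      (ℚP.≤-trans (ℚP.≤-reflexive (trans (cong (λ t → A ℚ.* c ↑ (suc N ℕ.+ j) ℚ.+ B ℚ.* t) (sym (cancel (suc N) j)))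
          (solve 4 (λ A B C V → A :* C :+ B :* (C :* V) := (A :+ B :* V) :* C) refl A B (c ↑ (suc N ℕ.+ j)) (v ↑ suc N))))
        (ℚP.*-monoʳ-≤-nonNeg (c ↑ (suc N ℕ.+ j)) {{ℚ.nonNegative (0≤↑ 0≤c (suc N ℕ.+ j))}} h))))
      where
      j : ℕ
      j = k ℕ.∸ suc N

  v↑≤1 : ∀ n → v ↑ n ℚ.≤ 1ℚ
  v↑≤1 zero = ℚP.≤-refl
  v↑≤1 (suc n) = ℚP.≤-trans (*-mono (v ↑ n) 1ℚ v 1ℚ (0≤↑ 0≤v n) (0≤/ 1 0) (v↑≤1 n) v≤1) (ℚP.≤-reflexive (ℚP.*-identityˡ 1ℚ))

  -- Each new part size costs a factor g. The constant g^N is unbounded in N, so it serves only for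
  -- the finitely many part sizes at the start of `T-growth`.
  u-growth : ∀ N k → u N k ℚ.≤ g ↑ N ℚ.* c ↑ k
  u-growth zero k = ℚP.≤-trans (ℚP.≤-reflexive (u-0 k)) (ℚP.≤-trans (δ≤ k) (ℚP.≤-reflexive (sym (ℚP.*-identityˡ (c ↑ k)))))
    where
    δ≤ : ∀ k → δ k ℚ.≤ c ↑ k
    δ≤ zero = ℚP.≤-refl
    δ≤ (suc k) = 0≤↑ 0≤c (suc k)
  u-growth (suc N) = u-growth-step N (g ↑ N) (g ↑ suc N) (0≤↑ 0≤g (suc N))
    (≤-by (g ↑ N ℚ.* (g ℚ.* v) ℚ.* (1ℚ ℚ.- v ↑ N)) (0≤* (0≤* (0≤↑ 0≤g N) (0≤* 0≤g 0≤v)) (p≤q⇒0≤q-p (v↑≤1 N)))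
      (trans (cong (λ t → g ↑ N ℚ.* t ℚ.- (g ↑ N ℚ.+ g ↑ N ℚ.* g ℚ.* (v ↑ N ℚ.* v))) (sym vg))
        (solve 4 (λ G g v V → G :* (con 1ℚ :+ v :* g) :- (G :+ G :* g :* (V :* v)) := G :* (g :* v) :* (con 1ℚ :- V)) refl (g ↑ N) g v (v ↑ N))))
    (u-growth N)

  -- From M on, where g vᴹ ≤ ½, the constants 2 gᴹ (1 - g v^(N+1)) do, g v^(N+1) being the sum of vᵐ over m > N.
  T-growth : Σ[ B ∈ ℚ ] (0ℚ ℚ.≤ B × ∀ k → T [] k ℚ.≤ B ℚ.* c ↑ k)
  T-growth = H ℚ.+ H , 0≤+ 0≤H 0≤H , λ k → ℚP.≤-trans (ℚP.≤-reflexive (sym (u-stable (k ℕ.+ M) k (ℕP.m≤m+n k M))))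
      (ℚP.≤-trans (late k k) (ℚP.*-monoʳ-≤-nonNeg (c ↑ k) {{ℚ.nonNegative (0≤↑ 0≤c k)}} (b≤ k)))
    where
    M : ℕ
    M = proj₁ (v-vanishes 0≤g ½ 0<½)
    small : ∀ k → M ℕ.≤ k → g ℚ.* v ↑ k ℚ.≤ ½
    small = proj₂ (v-vanishes 0≤g ½ 0<½)
    H : ℚ
    H = g ↑ M
    0≤H : 0ℚ ℚ.≤ H
    0≤H = 0≤↑ 0≤g M
    b : ℕ → ℚ
    b j = (H ℚ.+ H) ℚ.* (1ℚ ℚ.- g ℚ.* v ↑ suc (j ℕ.+ M))
    t : ℕ → ℚ
    t j = v ↑ suc (j ℕ.+ M)
    b≤ : ∀ j → b j ℚ.≤ H ℚ.+ H
    b≤ j = ≤-by ((H ℚ.+ H) ℚ.* (g ℚ.* t j)) (0≤* (0≤+ 0≤H 0≤H) (0≤* 0≤g (0≤↑ 0≤v (suc (j ℕ.+ M)))))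
      (solve 2 (λ h x → h :- h :* (con 1ℚ :- x) := h :* x) refl (H ℚ.+ H) (g ℚ.* t j))
    0≤b : ∀ j → 0ℚ ℚ.≤ b j
    0≤b j = 0≤* (0≤+ 0≤H 0≤H) (p≤q⇒0≤q-p (ℚP.≤-trans (small (suc (j ℕ.+ M)) (ℕP.m≤n⇒m≤1+n (ℕP.m≤n+m M j))) (/-≤ 1 1 1 0 (ℕ.s≤s ℕ.z≤n))))
    start : H ℚ.≤ b 0
    start = ≤-by ((H ℚ.+ H) ℚ.* (½ ℚ.- g ℚ.* t 0)) (0≤* (0≤+ 0≤H 0≤H) (p≤q⇒0≤q-p (small (suc M) (ℕP.n≤1+n M))))
      (trans (cong (λ z → (H ℚ.+ H) ℚ.* (1ℚ ℚ.- g ℚ.* t 0) ℚ.- z) (sym (halves-+ H)))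
        (solve 3 (λ h x k → h :* (con 1ℚ :- x) :- h :* k := h :* (con 1ℚ :- k :- x)) refl (H ℚ.+ H) (g ℚ.* t 0) ½))
      where
      halves-+ : ∀ h → (h ℚ.+ h) ℚ.* ½ ≡ h
      halves-+ h = trans (ℚP.*-distribʳ-+ ½ h h) (halves h)
    late : ∀ j k → u (j ℕ.+ M) k ℚ.≤ b j ℚ.* c ↑ k
    late zero k = ℚP.≤-trans (u-growth M k) (ℚP.*-monoʳ-≤-nonNeg (c ↑ k) {{ℚ.nonNegative (0≤↑ 0≤c k)}} start)
    late (suc j) = u-growth-step (j ℕ.+ M) (b j) (b (suc j)) (0≤b (suc j))
      (≤-by ((H ℚ.+ H) ℚ.* (g ℚ.* (t j ℚ.* v)) ℚ.* t j)
        (0≤* (0≤* (0≤+ 0≤H 0≤H) (0≤* 0≤g (0≤* (0≤↑ 0≤v (suc (j ℕ.+ M))) 0≤v))) (0≤↑ 0≤v (suc (j ℕ.+ M))))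
        (trans (cong (λ z → (H ℚ.+ H) ℚ.* (1ℚ ℚ.- g ℚ.* (t j ℚ.* v)) ℚ.- ((H ℚ.+ H) ℚ.* (1ℚ ℚ.- z ℚ.* t j) ℚ.+ (H ℚ.+ H) ℚ.* (1ℚ ℚ.- g ℚ.* (t j ℚ.* v)) ℚ.* t j)) (sym vg))
          (solve 4 (λ h g t v → h :* (con 1ℚ :- g :* (t :* v)) :- (h :* (con 1ℚ :- (con 1ℚ :+ v :* g) :* t) :+ h :* (con 1ℚ :- g :* (t :* v)) :* t)
             := h :* (g :* (t :* v)) :* t) refl (H ℚ.+ H) g (t j) v)))
      (late j)

-- The exponential near 0 and bounds for π

module ExpExpansion (a : ℚ) (0≤a : 0ℚ ℚ.≤ a) (a≤1 : a ℚ.≤ 1ℚ) where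

  ∣-a∣≤1 : ℚ.∣ ℚ.- a ∣ ℚ.≤ 1ℚ
  ∣-a∣≤1 = subst (ℚ._≤ 1ℚ) (sym (trans (ℚP.∣-p∣≡∣p∣ a) (ℚP.0≤p⇒∣p∣≡p 0≤a))) a≤1

  -- Every further term brings a factor a/(j + 3), at most ½, so the tail is dominated by a
  -- geometric series of total a².
  term-bound : ∀ j → ℚ.∣ expTerm (ℚ.- a) (2 ℕ.+ j) ∣ ℚ.≤ a ℚ.* a ℚ.* ½ ↑ suc j
  term-bound zero = ℚP.≤-reflexive (trans (cong ℚ.∣_∣ (solve 2 (λ a k → con 1ℚ :* (:- a) :* con 1ℚ :* (:- a) :* k := a :* a :* (con 1ℚ :* k)) refl a ½))
    (ℚP.0≤p⇒∣p∣≡p (0≤* (0≤* 0≤a 0≤a) (0≤↑ (ℚP.<⇒≤ 0<½) 1))))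
  term-bound (suc j) = subst (ℚ._≤ a ℚ.* a ℚ.* ½ ↑ suc (suc j))
    (sym (trans (ℚP.∣p*q∣≡∣p∣*∣q∣ (t ℚ.* (ℚ.- a)) i) (cong₂ ℚ._*_ (ℚP.∣p*q∣≡∣p∣*∣q∣ t (ℚ.- a)) (ℚP.0≤p⇒∣p∣≡p (0≤/ 1 (2 ℕ.+ j))))))
    (ℚP.≤-trans (*-mono (ℚ.∣ t ∣ ℚ.* ℚ.∣ ℚ.- a ∣) (a ℚ.* a ℚ.* ½ ↑ suc j) i ½ (0≤* (ℚP.0≤∣p∣ t) (ℚP.0≤∣p∣ (ℚ.- a))) (ℚP.<⇒≤ 0<½)
        (ℚP.≤-trans (*-mono ℚ.∣ t ∣ (a ℚ.* a ℚ.* ½ ↑ suc j) ℚ.∣ ℚ.- a ∣ 1ℚ (ℚP.0≤∣p∣ t) (0≤/ 1 0) (term-bound j) ∣-a∣≤1)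
          (ℚP.≤-reflexive (ℚP.*-identityʳ _)))
        (/-≤ 1 1 (2 ℕ.+ j) 1 (ℕP.+-monoˡ-≤ 0 {2} {3 ℕ.+ j} (ℕ.s≤s (ℕ.s≤s ℕ.z≤n)))))
      (ℚP.≤-reflexive (ℚP.*-assoc (a ℚ.* a) (½ ↑ suc j) ½)))
    where
    t i : ℚ
    t = expTerm (ℚ.- a) (2 ℕ.+ j)
    i = + 1 / (3 ℕ.+ j)

  partial-bound : ∀ j → ℚ.∣ expPartial (ℚ.- a) (2 ℕ.+ j) ℚ.- (1ℚ ℚ.- a) ∣ ℚ.≤ a ℚ.* a ℚ.* (1ℚ ℚ.- ½ ↑ j)
  partial-bound zero = ℚP.≤-reflexive (trans (cong ℚ.∣_∣
      (solve 1 (λ a → con 0ℚ :+ con 1ℚ :+ con 1ℚ :* (:- a) :* con 1ℚ :- (con 1ℚ :- a) := con 0ℚ) refl a))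
    (sym (ℚP.*-zeroʳ (a ℚ.* a))))
  partial-bound (suc j) = ℚP.≤-trans (ℚP.≤-reflexive (cong ℚ.∣_∣
      (solve 3 (λ s t a → s :+ t :- a := (s :- a) :+ t) refl (expPartial (ℚ.- a) (2 ℕ.+ j)) (expTerm (ℚ.- a) (2 ℕ.+ j)) (1ℚ ℚ.- a))))
    (ℚP.≤-trans (ℚP.∣p+q∣≤∣p∣+∣q∣ (expPartial (ℚ.- a) (2 ℕ.+ j) ℚ.- (1ℚ ℚ.- a)) (expTerm (ℚ.- a) (2 ℕ.+ j)))
    (ℚP.≤-trans (ℚP.+-mono-≤ (partial-bound j) (term-bound j))
      (ℚP.≤-reflexive (trans (cong (λ h → a ℚ.* a ℚ.* (1ℚ ℚ.- h) ℚ.+ a ℚ.* a ℚ.* ½ ↑ suc j) (sym (halves (½ ↑ j))))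
        (solve 2 (λ a h → a :* (con 1ℚ :- (h :+ h)) :+ a :* h := a :* (con 1ℚ :- h)) refl (a ℚ.* a) (½ ↑ suc j))))))

  -- The bound is uniform in the number of terms, so it applies along the diagonal sequence by which
  -- `exp` is defined.
  exp-bound : ∀ n → 2 ℕ.≤ n → ℚ.∣ expPartial (ℚ.- a) n ℚ.- (1ℚ ℚ.- a) ∣ ℚ.≤ a ℚ.* a
  exp-bound n 2≤n = subst (λ n → ℚ.∣ expPartial (ℚ.- a) n ℚ.- (1ℚ ℚ.- a) ∣ ℚ.≤ a ℚ.* a) (ℕP.m+[n∸m]≡n 2≤n)
    (ℚP.≤-trans (partial-bound (n ℕ.∸ 2)) (≤-by (a ℚ.* a ℚ.* ½ ↑ (n ℕ.∸ 2)) (0≤* (0≤* 0≤a 0≤a) (0≤↑ (ℚP.<⇒≤ 0<½) (n ℕ.∸ 2)))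
      (solve 2 (λ a h → a :- a :* (con 1ℚ :- h) := a :* h) refl (a ℚ.* a) (½ ↑ (n ℕ.∸ 2)))))

π-lower : ∀ n → 1 ℕ.≤ n → 1ℚ ℚ.≤ seq π n
π-lower (suc n) _ = ≤-by ((+ 5 / 3) ℚ.+ ((+ 4 / 3) ℚ.- leibniz 1 n)) (0≤+ (0≤/ 5 2) (p≤q⇒0≤q-p (proj₂ (leibniz-bounds n 1))))
  (solve 1 (λ l → con (+ 4 / 1) :- l :- con 1ℚ := con (+ 5 / 3) :+ (con (+ 4 / 3) :- l)) refl (leibniz 1 n))

π-upper : ∀ n → seq π n ℚ.≤ + 4 / 1
π-upper n = proj₂ (leibniz-bounds n 0)

-- Construction of a gas

module _ (z q : ℝ) (0≤z : Nonneg z) (z≤1 : z ≼ 1ℝ) (q-expansion : Bd (q - (1ℝ - z)) (z * z)) (0≤q : Nonneg q)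
  (v c g : ℚ) (0≤v : 0ℚ ℚ.≤ v) (v≤1 : v ℚ.≤ 1ℚ) (0≤c : 0ℚ ℚ.≤ c) (0≤g : 0ℚ ℚ.≤ g)
  (vc : v ℚ.* c ≡ 1ℚ) (vg : 1ℚ ℚ.+ v ℚ.* g ≡ g) (q≤v³ : q ≼ fromℚ (v ℚ.* v ℚ.* v)) where

  private
    open Geometric v c g 0≤v v≤1 0≤c 0≤g vc vg
    open Evaluate q (bd-nn 0≤q q≤v³)
    open PartitionGrowth v c g 0≤v v≤1 0≤c 0≤g vc vg using (T-growth)

    B : ℚ
    B = proj₁ T-growth

    0≤B : 0ℚ ℚ.≤ B
    0≤B = proj₁ (proj₂ T-growth)

    growth-T : ∀ X → Growth (T X) B
    growth-T X k = subst (ℚ._≤ B ℚ.* c ↑ k) (sym (ℚP.0≤p⇒∣p∣≡p (T-nonneg X k))) (ℚP.≤-trans (T-≤ X k) (proj₂ (proj₂ T-growth) k))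

    growth-E : Growth E B
    growth-E k = ℚP.≤-trans (∣E∣≤T k) (proj₂ (proj₂ T-growth) k)

    τ : List ℤ → ℝ
    τ X = proj₁ (sum-exists (T X) 0≤B (growth-T X))

    sum-T : ∀ X → Sum q (T X) (τ X)
    sum-T X = proj₂ (sum-exists (T X) 0≤B (growth-T X))

    ε : ℝ
    ε = proj₁ (sum-exists E 0≤B growth-E)

    sum-E-T : ∀ X → Sum q (conv E (T X)) (ε * τ X)
    sum-E-T X = sum-product 0≤B 0≤B growth-E (growth-T X) (proj₂ (sum-exists E 0≤B growth-E)) (sum-T X)

    normalised : ε * τ [] ≈ 1ℝ
    normalised = converges-unique (sum-cong conv-E-T (sum-E-T [])) (sum-δ q)

    τ-nonneg : ∀ X → Nonneg (τ X)
    τ-nonneg X = converges-nonneg (horner-nonneg q (T X) 0≤q (T-nonneg X)) (sum-T X)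

    -- The coefficients of Euler's product have both signs, so positivity is read off from ε = ε²
    -- τ([]), where τ has nonnegative coefficients.
    ε-nonneg : Nonneg ε
    ε-nonneg = nn-≈ (≈-trans (≈-pt λ n → ℚP.*-assoc (seq ε n) (seq ε n) (seq (τ []) n))
      (≈-trans (*-cong (≈-refl {ε}) normalised) (≈-pt λ n → ℚP.*-identityʳ (seq ε n))))
      (nn-square ε nn* τ-nonneg [])

    p-nonneg : ∀ X → Nonneg (ε * τ X)
    p-nonneg X = ε-nonneg nn* τ-nonneg X

    p≤1 : ∀ X → ε * τ X ≼ 1ℝ
    p≤1 X = ≼-trans (≼-pt (ε-nonneg nn* _≼_.diff (sum-≼ 0≤q (T-≤ X) (sum-T X) (sum-T [])))
        (λ n → solve 3 (λ e s t → e :* t :- e :* s := e :* (t :- s)) refl (seq ε n) (seq (τ X) n) (seq (τ []) n)))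
      (≈⇒≼ normalised)

    τ-recurrence : ∀ x A → x ∉ A → q ^ neg⁻ x * τ A ≈ q ^ neg⁻ x * τ (x ∷ A) + q ^ pos x * τ (shift (x ∷ A))
    τ-recurrence x A x∉A = converges-unique (sum-delays (neg⁻ x) (sum-T A))
      (sum-cong (λ k → sym (T-recurrence x A x∉A k)) (sum-+ (sum-delays (neg⁻ x) (sum-T (x ∷ A))) (sum-delays (pos x) (sum-T (shift (x ∷ A))))))

  gas : Gas
  gas = record
    { z = z ; q = q ; 0≤z = 0≤z ; z≤1 = z≤1 ; q-expansion = q-expansion
    ; p = λ X → ε * τ X
    ; p-bounded = λ X → bd-nn (p-nonneg X) (p≤1 X)
    ; p-[] = normalised
    ; p-↭ = λ {X} {Y} X↭Y → *-cong (≈-refl {ε}) (converges-unique (sum-cong (T-↭ X↭Y) (sum-T X)) (sum-T Y))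
    ; recurrence = λ x A x∉A → ≈-trans (≈-pt λ n → swap (seq (q ^ neg⁻ x) n) (seq ε n) (seq (τ A) n))
        (≈-trans (*-cong (≈-refl {ε}) (τ-recurrence x A x∉A)) (≈-pt λ n →
          solve 5 (λ e β t α s → e :* (β :* t :+ α :* s) := β :* (e :* t) :+ α :* (e :* s)) refl
            (seq ε n) (seq (q ^ neg⁻ x) n) (seq (τ (x ∷ A)) n) (seq (q ^ pos x) n) (seq (τ (shift (x ∷ A))) n)))
    }
    where
    swap : ∀ a b c → a ℚ.* (b ℚ.* c) ≡ b ℚ.* (a ℚ.* c)
    swap = solve 3 (λ a b c → a :* (b :* c) := b :* (a :* c)) refl

  gas-sum : ∀ X → Sum q (conv E (T X)) (Gas.p gas X)
  gas-sum = sum-E-T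

-- q ≤ 1 - z/2 ≤ (1 - x)³ for every x ≤ z/6; x is taken to be 1/(j + 2).
module SmallTemperature (y : ℝ) (0<y : 0ℝ < y) (y<δ : y < fromℚ (+ 1 / 16)) where

  z q : ℝ
  z = fromℚ (+ 2 / 1) * π * y
  q = exp (- z)

  private
    ε₀ : ℚ
    ε₀ = proj₁ 0<y

    0<ε₀ : 0ℚ ℚ.< ε₀
    0<ε₀ = proj₁ (proj₂ 0<y)

    -- Beyond this index both bounds on y hold for its entries, and the added 2 ensures that the
    -- partial exponential sum contains the terms 1 - z.
    N : ℕ
    N = proj₁ (proj₂ (proj₂ 0<y)) ℕ.+ (proj₁ (proj₂ (proj₂ y<δ)) ℕ.+ 2)

    y-lower : ∀ n → N ℕ.≤ n → ε₀ ℚ.≤ seq y n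
    y-lower n h = subst (ℚ._≤ seq y n) (ℚP.+-identityˡ ε₀) (proj₂ (proj₂ (proj₂ 0<y)) n (ℕP.m+n≤o⇒m≤o _ h))

    y-upper : ∀ n → N ℕ.≤ n → seq y n ℚ.≤ + 1 / 16
    y-upper n h = ℚP.≤-trans (≤-by (proj₁ y<δ) (ℚP.<⇒≤ (proj₁ (proj₂ y<δ))) (solve 2 (λ y e → y :+ e :- y := e) refl (seq y n) (proj₁ y<δ)))
      (proj₂ (proj₂ (proj₂ y<δ)) n (ℕP.m+n≤o⇒m≤o _ (ℕP.m+n≤o⇒n≤o (proj₁ (proj₂ (proj₂ 0<y))) h)))

    2≤ : ∀ n → N ℕ.≤ n → 2 ℕ.≤ n
    2≤ n h = ℕP.m+n≤o⇒n≤o (proj₁ (proj₂ (proj₂ y<δ))) (ℕP.m+n≤o⇒n≤o (proj₁ (proj₂ (proj₂ 0<y))) h)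

    z-lower : ∀ n → N ℕ.≤ n → ε₀ ℚ.≤ seq z n
    z-lower n h = ℚP.≤-trans (y-lower n h) (≤-by (((+ 2 / 1) ℚ.* (seq π n ℚ.- 1ℚ) ℚ.+ 1ℚ) ℚ.* seq y n)
      (0≤* (0≤+ (0≤* (0≤/ 2 0) (p≤q⇒0≤q-p (π-lower n (ℕP.≤-trans (ℕ.s≤s ℕ.z≤n) (2≤ n h))))) (0≤/ 1 0)) (ℚP.≤-trans (ℚP.<⇒≤ 0<ε₀) (y-lower n h)))
      (solve 2 (λ p y → con (+ 2 / 1) :* p :* y :- y := (con (+ 2 / 1) :* (p :- con 1ℚ) :+ con 1ℚ) :* y) refl (seq π n) (seq y n)))

    0≤zₙ : ∀ n → N ℕ.≤ n → 0ℚ ℚ.≤ seq z n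
    0≤zₙ n h = ℚP.≤-trans (ℚP.<⇒≤ 0<ε₀) (z-lower n h)

    z-upper : ∀ n → N ℕ.≤ n → seq z n ℚ.≤ ½
    z-upper n h = *-mono ((+ 2 / 1) ℚ.* seq π n) (+ 8 / 1) (seq y n) (+ 1 / 16)
      (0≤* (0≤/ 2 0) (ℚP.≤-trans (0≤/ 1 0) (π-lower n (ℕP.≤-trans (ℕ.s≤s ℕ.z≤n) (2≤ n h)))))
      (0≤/ 1 15)
      (ℚP.*-monoˡ-≤-nonNeg (+ 2 / 1) (π-upper n))
      (y-upper n h)

    ½≤1 : ½ ℚ.≤ 1ℚ
    ½≤1 = /-≤ 1 1 1 0 (ℕ.s≤s ℕ.z≤n)

    q-bound : ∀ n → N ℕ.≤ n → ℚ.∣ seq q n ℚ.- (1ℚ ℚ.- seq z n) ∣ ℚ.≤ seq z n ℚ.* seq z n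
    q-bound n h = ExpExpansion.exp-bound (seq z n) (0≤zₙ n h) (ℚP.≤-trans (z-upper n h) ½≤1) n (2≤ n h)

    scale : Σ[ j ∈ ℕ ] + 6 / suc j ℚ.≤ ε₀
    scale = archimedean 6 ε₀ 0<ε₀

    j : ℕ
    j = proj₁ scale

    -- v is (j + 1)/(j + 2); its inverse c and its geometric sum g = j + 2 are then explicit
    -- rationals.
    w x v c g : ℚ
    w = + 1 / suc j
    x = + 1 / suc (suc j)
    v = 1ℚ ℚ.- x
    c = 1ℚ ℚ.+ w
    g = num (suc (suc j))

    gx : g ℚ.* x ≡ 1ℚ
    gx = trans (cong (ℚ._* x) (+/1 (suc (suc j)))) (suc*1/suc (suc j))

    gw : num (suc j) ℚ.* w ≡ 1ℚ
    gw = trans (cong (ℚ._* w) (+/1 (suc j))) (suc*1/suc j)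

    x≤1 : x ℚ.≤ 1ℚ
    x≤1 = /-≤ 1 1 (suc j) 0 (ℕ.s≤s ℕ.z≤n)

    0≤x : 0ℚ ℚ.≤ x
    0≤x = 0≤/ 1 (suc j)

    vc : v ℚ.* c ≡ 1ℚ
    vc = trans (solve 2 (λ x w → (con 1ℚ :- x) :* (con 1ℚ :+ w) := con 1ℚ :+ (w :* con 1ℚ :- x :* con 1ℚ :- x :* w)) refl x w)
      (trans (cong₂ (λ s t → 1ℚ ℚ.+ (w ℚ.* s ℚ.- x ℚ.* t ℚ.- x ℚ.* w)) (sym gx) (sym gw))
        (solve 3 (λ x w n → con 1ℚ :+ (w :* ((n :+ con 1ℚ) :* x) :- x :* (n :* w) :- x :* w) := con 1ℚ) refl x w (num (suc j))))

    vg : 1ℚ ℚ.+ v ℚ.* g ≡ g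
    vg = trans (solve 2 (λ x g → con 1ℚ :+ (con 1ℚ :- x) :* g := con 1ℚ :+ g :- g :* x) refl x g)
      (trans (cong (λ t → 1ℚ ℚ.+ g ℚ.- t) gx) (solve 1 (λ g → con 1ℚ :+ g :- con 1ℚ := g) refl g))

    6x≤z : ∀ n → N ℕ.≤ n → (+ 6 / 1) ℚ.* x ℚ.≤ seq z n
    6x≤z n h = ℚP.≤-trans (ℚP.≤-reflexive (/-* 6 (suc j))) (ℚP.≤-trans (/-≤ 6 6 (suc j) j (ℕP.*-monoʳ-≤ 6 (ℕP.n≤1+n (suc j)))) (ℚP.≤-trans (proj₂ scale) (z-lower n h)))

    0≤z : Nonneg z
    0≤z = nn-eventually N 0≤zₙ

    z≤1 : z ≼ 1ℝ
    z≤1 = le (nn-eventually N λ n h → p≤q⇒0≤q-p (ℚP.≤-trans (z-upper n h) ½≤1))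

    q-expansion : Bd (q - (1ℝ - z)) (z * z)
    q-expansion = bd
      (nn-eventually N λ n h → subst (0ℚ ℚ.≤_) (solve 2 (λ d c → c :- (:- d) := c :+ d) refl (seq q n ℚ.- (1ℚ ℚ.- seq z n)) (seq z n ℚ.* seq z n))
        (p≤q⇒0≤q-p (∣p∣≤⇒-p≤ {seq q n ℚ.- (1ℚ ℚ.- seq z n)} (q-bound n h))))
      (nn-eventually N λ n h → p≤q⇒0≤q-p (∣p∣≤⇒p≤ {seq q n ℚ.- (1ℚ ℚ.- seq z n)} (q-bound n h)))

    0≤½-z : ∀ n → N ℕ.≤ n → 0ℚ ℚ.≤ ½ ℚ.- seq z n
    0≤½-z n h = p≤q⇒0≤q-p (z-upper n h)

    0≤q : Nonneg q
    0≤q = nn-≗ (λ n → solve 2 (λ q z → (z :* z :+ (q :- (con 1ℚ :- z))) :+ (con 1ℚ :- z :- z :* z) := q) refl (seq q n) (seq z n))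
      (Bd.lo q-expansion nn+ nn-eventually {1ℝ - z - z * z} N λ n h → subst (0ℚ ℚ.≤_)
        (solve 2 (λ k z → (k :- z) :* (con 1ℚ :+ z) :+ k :* (con 1ℚ :- z) := k :+ k :- z :- z :* z) refl ½ (seq z n))
        (0≤+ (0≤* (0≤½-z n h) (0≤+ (0≤/ 1 0) (0≤zₙ n h)))
          (0≤* (ℚP.<⇒≤ 0<½) (p≤q⇒0≤q-p (ℚP.≤-trans (z-upper n h) ½≤1)))))

    -- Since q is at most 1 - z + z², it suffices that (1 - x)³ minus this bound is z(½ - z) + ½(z -
    -- 6x) + x²(3 - x), a sum of nonnegative terms.
    q≤v³ : q ≼ fromℚ (v ℚ.* v ℚ.* v)
    q≤v³ = le (nn-≗ (λ n → solve 3 (λ q z V → (z :* z :- (q :- (con 1ℚ :- z))) :+ (V :- con 1ℚ :+ z :- z :* z) := V :- q) refl (seq q n) (seq z n) (v ℚ.* v ℚ.* v))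
      (Bd.hi q-expansion nn+ nn-eventually {fromℚ (v ℚ.* v ℚ.* v) - 1ℝ + z - z * z} N λ n h → subst (0ℚ ℚ.≤_)
        (solve-cube (seq z n) x ½ refl)
        (0≤+ (0≤+ (0≤* (0≤zₙ n h) (0≤½-z n h)) (0≤* (ℚP.<⇒≤ 0<½) (p≤q⇒0≤q-p (6x≤z n h))))
          (0≤* (0≤* 0≤x 0≤x) (0≤+ (0≤/ 2 0) (p≤q⇒0≤q-p x≤1))))))
      where
      solve-cube : ∀ z x k → k ℚ.+ k ≡ 1ℚ →
        z ℚ.* (k ℚ.- z) ℚ.+ k ℚ.* (z ℚ.- (+ 6 / 1) ℚ.* x) ℚ.+ x ℚ.* x ℚ.* ((+ 2 / 1) ℚ.+ (1ℚ ℚ.- x))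
        ≡ (1ℚ ℚ.- x) ℚ.* (1ℚ ℚ.- x) ℚ.* (1ℚ ℚ.- x) ℚ.- 1ℚ ℚ.+ z ℚ.- z ℚ.* z
      solve-cube z x k 2k = trans
        (solve 3 (λ z x k → z :* (k :- z) :+ k :* (z :- con (+ 6 / 1) :* x) :+ x :* x :* (con (+ 2 / 1) :+ (con 1ℚ :- x))
          := (z :- con (+ 3 / 1) :* x) :* (k :+ k) :+ (con (+ 3 / 1) :* x :* x :- x :* x :* x :- z :* z)) refl z x k)
        (trans (cong (λ t → (z ℚ.- (+ 3 / 1) ℚ.* x) ℚ.* t ℚ.+ ((+ 3 / 1) ℚ.* x ℚ.* x ℚ.- x ℚ.* x ℚ.* x ℚ.- z ℚ.* z)) 2k)
          (solve 2 (λ z x → (z :- con (+ 3 / 1) :* x) :* con 1ℚ :+ (con (+ 3 / 1) :* x :* x :- x :* x :* x :- z :* z)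
            := (con 1ℚ :- x) :* (con 1ℚ :- x) :* (con 1ℚ :- x) :- con 1ℚ :+ z :- z :* z) refl z x))

  thermal-gas : Σ[ D ∈ Gas ] ((Gas.z D ≡ z) × (∀ X → Sum q (conv E (T X)) (Gas.p D X)))
  thermal-gas = gas z q 0≤z z≤1 q-expansion 0≤q v c g (p≤q⇒0≤q-p x≤1) v≤1 (0≤+ (0≤/ 1 0) (0≤/ 1 j)) (0≤num (suc (suc j))) vc vg q≤v³ , refl ,
    gas-sum z q 0≤z z≤1 q-expansion 0≤q v c g (p≤q⇒0≤q-p x≤1) v≤1 (0≤+ (0≤/ 1 0) (0≤/ 1 j)) (0≤num (suc (suc j))) vc vg q≤v³
    where
    v≤1 : v ℚ.≤ 1ℚ
    v≤1 = ≤-by x 0≤x (solve 1 (λ x → con 1ℚ :- (con 1ℚ :- x) := x) refl x)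

-- The trace as a count of monomials

infix 4 _≗ᶜ_

-- All coefficients of G are complex numbers represented by constant sequences.
record _≗ᶜ_ (z : ℂ) (p : ℚ) : Set where
  constructor constant
  field
    real : ∀ n → seq (re z) n ≡ p
    imag : ∀ n → seq (im z) n ≡ 0ℚ

≗ᶜ-0 : 0ᶜ ≗ᶜ 0ℚ
≗ᶜ-0 = constant (λ _ → refl) (λ _ → refl)

≗ᶜ-1 : 1ᶜ ≗ᶜ 1ℚ
≗ᶜ-1 = constant (λ _ → refl) (λ _ → refl)

≗ᶜ-+ : ∀ {z w p r} → z ≗ᶜ p → w ≗ᶜ r → z +ᶜ w ≗ᶜ p ℚ.+ r
≗ᶜ-+ (constant a b) (constant c d) =
  constant (λ n → cong₂ ℚ._+_ (a n) (c n)) (λ n → trans (cong₂ ℚ._+_ (b n) (d n)) (ℚP.+-identityʳ 0ℚ))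

≗ᶜ-neg : ∀ {z p} → z ≗ᶜ p → -ᶜ z ≗ᶜ ℚ.- p
≗ᶜ-neg (constant a b) = constant (λ n → cong (λ t → ℚ.- t) (a n)) (λ n → cong (λ t → ℚ.- t) (b n))

≗ᶜ-* : ∀ {z w p r} → z ≗ᶜ p → w ≗ᶜ r → z *ᶜ w ≗ᶜ p ℚ.* r
≗ᶜ-* {p = p} {r} (constant a b) (constant c d) = constant
  (λ n → trans (cong₂ ℚ._-_ (cong₂ ℚ._*_ (a n) (c n)) (cong₂ ℚ._*_ (b n) (d n)))
    (solve 2 (λ p r → p :* r :- con 0ℚ :* con 0ℚ := p :* r) refl p r))
  (λ n → trans (cong₂ ℚ._+_ (cong₂ ℚ._*_ (a n) (d n)) (cong₂ ℚ._*_ (b n) (c n)))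
    (solve 2 (λ p r → p :* con 0ℚ :+ con 0ℚ :* r := con 0ℚ) refl p r))

≗ᶜ-≡ : ∀ {z p r} → p ≡ r → z ≗ᶜ p → z ≗ᶜ r
≗ᶜ-≡ refl h = h

∑ℚ : ℕ → (ℕ → ℚ) → ℚ
∑ℚ zero f = 0ℚ
∑ℚ (suc n) f = ∑ℚ n f ℚ.+ f n

≗ᶜ-∑ : ∀ n {f g} → (∀ i → f i ≗ᶜ g i) → ∑ n f ≗ᶜ ∑ℚ n g
≗ᶜ-∑ zero h = ≗ᶜ-0
≗ᶜ-∑ (suc n) h = ≗ᶜ-+ (≗ᶜ-∑ n h) (h n)

∑ℚ-front : ∀ n f → ∑ℚ (suc n) f ≡ f 0 ℚ.+ ∑ℚ n (f ∘ suc)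
∑ℚ-front zero f = ℚP.+-comm 0ℚ (f 0)
∑ℚ-front (suc n) f = trans (cong (ℚ._+ f (suc n)) (∑ℚ-front n f)) (ℚP.+-assoc (f 0) (∑ℚ n (f ∘ suc)) (f (suc n)))

∑ℚ-conv : ∀ n a b → ∑ℚ (suc n) (λ i → a i ℚ.* b (n ℕ.∸ i)) ≡ conv a b n
∑ℚ-conv zero a b = ℚP.+-identityˡ _
∑ℚ-conv (suc n) a b = trans (∑ℚ-front (suc n) (λ i → a i ℚ.* b (suc n ℕ.∸ i)))
  (cong (a 0 ℚ.* b (suc n) ℚ.+_) (∑ℚ-conv n (a ∘ suc) b))

≗ᶜ-⊛ : ∀ {f g a b} → (∀ N → f N ≗ᶜ a N) → (∀ N → g N ≗ᶜ b N) → ∀ N → (f ⊛ g) N ≗ᶜ conv a b N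
≗ᶜ-⊛ {a = a} {b} h k N = ≗ᶜ-≡ (∑ℚ-conv N a b) (≗ᶜ-∑ (suc N) (λ i → ≗ᶜ-* (h i) (k (N ℕ.∸ i))))

≗ᶜ-monomial : ∀ k N → monomial k N ≗ᶜ delays k δ N
≗ᶜ-monomial zero zero = ≗ᶜ-1
≗ᶜ-monomial zero (suc N) = ≗ᶜ-0
≗ᶜ-monomial (suc k) zero = ≗ᶜ-0
≗ᶜ-monomial (suc k) (suc N) = ≗ᶜ-monomial k N

conv-δʳ : ∀ a n → conv a δ n ≡ a n
conv-δʳ a zero = ℚP.*-identityʳ (a 0)
conv-δʳ a (suc n) = trans (cong₂ ℚ._+_ (ℚP.*-zeroʳ (a 0)) (conv-δʳ (a ∘ suc) n)) (ℚP.+-identityˡ _)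

≗ᶜ-eulerPartial : ∀ M N → eulerPartial M N ≗ᶜ euler M N
≗ᶜ-eulerPartial zero N = ≗ᶜ-monomial 0 N
≗ᶜ-eulerPartial (suc M) N = ≗ᶜ-≡ expand
  (≗ᶜ-⊛ (≗ᶜ-eulerPartial M) (λ N → ≗ᶜ-+ (≗ᶜ-monomial 0 N) (≗ᶜ-neg (≗ᶜ-monomial (suc M) N))) N)
  where
  k : ℕ
  k = suc M
  conv-negʳ : ∀ a b n → conv a (λ N → ℚ.- b N) n ≡ ℚ.- conv a b n
  conv-negʳ a b zero = sym (ℚP.neg-distribʳ-* (a 0) (b 0))
  conv-negʳ a b (suc n) = trans (cong (a 0 ℚ.* (ℚ.- b (suc n)) ℚ.+_) (conv-negʳ (a ∘ suc) b n))
    (solve 3 (λ a b x → a :* (:- b) :+ (:- x) := :- (a :* b :+ x)) refl (a 0) (b (suc n)) (conv (a ∘ suc) b n))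
  expand : conv (euler M) (λ N → δ N ℚ.+ (ℚ.- delays k δ N)) N ≡ euler M N ℚ.- delays k (euler M) N
  expand = trans (conv-addʳ (euler M) δ (λ N → ℚ.- delays k δ N) N) (cong₂ ℚ._+_ (conv-δʳ (euler M) N)
    (trans (conv-negʳ (euler M) (delays k δ) N) (cong (λ t → ℚ.- t) (trans (sym (conv-delays k (euler M) δ N)) (conv-δʳ (delays k (euler M)) N)))))

sign : ℕ → ℚ
sign zero = 1ℚ
sign (suc k) = ℚ.- sign k

≗ᶜ-sgn : ∀ k → sgn k ≗ᶜ sign k
≗ᶜ-sgn zero = ≗ᶜ-1
≗ᶜ-sgn (suc k) = ≗ᶜ-neg (≗ᶜ-sgn k)

sign² : ∀ k → sign k ℚ.* sign k ≡ 1ℚ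
sign² zero = refl
sign² (suc k) = trans (solve 1 (λ s → (:- s) :* (:- s) := s :* s) refl (sign k)) (sign² k)

-- The sign of a mode depends on the number of entries above n, which is the same with or without n
-- itself. Hence the signs of the two modes in A(t) agree and cancel.
length-above : ∀ n {xs ys} → xs ↭ n ∷ ys → length (above n xs) ≡ length (above n ys)
length-above n {xs} {ys} p = trans (↭P.↭-length (↭P.filter-↭ (n ℕP.<?_) p))
  (cong length (LP.filter-reject (n ℕP.<?_) {xs = ys} (ℕP.<-irrefl refl)))

insert-remove : ∀ n d → n ∈ list d → insert n (remove n d) ≡ d
insert-remove n d n∈ = list-injective (descending-ext (sorted (insert n (remove n d))) (sorted d) f g)
  where
  f : ∀ {z} → z ∈ list (insert n (remove n d)) → z ∈ list d
  f {z} m with z ℕP.≟ n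
  ... | yes refl = n∈
  ... | no z≢n = proj₁ (∈-remove⁻ n d (∈-insert⁻ n (remove n d) m z≢n))
  g : ∀ {z} → z ∈ list d → z ∈ list (insert n (remove n d))
  g {z} m with z ℕP.≟ n
  ... | yes refl = ∈-insert n (remove n d)
  ... | no z≢n = ∈-insert⁺ n (remove n d) z≢n (∈-remove⁺ n d z≢n m)

remove-insert : ∀ n d → n ∉ list d → remove n (insert n d) ≡ d
remove-insert n d n∉ = list-injective (descending-ext (sorted (remove n (insert n d))) (sorted d) f g)
  where
  f : ∀ {z} → z ∈ list (remove n (insert n d)) → z ∈ list d
  f m = let m' , z≢n = ∈-remove⁻ n (insert n d) m in ∈-insert⁻ n d m' z≢n
  g : ∀ {z} → z ∈ list d → z ∈ list (remove n (insert n d))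
  g {z} m = ∈-remove⁺ n (insert n d) (λ { refl → n∉ m }) (∈-insert⁺ n d (λ { refl → n∉ m }) m)

-- The mode `ψ e` acts first. For e = k + ½ with k ≥ 0 it needs the hole k, at site -k; for e = -n -
-- ½ it creates the particle n, at site n + 1. In both cases it gives 0 exactly when the site is
-- occupied.
site : HalfInt → ℤ
site (k +½) = ℤ.- k

Unit : Monomial → Fock → Set
Unit μ v = Σ[ c ∈ ℂ ] (c ≗ᶜ 1ℚ × v ≡ (c , μ) ∷ [])

private
  hole : ∀ k a b {t} → occupied (a ∙ b) (ℤ.- + k) ≡ t → mem k b ≡ not t
  hole zero a b h = trans (sym (BoolP.not-involutive _)) (cong not h)
  hole (suc k) a b h = trans (sym (BoolP.not-involutive _)) (cong not h)

  neg-hole : ∀ n → neg (-[1+ n ] +½) ≡ (+ n) +½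
  neg-hole zero = refl
  neg-hole (suc n) = refl

  unit² : ∀ {c} k l → k ≡ l → c ≗ᶜ 1ℚ → (c *ᶜ sgn k) *ᶜ sgn l ≗ᶜ 1ℚ
  unit² k .k refl h = ≗ᶜ-≡ (trans (solve 1 (λ s → con 1ℚ :* s :* s := s :* s) refl (sign k)) (sign² k))
    (≗ᶜ-* (≗ᶜ-* h (≗ᶜ-sgn k)) (≗ᶜ-sgn k))

  relabel : ∀ {c : ℂ} {μ ν : Monomial} → μ ≡ ν → _≡_ {A = Fock} ((c , μ) ∷ []) ((c , ν) ∷ [])
  relabel refl = refl

-- A[ e ] is the projection on the monomials for which site e is empty.
A-occupied : ∀ e μ c → occupied μ (site e) ≡ true → A[ e ] ((c , μ) ∷ []) ≡ []
A-empty : ∀ e μ c → c ≗ᶜ 1ℚ → occupied μ (site e) ≡ false → Unit μ (A[ e ] ((c , μ) ∷ []))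
A-occupied ((+ k) +½) (a ∙ b) c h rewrite hole k a b h = refl
A-occupied (-[1+ n ] +½) (a ∙ b) c h rewrite h = refl
A-empty ((+ k) +½) (a ∙ b) c hc h rewrite hole k a b h | mem-remove-≡ k b =
  _ , unit² _ _ (cong (length (list a) ℕ.+_) (length-above k (remove-↭ k b k∈))) hc , relabel (cong (a ∙_) (insert-remove k b k∈))
  where
  k∈ : k ∈ list b
  k∈ = true-mem {k} {b} (hole k a b h)
A-empty (-[1+ n ] +½) (a ∙ b) c hc h rewrite h | neg-hole n | mem-insert-≡ n a =
  _ , unit² _ _ (sym (length-above n (insert-↭ n a n∉))) hc , relabel (cong (_∙ b) (remove-insert n a n∉))
  where
  n∉ : n ∉ list a
  n∉ = false-mem {n} {a} h

correlator : ∀ {n} → Vector HalfInt n → Fock → Fock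
correlator e v = Vector.foldr A[_] v e

sites : ∀ {n} → Vector HalfInt n → List ℤ
sites e = tabulate (λ i → site (e i))

correlator-dichotomy : ∀ n (e : Vector HalfInt n) μ →
  (EmptyOn (sites e) μ × Unit μ (correlator e ((1ᶜ , μ) ∷ []))) ⊎ (¬ EmptyOn (sites e) μ × correlator e ((1ᶜ , μ) ∷ []) ≡ [])
correlator-dichotomy zero e μ = inj₁ ([] , 1ᶜ , ≗ᶜ-1 , refl)
correlator-dichotomy (suc n) e μ with correlator-dichotomy n (Vector.tail e) μ
-- Once one projection has produced the empty combination, all later ones keep it.
... | inj₂ (¬p , eq) = inj₂ ((λ p → ¬p (All.tail p)) , cong A[ Vector.head e ] eq)
... | inj₁ (p , c , hc , eq) = cases (occupied μ (site (e Fin.zero))) refl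
  where
  cases : ∀ b → occupied μ (site (e Fin.zero)) ≡ b →
    (EmptyOn (sites e) μ × Unit μ (correlator e ((1ᶜ , μ) ∷ []))) ⊎ (¬ EmptyOn (sites e) μ × correlator e ((1ᶜ , μ) ∷ []) ≡ [])
  cases false h = inj₁ (h ∷ p , subst (λ v → Unit μ (A[ e Fin.zero ] v)) (sym eq) (A-empty (e Fin.zero) μ c hc h))
  cases true h = inj₂ ((λ { (h' ∷ _) → BoolP.not-¬ h' h }) , trans (cong A[ e Fin.zero ] eq) (A-occupied (e Fin.zero) μ c h))

bracket-unit : ∀ μ v → Unit μ v → ⟨ μ ∣ v ⟩ ≗ᶜ 1ℚ
bracket-unit μ _ (c , hc , refl)
  rewrite dec-true (LP.≡-dec ℕP._≟_ (list (ns μ)) (list (ns μ))) refl | dec-true (LP.≡-dec ℕP._≟_ (list (ms μ)) (list (ms μ))) refl =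
  ≗ᶜ-≡ (ℚP.+-identityʳ 1ℚ) (≗ᶜ-+ hc ≗ᶜ-0)

≗ᶜ-trace : ∀ {n} (e : Vector HalfInt n) N → tr₀ (correlator e) N ≗ᶜ T (sites e) N
≗ᶜ-trace {n} e N = go (basis₀ N)
  where
  go : ∀ μs → foldr (λ μ z → ⟨ μ ∣ correlator e ((1ᶜ , μ) ∷ []) ⟩ +ᶜ z) 0ᶜ μs ≗ᶜ num (length (filter (emptyOn? (sites e)) μs))
  go [] = ≗ᶜ-0
  go (μ ∷ μs) with emptyOn? (sites e) μ | correlator-dichotomy n e μ
  ... | yes _ | inj₁ (_ , u) = ≗ᶜ-≡ (ℚP.+-comm 1ℚ (num (length (filter (emptyOn? (sites e)) μs)))) (≗ᶜ-+ (bracket-unit μ _ u) (go μs))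
  ... | no _ | inj₂ (_ , eq) = ≗ᶜ-≡ (ℚP.+-identityˡ _) (≗ᶜ-+ (subst (λ v → ⟨ μ ∣ v ⟩ ≗ᶜ 0ℚ) (sym eq) ≗ᶜ-0) (go μs))
  ... | yes p | inj₂ (¬p , _) = ⊥-elim (¬p p)
  ... | no ¬p | inj₁ (p , _) = ⊥-elim (¬p p)

≗ᶜ-F : ∀ {n} (e : Vector HalfInt n) N → F e N ≗ᶜ conv E (T (sites e)) N
≗ᶜ-F e = ≗ᶜ-⊛ {eulerProduct} {tr₀ (correlator e)} (λ N → ≗ᶜ-eulerPartial N N) (≗ᶜ-trace e)

-- Asymptotics

open Gas

Quantity : Set
Quantity = Gas → ℝ

pow-+ : ∀ x j k n → seq (x ^ (k ℕ.+ j)) n ≡ seq (x ^ j) n ℚ.* seq (x ^ k) n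
pow-+ x j zero n = sym (ℚP.*-identityʳ _)
pow-+ x j (suc k) n = trans (cong (ℚ._* seq x n) (pow-+ x j k n)) (ℚP.*-assoc (seq (x ^ j) n) (seq (x ^ k) n) (seq x n))

pow-nonneg : ∀ {x} → Nonneg x → ∀ k → Nonneg (x ^ k)
pow-nonneg h zero = nn-const (0≤/ 1 0)
pow-nonneg h (suc k) = pow-nonneg h k nn* h

pow-≤1 : ∀ {x} → Nonneg x → x ≼ 1ℝ → ∀ k → x ^ k ≼ 1ℝ
pow-≤1 h g zero = ≼-refl
pow-≤1 {x} h (le g) (suc k) = let le r = pow-≤1 h (le g) k in le (nn-≗
  (λ n → solve 2 (λ p x → p :* (con 1ℚ :- x) :+ (con 1ℚ :- p) := con 1ℚ :- p :* x) refl (seq (x ^ k) n) (seq x n))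
  (pow-nonneg h k nn* g nn+ r))

-- `C` is fixed before the gas D. This uniformity in the temperature is what turns the bounds into
-- an O(y²) as y tends to 0.
record O (k : ℕ) (f : Quantity) : Set where
  constructor bigO
  field
    C : ℚ
    0≤C : 0ℚ ℚ.≤ C
    bound : ∀ D → Bd (f D) (fromℚ C * z D ^ k)

O-≈ : ∀ {k f g} → (∀ D → f D ≈ g D) → O k f → O k g
O-≈ h (bigO C 0≤C b) = bigO C 0≤C λ D → bd-≈ (h D) (b D)

O-+ : ∀ {k f g} → O k f → O k g → O k (λ D → f D + g D)
O-+ {k} (bigO C c b) (bigO C' c' b') = bigO (C ℚ.+ C') (0≤+ c c') λ D →
  bd-resp ≈-refl (≈-pt λ n → sym (ℚP.*-distribʳ-+ (seq (z D ^ k) n) C C')) (bd-+ (b D) (b' D))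

O-neg : ∀ {k f} → O k f → O k (λ D → - f D)
O-neg (bigO C c b) = bigO C c λ D → bd-neg (b D)

O-* : ∀ j k {f g} → O j f → O k g → O (k ℕ.+ j) (λ D → f D * g D)
O-* j k (bigO C c b) (bigO C' c' b') = bigO (C ℚ.* C') (0≤* c c') λ D →
  bd-resp ≈-refl (≈-pt λ n → trans
    (solve 4 (λ C C' x y → (C :* x) :* (C' :* y) := (C :* C') :* (x :* y)) refl C C' (seq (z D ^ j) n) (seq (z D ^ k) n))
    (cong (C ℚ.* C' ℚ.*_) (sym (pow-+ (z D) j k n)))) (bd-* (b D) (b' D))

O-const : ∀ a → O 0 (λ _ → fromℚ a)
O-const a = bigO ℚ.∣ a ∣ (ℚP.0≤∣p∣ a) λ D →
  bd-resp ≈-refl (≈-pt λ n → sym (ℚP.*-identityʳ _)) (bd-const {a} ℚP.≤-refl)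

O-z : O 1 z
O-z = bigO 1ℚ (0≤/ 1 0) λ D → bd-resp ≈-refl (≈-pt λ n → solve 1 (λ z → z := con 1ℚ :* (con 1ℚ :* z)) refl (seq (z D) n))
  (bd-nn (0≤z D) ≼-refl)

O-p : ∀ X → O 0 (λ D → p D X)
O-p X = bigO 1ℚ (0≤/ 1 0) λ D → bd-resp ≈-refl (≈-pt λ n → refl) (p-bounded D X)

O-weaken : ∀ j {k f} → O (j ℕ.+ k) f → O k f
O-weaken j {k} (bigO C c b) = bigO C c λ D → bd-≼
  (≼-pt (nn-const c nn* pow-nonneg (0≤z D) k nn* _≼_.diff (pow-≤1 (0≤z D) (z≤1 D) j))
    (λ n → trans (cong (λ t → C ℚ.* seq (z D ^ k) n ℚ.- C ℚ.* t) (pow-+ (z D) k j n))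
      (solve 3 (λ C x y → C :* x :- C :* (x :* y) := C :* x :* (con 1ℚ :- y)) refl C (seq (z D ^ k) n) (seq (z D ^ j) n))))
  (b D)

O-zero : ∀ {k f} → (∀ D → f D ≈ 0ℝ) → O k f
O-zero {k} h = bigO 0ℚ ℚP.≤-refl λ D → bd-resp (≈-sym (h D)) (≈-pt λ n → sym (ℚP.*-zeroˡ (seq (z D ^ k) n)))
  (bd-const {0ℚ} {0ℚ} ℚP.≤-refl)

record Jet₁ (f : Quantity) (a : ℚ) : Set where
  constructor jet₁
  field rest₁ : O 1 (λ D → f D - fromℚ a)

record Jet (f : Quantity) (a b : ℚ) : Set where
  constructor jet
  field rest : O 2 (λ D → f D - (fromℚ a + fromℚ b * z D))

jet₁-≈ : ∀ {f g a} → (∀ D → f D ≈ g D) → Jet₁ f a → Jet₁ g a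
jet₁-≈ h (jet₁ r) = jet₁ (O-≈ (λ D → sub-cong (h D) ≈-refl) r)

jet-≈ : ∀ {f g a b} → (∀ D → f D ≈ g D) → Jet f a b → Jet g a b
jet-≈ h (jet r) = jet (O-≈ (λ D → sub-cong (h D) ≈-refl) r)

jet₁-O₀ : ∀ {f a} → Jet₁ f a → O 0 f
jet₁-O₀ {f} {a} (jet₁ r) = O-≈ (λ D → ≈-pt λ n → solve 2 (λ f a → (f :- a) :+ a := f) refl (seq (f D) n) a)
  (O-+ (O-weaken 1 r) (O-const a))

jet⇒jet₁ : ∀ {f a b} → Jet f a b → Jet₁ f a
jet⇒jet₁ {f} {a} {b} (jet r) = jet₁ (O-≈
  (λ D → ≈-pt λ n → solve 4 (λ f a b z → (f :- (a :+ b :* z)) :+ b :* z := f :- a) refl (seq (f D) n) a b (seq (z D) n))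
  (O-+ (O-weaken 1 r) (O-* 0 1 (O-const b) O-z)))

jet₁-O₁ : ∀ {f} → Jet₁ f 0ℚ → O 1 f
jet₁-O₁ {f} (jet₁ r) = O-≈ (λ D → ≈-pt λ n → ℚP.+-identityʳ _) r

O₁-jet₁ : ∀ {f} → O 1 f → Jet₁ f 0ℚ
O₁-jet₁ {f} r = jet₁ (O-≈ (λ D → ≈-pt λ n → sym (ℚP.+-identityʳ _)) r)

O₂-jet : ∀ {f} → O 2 f → Jet f 0ℚ 0ℚ
O₂-jet {f} r = jet (O-≈ (λ D → ≈-pt λ n → solve 2 (λ f z → f := f :- (con 0ℚ :+ con 0ℚ :* z)) refl (seq (f D) n) (seq (z D) n)) r)

jet₁-+ : ∀ {f g a b} → Jet₁ f a → Jet₁ g b → Jet₁ (λ D → f D + g D) (a ℚ.+ b)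
jet₁-+ {f} {g} {a} {b} (jet₁ r) (jet₁ s) = jet₁ (O-≈
  (λ D → ≈-pt λ n → solve 4 (λ f g a b → (f :- a) :+ (g :- b) := f :+ g :- (a :+ b)) refl (seq (f D) n) (seq (g D) n) a b) (O-+ r s))

jet₁-* : ∀ {f g a b} → Jet₁ f a → Jet₁ g b → Jet₁ (λ D → f D * g D) (a ℚ.* b)
jet₁-* {f} {g} {a} {b} (jet₁ r) (jet₁ s) = jet₁ (O-≈
  (λ D → ≈-pt λ n → solve 4 (λ f g a b → (f :- a) :* g :+ a :* (g :- b) := f :* g :- a :* b) refl (seq (f D) n) (seq (g D) n) a b)
  (O-+ (O-* 1 0 r (jet₁-O₀ {g} {b} (jet₁ s))) (O-* 0 1 (O-const a) s)))

jet₁-neg : ∀ {f a} → Jet₁ f a → Jet₁ (λ D → - f D) (ℚ.- a)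
jet₁-neg {f} {a} (jet₁ r) = jet₁ (O-≈
  (λ D → ≈-pt λ n → solve 2 (λ f a → :- (f :- a) := (:- f) :- (:- a)) refl (seq (f D) n) a) (O-neg r))

jet₁-const : ∀ a → Jet₁ (λ _ → fromℚ a) a
jet₁-const a = jet₁ (O-zero λ D → ≈-pt λ n → ℚP.+-inverseʳ a)

jet-+ : ∀ {f g a b c d} → Jet f a b → Jet g c d → Jet (λ D → f D + g D) (a ℚ.+ c) (b ℚ.+ d)
jet-+ {f} {g} {a} {b} {c} {d} (jet r) (jet s) = jet (O-≈
  (λ D → ≈-pt λ n → solve 7 (λ f g a b c d z → (f :- (a :+ b :* z)) :+ (g :- (c :+ d :* z)) := f :+ g :- (a :+ c :+ (b :+ d) :* z))
    refl (seq (f D) n) (seq (g D) n) a b c d (seq (z D) n)) (O-+ r s))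

jet-neg : ∀ {f a b} → Jet f a b → Jet (λ D → - f D) (ℚ.- a) (ℚ.- b)
jet-neg {f} {a} {b} (jet r) = jet (O-≈
  (λ D → ≈-pt λ n → solve 4 (λ f a b z → :- (f :- (a :+ b :* z)) := (:- f) :- (:- a :+ (:- b) :* z)) refl (seq (f D) n) a b (seq (z D) n)) (O-neg r))

jet-const : ∀ a → Jet (λ _ → fromℚ a) a 0ℚ
jet-const a = jet (O-zero λ D → ≈-pt λ n → solve 2 (λ a z → a :- (a :+ con 0ℚ :* z) := con 0ℚ) refl a (seq (z D) n))

jet-* : ∀ {f g a b c d} → Jet f a b → Jet g c d → Jet (λ D → f D * g D) (a ℚ.* c) (a ℚ.* d ℚ.+ b ℚ.* c)
jet-* {f} {g} {a} {b} {c} {d} jf@(jet r) jg@(jet s) = jet (O-≈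
  (λ D → ≈-pt λ n → solve 7 (λ f g a b c d z →
      (f :- (a :+ b :* z)) :* g :+ (a :* (g :- (c :+ d :* z)) :+ (b :* z) :* (g :- c))
      := f :* g :- (a :* c :+ (a :* d :+ b :* c) :* z))
    refl (seq (f D) n) (seq (g D) n) a b c d (seq (z D) n))
  (O-+ (O-* 2 0 r (jet₁-O₀ (jet⇒jet₁ jg))) (O-+ (O-* 0 2 (O-const a) s)
    (O-* 1 1 (O-* 0 1 (O-const b) O-z) (Jet₁.rest₁ (jet⇒jet₁ jg))))))

-- A factor without constant term gains one order, so the other factor need only be known to leading
-- order. This breaks the circle between sets of n and of n + 1 points.
jet-small-* : ∀ {f g a b} → Jet f 0ℚ b → Jet₁ g a → Jet (λ D → f D * g D) 0ℚ (b ℚ.* a)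
jet-small-* {f} {g} {a} {b} jf (jet₁ s) = jet (O-≈
  (λ D → ≈-pt λ n → solve 5 (λ f g a b z →
      f :* (g :- a) :+ a :* (f :- (con 0ℚ :+ b :* z)) := f :* g :- (con 0ℚ :+ (b :* a) :* z))
    refl (seq (f D) n) (seq (g D) n) a b (seq (z D) n))
  (O-+ (O-* 1 1 (jet₁-O₁ (jet⇒jet₁ jf)) s) (O-* 0 2 (O-const a) (Jet.rest jf))))

jet-cast : ∀ {f a b c d} → a ≡ c → b ≡ d → Jet f a b → Jet f c d
jet-cast refl refl j = j

jet-q : Jet q 1ℚ (ℚ.- 1ℚ)
jet-q = jet (bigO 1ℚ (0≤/ 1 0) λ D → bd-resp
  (≈-pt λ n → solve 2 (λ q z → q :- (con 1ℚ :- z) := q :- (con 1ℚ :+ con (ℚ.- 1ℚ) :* z)) refl (seq (q D) n) (seq (z D) n))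
  (≈-pt λ n → solve 1 (λ z → z :* z := con 1ℚ :* (con 1ℚ :* z :* z)) refl (seq (z D) n))
  (q-expansion D))

jet-q^ : ∀ k → Jet (λ D → q D ^ k) 1ℚ (ℚ.- num k)
jet-q^ zero = jet-const 1ℚ
jet-q^ (suc k) = jet-cast refl
  (solve 1 (λ n → con 1ℚ :* con (ℚ.- 1ℚ) :+ (:- n) :* con 1ℚ := :- (n :+ con 1ℚ)) refl (num k)) (jet-* (jet-q^ k) jet-q)

ι : ℤ → ℚ
ι x = num (pos x) ℚ.- num (neg⁻ x)

ι-suc : ∀ w → ι (ℤ.suc w) ℚ.- ι w ≡ 1ℚ
ι-suc (+ n) = solve 1 (λ n → (n :+ con 1ℚ :- con 0ℚ) :- (n :- con 0ℚ) := con 1ℚ) refl (num n)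
ι-suc -[1+ zero ] = refl
ι-suc -[1+ suc n ] = solve 1 (λ n → (con 0ℚ :- n) :- (con 0ℚ :- (n :+ con 1ℚ)) := con 1ℚ) refl (num (suc n))

-- Moving the points of a set

-- Eliminating p (x ∷ w ∷ A) from the recurrences at x and at w leaves a difference of powers of q.

module Move (w x : ℤ) (A : List ℤ) (x≢w : x ≢ w) (w∉ : w ∉ A) (x∉ : x ∉ A) where

  Δ γ P ζ : Quantity
  Δ D = p D (x ∷ A) - p D (w ∷ A)
  γ D = q D ^ neg⁻ x * q D ^ pos w - q D ^ neg⁻ w * q D ^ pos x
  P D = p D (shift (x ∷ w ∷ A))
  ζ D = 1ℝ - q D ^ neg⁻ x * q D ^ neg⁻ w

  -- The elimination yields Δ times `q ^ neg⁻ x * q ^ neg⁻ w`. No division by this factor is made: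
  -- its distance ζ from 1 is O(z), and ζ Δ is carried as a correction.
  relation : ∀ D → Δ D ≈ γ D * P D + ζ D * Δ D
  relation D = ≈-trans (≈-pt λ n →
      solve 4 (λ a b v u → a :- b := v :* (u :* a) :- u :* (v :* b) :+ (con 1ℚ :- v :* u) :* (a :- b)) refl
        (seq (p D (x ∷ A)) n) (seq (p D (w ∷ A)) n) (seq βx n) (seq βw n))
    (≈-trans (+-cong (sub-cong (*-cong (≈-refl {βx}) at-w) (*-cong (≈-refl {βw}) (recurrence D x (w ∷ A) x∉w∷A))) (≈-refl {ζ D * Δ D}))
      (≈-pt λ n → solve 7 (λ v u αx αw R P Δ →
          v :* (u :* R :+ αw :* P) :- u :* (v :* R :+ αx :* P) :+ (con 1ℚ :- v :* u) :* Δ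
          := (v :* αw :- u :* αx) :* P :+ (con 1ℚ :- v :* u) :* Δ) refl
        (seq βx n) (seq βw n) (seq (q D ^ pos x) n) (seq (q D ^ pos w) n)
        (seq (p D (x ∷ w ∷ A)) n) (seq (P D) n) (seq (Δ D) n)))
    where
    βx βw : ℝ
    βx = q D ^ neg⁻ x
    βw = q D ^ neg⁻ w
    x∉w∷A : x ∉ w ∷ A
    x∉w∷A (here e) = x≢w e
    x∉w∷A (there m) = x∉ m
    w∉x∷A : w ∉ x ∷ A
    w∉x∷A (here e) = x≢w (sym e)
    w∉x∷A (there m) = w∉ m
    at-w : βw * p D (x ∷ A) ≈ βw * p D (x ∷ w ∷ A) + q D ^ pos w * P D
    at-w = ≈-trans (recurrence D w (x ∷ A) w∉x∷A) (+-cong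
      (*-cong (≈-refl {βw}) (p-↭ D (↭-swap w x ↭-refl)))
      (*-cong (≈-refl {q D ^ pos w}) (p-↭ D (↭P.map⁺ ℤ.suc (↭-swap w x ↭-refl)))))

  γ-jet : Jet γ 0ℚ (ι x ℚ.- ι w)
  γ-jet = jet-cast refl
    (solve 4 (λ a b c d → (con 1ℚ :* (:- a) :+ (:- b) :* con 1ℚ) :- (con 1ℚ :* (:- c) :+ (:- d) :* con 1ℚ) := (c :- b) :- (a :- d))
      refl (num (pos w)) (num (neg⁻ x)) (num (pos x)) (num (neg⁻ w)))
    (jet-+ (jet-* (jet-q^ (neg⁻ x)) (jet-q^ (pos w))) (jet-neg (jet-* (jet-q^ (neg⁻ w)) (jet-q^ (pos x)))))

  ζ-O : O 1 ζ
  ζ-O = jet₁-O₁ (jet₁-+ (jet₁-const 1ℚ) (jet₁-neg (jet₁-* (jet⇒jet₁ (jet-q^ (neg⁻ x))) (jet⇒jet₁ (jet-q^ (neg⁻ w))))))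

  Δ-O : O 1 Δ
  Δ-O = O-≈ (λ D → ≈-sym (relation D))
    (O-+ (O-* 1 0 (jet₁-O₁ (jet⇒jet₁ γ-jet)) (O-p (shift (x ∷ w ∷ A))))
         (O-* 1 0 ζ-O (O-+ (O-p (x ∷ A)) (O-neg (O-p (w ∷ A))))))

  -- A bootstrap: `Δ-O` makes the correction ζ Δ second order, so γ P alone determines the linear
  -- term.
  Δ-jet : ∀ {a} → Jet₁ P a → Jet Δ 0ℚ ((ι x ℚ.- ι w) ℚ.* a)
  Δ-jet {a} hP = jet-≈ (λ D → ≈-sym (relation D)) (jet-cast refl (ℚP.+-identityʳ ((ι x ℚ.- ι w) ℚ.* a))
    (jet-+ (jet-small-* γ-jet hP) (O₂-jet (O-* 1 1 ζ-O Δ-O))))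

private
  suc-< : ∀ {i} → i ℤ.< ℤ.suc i
  suc-< = ℤP.suc[i]≤j⇒i<j ℤP.≤-refl

  suc-mono : ∀ {i j} → i ℤ.< j → ℤ.suc i ℤ.< ℤ.suc j
  suc-mono = ℤP.+-monoʳ-< (+ 1)

  suc-injective : ∀ {i j} → ℤ.suc i ≡ ℤ.suc j → i ≡ j
  suc-injective {i} {j} e = trans (sym (ℤP.pred-suc i)) (trans (cong ℤ.pred e) (ℤP.pred-suc j))

shift-unique : ∀ {X} → Unique X → Unique (shift X)
shift-unique u = UniqueP.map⁺ suc-injective u

unique-∉ : ∀ {x : ℤ} {A} → Unique (x ∷ A) → x ∉ A
unique-∉ (px ∷ _) m = All.lookup px m refl

length-↭ : ∀ {X Y : List ℤ} → X ↭ Y → length X ≡ length Y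
length-↭ = ↭P.↭-length

-- S c f stands for "f = c z + higher order" at the order of precision in use.
module Shift (S : ℚ → Quantity → Set) (n : ℕ) (c : ℚ)
  (S-+ : ∀ {a b f g} → S a f → S b g → S (a ℚ.+ b) (λ D → f D + g D))
  (S-≈ : ∀ {a f g} → (∀ D → f D ≈ g D) → S a f → S a g)
  (S-0 : S 0ℚ (λ _ → 0ℝ))
  (S-move : ∀ w A → length A ≡ n → Unique (w ∷ A) → Unique (ℤ.suc w ∷ A) → S c (λ D → p D (ℤ.suc w ∷ A) - p D (w ∷ A)))
  where

  steps : List ℤ → ℚ
  steps [] = 0ℚ
  steps (a ∷ A) = steps A ℚ.+ c

  -- The topmost point moves first, so that no point moves to a site already in the set.
  sorted-shift : ∀ A M → length (A ++ M) ≡ suc n → AllPairs ℤ._<_ A → Unique M → All (λ m → All (m ℤ.<_) A) M →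
    S (steps A) (λ D → p D (shift A ++ M) - p D (A ++ M))
  sorted-shift [] M l _ uM M<A = S-≈ (λ D → ≈-pt λ k → sym (ℚP.+-inverseʳ (seq (p D M) k))) S-0
  sorted-shift (a ∷ A) M l (a<A ∷ sA) uM M<A = S-≈
    (λ D → ≈-trans (≈-pt λ k → solve 4 (λ s t u v → (t :- v) :+ (s :- u) := s :- v :+ (t :- u)) refl
        (seq (p D (ℤ.suc a ∷ shift A ++ M)) k) (seq (p D (shift A ++ a ∷ M)) k)
        (seq (p D (a ∷ shift A ++ M)) k) (seq (p D (A ++ a ∷ M)) k))
      (≈-trans (+-cong (sub-cong (≈-refl {p D (ℤ.suc a ∷ shift A ++ M)}) (p-↭ D (↭P.shift a A M)))
                         (sub-cong (p-↭ D (↭P.shift a (shift A) M)) (≈-refl {p D (a ∷ shift A ++ M)})))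
        (≈-pt λ k → solve 3 (λ s u v → s :- v :+ (u :- u) := s :- v) refl
          (seq (p D (ℤ.suc a ∷ shift A ++ M)) k) (seq (p D (a ∷ shift A ++ M)) k) (seq (p D (a ∷ A ++ M)) k))))
    -- The points above a move while a rests among the fixed points; then a moves by itself.
    (S-+ (sorted-shift A (a ∷ M) (trans (length-↭ (↭P.shift a A M)) l) sA (a∉M ∷ uM) (a<A ∷ All.map All.tail M<A))
         (S-move a (shift A ++ M) length-rest (rest-unique a (All.map (ℤP.<-trans suc-<) a+<) a∉M)
           (rest-unique (ℤ.suc a) a+< (All.map (λ m<a e → ℤP.<-irrefl (sym e) (ℤP.<-trans (All.head m<a) suc-<)) M<A))))
    where
    a∉M : All (a ≢_) M
    a∉M = All.map (λ m<a e → ℤP.<-irrefl (sym e) (All.head m<a)) M<A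
    a+< : All (ℤ.suc a ℤ.<_) (shift A)
    a+< = AllP.map⁺ (All.map suc-mono a<A)
    length-rest : length (shift A ++ M) ≡ n
    length-rest = ℕP.suc-injective (trans (cong suc (trans (LP.length-++ (shift A))
      (trans (cong (ℕ._+ length M) (LP.length-map ℤ.suc A)) (sym (LP.length-++ A))))) l)
    tail-unique : Unique (shift A ++ M)
    tail-unique = UniqueP.++⁺ (shift-unique (AllPairs.map (λ i<j e → ℤP.<-irrefl e i<j) sA)) uM
      λ (i∈A , i∈M) → ℤP.<-irrefl refl (ℤP.<-trans suc-<
        (ℤP.<-trans (All.lookup a+< i∈A) (All.head (All.lookup M<A i∈M))))
    rest-unique : ∀ b → All (b ℤ.<_) (shift A) → All (b ≢_) M → Unique (b ∷ shift A ++ M)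
    rest-unique b b< b∉ = AllP.++⁺ (All.map (λ i<j e → ℤP.<-irrefl e i<j) b<) b∉ ∷ tail-unique

  unique-shift : ∀ X → length X ≡ suc n → Unique X → S (steps (sort X)) (λ D → p D (shift X) - p D X)
  unique-shift X l uX = S-≈
    (λ D → sub-cong (p-↭ D (↭-trans (↭-reflexive (LP.++-identityʳ (shift A))) (↭P.map⁺ ℤ.suc (sort-↭ X))))
                    (p-↭ D (↭-trans (↭-reflexive (LP.++-identityʳ A)) (sort-↭ X))))
    (sorted-shift A [] (trans (cong length (LP.++-identityʳ A)) (trans (length-↭ (sort-↭ X)) l))
      (AllPairs.zipWith (λ (i≤j , i≢j) → ℤP.≤∧≢⇒< i≤j i≢j)
        (SortedP.Sorted⇒AllPairs ℤP.≤-totalOrder (sort-↗ X) , ↭S.Unique-resp-↭ (setoid ℤ) (↭⇒↭ₛ (↭-sym (sort-↭ X))) uX))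
      [] [])
    where
    A = sort X

  steps-length : ∀ X → steps (sort X) ≡ num (length X) ℚ.* c
  steps-length X = trans (go (sort X)) (cong (λ k → num k ℚ.* c) (length-↭ (sort-↭ X)))
    where
    go : ∀ A → steps A ≡ num (length A) ℚ.* c
    go [] = sym (ℚP.*-zeroˡ c)
    go (a ∷ A) = trans (cong (ℚ._+ c) (go A)) (solve 2 (λ n c → n :* c :+ c := (n :+ con 1ℚ) :* c) refl (num (length A)) c)

-- Solving the recurrence order by order

half^ : ℕ → ℚ
half^ zero = 1ℚ
half^ (suc n) = half^ n ℚ.* ½

-- The recurrence as 2 p(X) = R. The terms in p(X) are gathered on the right with coefficient 2 -
-- q^`pos x` - q^`neg⁻ x`, which is O(z), and `p (shift X)` enters only through its O(z) difference
-- from p(X).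
module Solve (x : ℤ) (A : List ℤ) (x∉ : x ∉ A) where

  X : List ℤ
  X = x ∷ A

  R : Quantity
  R D = q D ^ neg⁻ x * p D A + (1ℝ + 1ℝ - (q D ^ pos x + q D ^ neg⁻ x)) * p D X
        - q D ^ pos x * (p D (shift X) - p D X)

  relation : ∀ D → fromℚ ½ * R D ≈ p D X
  relation D = ≈-trans
    (*-cong (≈-refl {fromℚ ½}) (+-cong (+-cong (recurrence D x A x∉)
      (≈-refl {(1ℝ + 1ℝ - (q D ^ pos x + q D ^ neg⁻ x)) * p D X})) (≈-refl { - (q D ^ pos x * (p D (shift X) - p D X))})))
    (≈-pt λ n → trans (cong (½ ℚ.*_)
      (solve 4 (λ α β P P' → (β :* P :+ α :* P') :+ (con 1ℚ :+ con 1ℚ :- (α :+ β)) :* P :- α :* (P' :- P) := P :+ P) refl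
        (seq (q D ^ pos x) n) (seq (q D ^ neg⁻ x) n) (seq (p D X) n) (seq (p D (shift X)) n)))
      (solve 1 (λ P → con ½ :* (P :+ P) := P) refl (seq (p D X) n)))

  2-α-β : Jet (λ D → 1ℝ + 1ℝ - (q D ^ pos x + q D ^ neg⁻ x)) 0ℚ (num (pos x) ℚ.+ num (neg⁻ x))
  2-α-β = jet-cast refl
    (solve 2 (λ a b → con 0ℚ :+ con 0ℚ :- (:- a :+ (:- b)) := a :+ b) refl (num (pos x)) (num (neg⁻ x)))
    (jet-+ (jet-+ (jet-const 1ℚ) (jet-const 1ℚ)) (jet-neg (jet-+ (jet-q^ (pos x)) (jet-q^ (neg⁻ x)))))

-- Induction on the number of points from 2 p(X) = p(A) + O(z). For the larger sets that occur in
-- the moves, the a priori bound |p| ≤ 1 is enough.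
expand₁ : ∀ X → Unique X → Jet₁ (λ D → p D X) (half^ (length X))
expand₁ [] _ = jet₁-≈ (λ D → ≈-sym (p-[] D)) (jet₁-const 1ℚ)
expand₁ X@(x ∷ A) uX@(_ ∷ uA) = jet₁-≈ relation (subst (Jet₁ _) arith
  (jet₁-* (jet₁-const ½)
    (jet₁-+ (jet₁-+ (jet₁-* (jet⇒jet₁ (jet-q^ (neg⁻ x))) (expand₁ A uA))
                    (O₁-jet₁ (O-* 1 0 (jet₁-O₁ (jet⇒jet₁ 2-α-β)) (O-p X))))
            (jet₁-neg (O₁-jet₁ (O-* 0 1 (jet₁-O₀ (jet⇒jet₁ (jet-q^ (pos x)))) shift-O))))))
  where
  open Solve x A (unique-∉ uX) hiding (X)
  -- At this order `S c f` is plain O(z), and each move contributes the constant 0.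
  open Shift (λ _ f → O 1 f) (length A) 0ℚ O-+ O-≈ (O-zero λ _ → ≈-refl)
    (λ w B _ u u' → Move.Δ-O w (ℤ.suc w) B (λ e → ℤP.<-irrefl (sym e) suc-<) (unique-∉ u) (unique-∉ u'))
  shift-O : O 1 (λ D → p D (shift X) - p D X)
  shift-O = unique-shift X refl uX
  arith : ½ ℚ.* (1ℚ ℚ.* half^ (length A) ℚ.+ 0ℚ ℚ.- 0ℚ) ≡ half^ (length A) ℚ.* ½
  arith = solve 2 (λ k h → k :* (con 1ℚ :* h :+ con 0ℚ :- con 0ℚ) := h :* k) refl ½ (half^ (length A))

-- The expansion of p X is 2⁻ⁿ (1 - κ X z/2) for n = length X.
κ : List ℤ → ℚ
κ [] = 0ℚ
κ (x ∷ A) = κ A ℚ.- ι x ℚ.+ num (suc (length A)) ℚ.* ½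

-- With h = 2^(1-n), the linear coefficients of the three terms of R are -h κ(A)/2 - h `neg⁻ x`,
-- then h(`pos x` + `neg⁻ x`)/2, and finally -n h/4 from the n unit moves. Half their sum gives the
-- recursion of κ.
expand : ∀ X → Unique X → Jet (λ D → p D X) (half^ (length X)) (ℚ.- (half^ (length X) ℚ.* ½ ℚ.* κ X))
expand [] _ = jet-≈ (λ D → ≈-sym (p-[] D)) (jet-const 1ℚ)
expand X@(x ∷ A) uX@(_ ∷ uA) = jet-≈ relation (jet-cast arith₀ (arith₁ h (κ A) (num (pos x)) (num (neg⁻ x)) (num (length X)))
  (jet-* (jet-const ½)
    (jet-+ (jet-+ (jet-* (jet-q^ (neg⁻ x)) (expand A uA)) (jet-small-* 2-α-β (expand₁ X uX)))
           (jet-neg (jet-≈ (λ D → *-comm (p D (shift X) - p D X) (q D ^ pos x)) (jet-small-* shift-jet (jet⇒jet₁ (jet-q^ (pos x)))))))))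
  where
  open Solve x A (unique-∉ uX) hiding (X)
  h : ℚ
  h = half^ (length A)
  -- The set in a move has n + 1 points. Its leading term 2^(-n-1) comes from `expand₁`, already
  -- available for all sets, so the induction is not called on a larger set.
  S-move : ∀ w B → length B ≡ length A → Unique (w ∷ B) → Unique (ℤ.suc w ∷ B) →
    Jet (λ D → p D (ℤ.suc w ∷ B) - p D (w ∷ B)) 0ℚ (h ℚ.* ½ ℚ.* ½)
  S-move w B l u@(_ ∷ _) u'@(s∉ ∷ _) = jet-cast refl
    (trans (cong₂ ℚ._*_ (ι-suc w) (cong (λ k → half^ (suc (suc k))) (trans (LP.length-map ℤ.suc B) l))) (ℚP.*-identityˡ _))
    (Move.Δ-jet w (ℤ.suc w) B s≢w (unique-∉ u) (unique-∉ u')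
      (expand₁ (shift (ℤ.suc w ∷ w ∷ B)) (shift-unique ((s≢w ∷ s∉) ∷ u))))
    where
    s≢w : ℤ.suc w ≢ w
    s≢w e = ℤP.<-irrefl (sym e) suc-<
  open Shift (λ b f → Jet f 0ℚ b) (length A) (h ℚ.* ½ ℚ.* ½) jet-+ jet-≈ (jet-const 0ℚ) S-move
  shift-jet : Jet (λ D → p D (shift X) - p D X) 0ℚ (num (length X) ℚ.* (h ℚ.* ½ ℚ.* ½))
  shift-jet = jet-cast refl (steps-length X) (unique-shift X refl uX)
  arith₀ : ½ ℚ.* (1ℚ ℚ.* h ℚ.+ 0ℚ ℚ.- 0ℚ) ≡ h ℚ.* ½
  arith₀ = solve 2 (λ k h → k :* (con 1ℚ :* h :+ con 0ℚ :- con 0ℚ) := h :* k) refl ½ h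
  arith₁ : ∀ h c π ν n →
    ½ ℚ.* ((1ℚ ℚ.* (ℚ.- (h ℚ.* ½ ℚ.* c)) ℚ.+ (ℚ.- ν) ℚ.* h) ℚ.+ (π ℚ.+ ν) ℚ.* (h ℚ.* ½) ℚ.- n ℚ.* (h ℚ.* ½ ℚ.* ½) ℚ.* 1ℚ)
      ℚ.+ 0ℚ ℚ.* (1ℚ ℚ.* h ℚ.+ 0ℚ ℚ.- 0ℚ)
    ≡ ℚ.- (h ℚ.* ½ ℚ.* ½ ℚ.* (c ℚ.- (π ℚ.- ν) ℚ.+ n ℚ.* ½))
  arith₁ h c π ν n = trans
    -- One h is rewritten as h(½ + ½), after which the identity is polynomial in k = ½.
    (cong (λ u → ½ ℚ.* ((1ℚ ℚ.* (ℚ.- (h ℚ.* ½ ℚ.* c)) ℚ.+ (ℚ.- ν) ℚ.* u) ℚ.+ (π ℚ.+ ν) ℚ.* (h ℚ.* ½) ℚ.- n ℚ.* (h ℚ.* ½ ℚ.* ½) ℚ.* 1ℚ)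
      ℚ.+ 0ℚ ℚ.* (1ℚ ℚ.* h ℚ.+ 0ℚ ℚ.- 0ℚ))
      (sym (ℚP.*-identityʳ h)))
    (solve 6 (λ h c π ν n k →
      k :* ((con 1ℚ :* (:- (h :* k :* c)) :+ (:- ν) :* (h :* (k :+ k))) :+ (π :+ ν) :* (h :* k) :- n :* (h :* k :* k) :* con 1ℚ)
        :+ con 0ℚ :* (con 1ℚ :* h :+ con 0ℚ :- con 0ℚ)
      := :- (h :* k :* k :* (c :- (π :- ν) :+ n :* k))) refl h c π ν n ½)

-- From real sums to complex values

infix 4 _≗ᴿ_

record _≗ᴿ_ (z : ℂ) (x : ℝ) : Set where
  constructor pointwise
  field
    real : ∀ n → seq (re z) n ≡ seq x n
    imag : ∀ n → seq (im z) n ≡ 0ℚ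

≗ᴿ-ofℝ : ∀ x → ofℝ x ≗ᴿ x
≗ᴿ-ofℝ x = pointwise (λ _ → refl) (λ _ → refl)

≗ᴿ-const : ∀ {z p} → z ≗ᶜ p → z ≗ᴿ fromℚ p
≗ᴿ-const (constant a b) = pointwise a b

≗ᴿ-+ : ∀ {z w x y} → z ≗ᴿ x → w ≗ᴿ y → z +ᶜ w ≗ᴿ x + y
≗ᴿ-+ (pointwise a b) (pointwise c d) =
  pointwise (λ n → cong₂ ℚ._+_ (a n) (c n)) (λ n → trans (cong₂ ℚ._+_ (b n) (d n)) (ℚP.+-identityʳ 0ℚ))

≗ᴿ-sub : ∀ {z w x y} → z ≗ᴿ x → w ≗ᴿ y → z -ᶜ w ≗ᴿ x - y
≗ᴿ-sub (pointwise a b) (pointwise c d) =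
  pointwise (λ n → cong₂ ℚ._-_ (a n) (c n)) (λ n → trans (cong₂ ℚ._-_ (b n) (d n)) (ℚP.+-inverseʳ 0ℚ))

≗ᴿ-* : ∀ {z w x y} → z ≗ᴿ x → w ≗ᴿ y → z *ᶜ w ≗ᴿ x * y
≗ᴿ-* {x = x} {y} (pointwise a b) (pointwise c d) = pointwise
  (λ n → trans (cong₂ ℚ._-_ (cong₂ ℚ._*_ (a n) (c n)) (cong₂ ℚ._*_ (b n) (d n)))
    (solve 2 (λ p r → p :* r :- con 0ℚ :* con 0ℚ := p :* r) refl (seq x n) (seq y n)))
  (λ n → trans (cong₂ ℚ._+_ (cong₂ ℚ._*_ (a n) (d n)) (cong₂ ℚ._*_ (b n) (c n)))
    (solve 2 (λ p r → p :* con 0ℚ :+ con 0ℚ :* r := con 0ℚ) refl (seq x n) (seq y n)))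

≗ᴿ-^ : ∀ {z x} → z ≗ᴿ x → ∀ n → z ^ᶜ n ≗ᴿ x ^ n
≗ᴿ-^ h zero = ≗ᴿ-ofℝ 1ℝ
≗ᴿ-^ h (suc n) = ≗ᴿ-* (≗ᴿ-^ h n) h

-- The imaginary part vanishes, and c² - x² is (c + x)(c - x), a product of the two nonnegative
-- quantities in `Bd`.
bd⇒disk : ∀ {z x c} → z ≗ᴿ x → Bd x c → ∣ z ∣≤ c
bd⇒disk {z} {x} {c} (pointwise a b) h@(bd lo hi) = ≼⇒≤ (nn⇒≼ (bd-0≤ h)) ,
  ≼⇒≤ {re z * re z + im z * im z} {c * c} (≼-pt (lo nn* hi) λ n →
  trans (cong₂ (λ s t → seq c n ℚ.* seq c n ℚ.- (s ℚ.* s ℚ.+ t ℚ.* t)) (a n) (b n))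
    (solve 2 (λ c x → c :* c :- (x :* x :+ con 0ℚ :* con 0ℚ) := (c :+ x) :* (c :- x)) refl (seq c n) (seq x n)))

-- Converts the nested form, which grows at the inside, into the sums of `HasValue`, which grow at
-- the end.
horner-last : ∀ q a K n → seq (horner q a (suc K)) n ≡ seq (horner q a K) n ℚ.+ a K ℚ.* seq (q ^ K) n
horner-last q a zero n = solve 2 (λ a q → a :+ q :* con 0ℚ := con 0ℚ :+ a :* con 1ℚ) refl (a 0) (seq q n)
horner-last q a (suc K) n = trans (cong (λ t → a 0 ℚ.+ seq q n ℚ.* t) (horner-last q (a ∘ suc) K n))
  (solve 5 (λ a q h b p → a :+ q :* (h :+ b :* p) := a :+ q :* h :+ b :* (p :* q)) refl
    (a 0) (seq q n) (seq (horner q (a ∘ suc) K) n) (a (suc K)) (seq (q ^ K) n))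

≗ᴿ-partial-sum : ∀ {f : PowerSeries} {a : Coefficients} q → (∀ N → f N ≗ᶜ a N) → ∀ K → ∑ K (λ k → f k *ᶜ ofℝ q ^ᶜ k) ≗ᴿ horner q a K
≗ᴿ-partial-sum q h zero = pointwise (λ _ → refl) (λ _ → refl)
≗ᴿ-partial-sum {f} {a} q h (suc K) =
  let pointwise r i = ≗ᴿ-+ (≗ᴿ-partial-sum {f} {a} q h K) (≗ᴿ-* (≗ᴿ-const (h K)) (≗ᴿ-^ (≗ᴿ-ofℝ q) K))
  in pointwise (λ n → trans (r n) (sym (horner-last q a K n))) i

sum⇒hasValue : ∀ {f : PowerSeries} {a : Coefficients} {q L} → (∀ N → f N ≗ᶜ a N) → Sum q a L → HasValue f (ofℝ q) (ofℝ L)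
sum⇒hasValue {f} {a} {q} {L} h s ε 0<ε = let K , hK = s ε 0<ε in K , λ k K≤k →
  bd⇒disk (≗ᴿ-sub (≗ᴿ-partial-sum {f} {a} q h k) (≗ᴿ-ofℝ L)) (hK k K≤k)

-- The linear coefficient for the given exponents

private
  module ℤR = ℤS.+-*-Solver

  toℚᵘ-/ : ∀ i d → ℚ.toℚᵘ (i / suc d) ℚᵘ.≃ mkℚᵘ i d
  toℚᵘ-/ i d = ℚP.toℚᵘ-fromℚᵘ (mkℚᵘ i d)

/1-+ : ∀ i j → (i ℤ.+ j) / 1 ≡ i / 1 ℚ.+ j / 1
/1-+ i j = ℚP.toℚᵘ-injective (ℚᵘP.≃-trans (toℚᵘ-/ (i ℤ.+ j) 0) (ℚᵘP.≃-sym
  (ℚᵘP.≃-trans (ℚP.toℚᵘ-homo-+ (i / 1) (j / 1)) (ℚᵘP.≃-trans (ℚᵘP.+-cong (toℚᵘ-/ i 0) (toℚᵘ-/ j 0))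
    (ℚᵘ.*≡* (ℤR.solve 2 (λ i j → (i ℤR.:* ℤR.con (+ 1) ℤR.:+ j ℤR.:* ℤR.con (+ 1)) ℤR.:* ℤR.con (+ 1) ℤR.:= (i ℤR.:+ j) ℤR.:* ℤR.con (+ 1)) refl i j))))))

/1-neg : ∀ i → (ℤ.- i) / 1 ≡ ℚ.- (i / 1)
/1-neg i = ℚP.toℚᵘ-injective (ℚᵘP.≃-trans (toℚᵘ-/ (ℤ.- i) 0) (ℚᵘP.≃-sym
  (ℚᵘP.≃-trans (ℚP.toℚᵘ-homo‿- (i / 1)) (ℚᵘP.-‿cong (toℚᵘ-/ i 0)))))

/-split : ∀ i j d → (i ℤ.* j) / suc d ≡ i / 1 ℚ.* (j / 1) ℚ.* (+ 1 / suc d)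
/-split i j d = ℚP.toℚᵘ-injective (ℚᵘP.≃-trans (toℚᵘ-/ (i ℤ.* j) d) (ℚᵘP.≃-sym
  (ℚᵘP.≃-trans (ℚP.toℚᵘ-homo-* (i / 1 ℚ.* (j / 1)) (+ 1 / suc d))
  (ℚᵘP.≃-trans (ℚᵘP.*-cong (ℚᵘP.≃-trans (ℚP.toℚᵘ-homo-* (i / 1) (j / 1)) (ℚᵘP.*-cong (toℚᵘ-/ i 0) (toℚᵘ-/ j 0))) (toℚᵘ-/ (+ 1) d))
    (ℚᵘ.*≡* (trans (ℤR.solve 2 (λ a d → a ℤR.:* ℤR.con (+ 1) ℤR.:* d ℤR.:= a ℤR.:* d) refl (i ℤ.* j) (+ suc d))
        (cong (i ℤ.* j ℤ.*_) (cong +_ (sym (ℕP.+-identityʳ (suc d)))))))))))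

sum-ι : List ℤ → ℚ
sum-ι [] = 0ℚ
sum-ι (x ∷ A) = ι x ℚ.+ sum-ι A

sum-ι-++ : ∀ A B → sum-ι (A ++ B) ≡ sum-ι A ℚ.+ sum-ι B
sum-ι-++ [] B = sym (ℚP.+-identityˡ _)
sum-ι-++ (x ∷ A) B = trans (cong (ι x ℚ.+_) (sum-ι-++ A B)) (sym (ℚP.+-assoc (ι x) (sum-ι A) (sum-ι B)))

-- The j-th point contributes j/2 besides its site, and these halves add up to n(n + 1)/4.
κ-closed : ∀ X → κ X ≡ num (length X) ℚ.* (num (length X) ℚ.+ 1ℚ) ℚ.* (½ ℚ.* ½) ℚ.- sum-ι X
κ-closed [] = refl
κ-closed (x ∷ A) = trans (cong₂ (λ s t → s ℚ.- ι x ℚ.+ t) (κ-closed A) (sym (ℚP.*-identityʳ (N ℚ.* ½))))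
  (solve 4 (λ n k x s → n :* (n :+ con 1ℚ) :* (k :* k) :- s :- x :+ (n :+ con 1ℚ) :* k :* (k :+ k)
    := (n :+ con 1ℚ) :* ((n :+ con 1ℚ) :+ con 1ℚ) :* (k :* k) :- (x :+ s)) refl (num (length A)) ½ (ι x) (sum-ι A))
  where
  N = num (suc (length A))

tabulate-++ : ∀ {A : Set} m {l} (f : Vector A m) (g : Vector A l) → tabulate (f Vector.++ g) ≡ tabulate f ++ tabulate g
tabulate-++ zero f g = refl
tabulate-++ (suc m) f g = cong (f Fin.zero ∷_) (trans (LP.tabulate-cong lem) (tabulate-++ m (f ∘ Fin.suc) g))
  where
  lem : ∀ i → (f Vector.++ g) (Fin.suc i) ≡ ((f ∘ Fin.suc) Vector.++ g) i
  lem i with Fin.splitAt m i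
  ... | inj₁ _ = refl
  ... | inj₂ _ = refl

private
  lower-site upper-site : ℕ → ℤ
  lower-site a = ℤ.- + a
  upper-site b = + suc b

exponents : ∀ {m l} → Vector ℕ m → Vector ℕ l → Vector HalfInt (m ℕ.+ l)
exponents r s = Vector.map (λ a → (+ a) +½) r Vector.++ Vector.map (λ b → neg ((+ b) +½)) s

sites-exponents : ∀ {m l} (r : Vector ℕ m) (s : Vector ℕ l) →
  sites (exponents r s) ≡ tabulate (lower-site ∘ r) ++ tabulate (upper-site ∘ s)
sites-exponents {m} r s = trans (sym (LP.map-tabulate (exponents r s) site)) (trans
  (cong (map site) (tabulate-++ m (λ i → (+ r i) +½) (λ i → neg ((+ s i) +½))))
  (trans (LP.map-++ site (tabulate (λ i → (+ r i) +½)) (tabulate (λ i → neg ((+ s i) +½))))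
    (cong₂ _++_ (LP.map-tabulate (λ i → (+ r i) +½) site) (LP.map-tabulate (λ i → neg ((+ s i) +½)) site))))

strictlyDecreasing⇒injective : ∀ {m} {r : Vector ℕ m} → StrictlyDecreasing r → ∀ {i j} → r i ≡ r j → i ≡ j
strictlyDecreasing⇒injective d {i} {j} e with FinP.<-cmp i j
... | tri< i<j _ _ = ⊥-elim (ℕP.<-irrefl (sym e) (d i j i<j))
... | tri≈ _ i≡j _ = i≡j
... | tri> _ _ j<i = ⊥-elim (ℕP.<-irrefl e (d j i j<i))

-- Strict decrease separates the sites within each group; the sites -r of the first are at most 0,
-- and the sites s + 1 of the second are at least 1.
sites-unique : ∀ {m l} (r : Vector ℕ m) (s : Vector ℕ l) → StrictlyDecreasing r → StrictlyDecreasing s → Unique (sites (exponents r s))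
sites-unique r s dr ds = subst Unique (sym (sites-exponents r s)) (UniqueP.++⁺
  (UniqueP.tabulate⁺ (λ e → strictlyDecreasing⇒injective dr (ℤP.+-injective (ℤP.neg-injective e))))
  (UniqueP.tabulate⁺ (λ e → strictlyDecreasing⇒injective ds (ℕP.suc-injective (ℤP.+-injective e))))
  λ (v∈ , v∈') → let i , e = ∈P.∈-tabulate⁻ v∈
                     j , e' = ∈P.∈-tabulate⁻ v∈'
                 in disjoint (r i) (s j) (trans (sym e) e'))
  where
  disjoint : ∀ a b → lower-site a ≢ upper-site b
  disjoint zero b ()
  disjoint (suc a) b ()

sum-ι-lower : ∀ {m} (r : Vector ℕ m) → sum-ι (tabulate (lower-site ∘ r)) ≡ ℚ.- num (total r)
sum-ι-lower {zero} r = refl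
sum-ι-lower {suc m} r = trans (cong₂ ℚ._+_ (ι-lower (r Fin.zero)) (sum-ι-lower (Vector.tail r)))
  (trans (sym (ℚP.neg-distrib-+ (num (r Fin.zero)) (num (total (Vector.tail r))))) (cong (λ t → ℚ.- t) (sym (num-+ (r Fin.zero) (total (Vector.tail r))))))
  where
  ι-lower : ∀ a → ι (lower-site a) ≡ ℚ.- num a
  ι-lower zero = refl
  ι-lower (suc a) = ℚP.+-identityˡ _

sum-ι-upper : ∀ {l} (s : Vector ℕ l) → sum-ι (tabulate (upper-site ∘ s)) ≡ num (total s) ℚ.+ num l
sum-ι-upper {zero} s = refl
sum-ι-upper {suc l} s = trans (cong (ι (upper-site (s Fin.zero)) ℚ.+_) (sum-ι-upper (Vector.tail s)))
  (trans (solve 3 (λ a t l → a :+ con 1ℚ :- con 0ℚ :+ (t :+ l) := (a :+ t) :+ (l :+ con 1ℚ)) refl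
      (num (s Fin.zero)) (num (total (Vector.tail s))) (num l))
    (cong (ℚ._+ num (suc l)) (sym (num-+ (s Fin.zero) (total (Vector.tail s))))))

length-sites : ∀ {n} (e : Vector HalfInt n) → length (sites e) ≡ n
length-sites e = LP.length-tabulate (λ i → site (e i))

-- The sites add up to -r + s + (n - m). Subtracting this from n(n + 1)/4 leaves r - s + m + n(n -
-- 3)/4.
κ-sites : ∀ n m → m ℕ.≤ n → (r : Vector ℕ m) (s : Vector ℕ (n ℕ.∸ m)) →
  κ (sites (exponents r s)) ≡ (+ total r ℤ.- + total s ℤ.+ + m) / 1 ℚ.+ (+ n ℤ.* (+ n ℤ.- + 3)) / 4
κ-sites n m m≤n r s = trans (κ-closed X) (trans
  (cong₂ (λ t u → t ℚ.* (t ℚ.+ 1ℚ) ℚ.* (½ ℚ.* ½) ℚ.- u) (cong num length-X) sum-X)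
  (trans (arith (num (total r)) (num (total s)) (num m) (num l) ½ (num n) (trans (cong num (sym n≡m+l)) (num-+ m l)) refl)
    (sym (cong₂ ℚ._+_ k₁≡ k₂≡))))
  where
  l : ℕ
  l = n ℕ.∸ m
  X : List ℤ
  X = sites (exponents r s)
  n≡m+l : m ℕ.+ l ≡ n
  n≡m+l = ℕP.m+[n∸m]≡n m≤n
  length-X : length X ≡ n
  length-X = trans (length-sites (exponents r s)) n≡m+l
  sum-X : sum-ι X ≡ ℚ.- num (total r) ℚ.+ (num (total s) ℚ.+ num l)
  sum-X = trans (cong sum-ι (sites-exponents r s)) (trans (sum-ι-++ (tabulate (lower-site ∘ r)) _) (cong₂ ℚ._+_ (sum-ι-lower r) (sum-ι-upper s)))
  k₁≡ : (+ total r ℤ.- + total s ℤ.+ + m) / 1 ≡ num (total r) ℚ.- num (total s) ℚ.+ num m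
  k₁≡ = trans (/1-+ (+ total r ℤ.- + total s) (+ m)) (cong₂ ℚ._+_
    (trans (/1-+ (+ total r) (ℤ.- + total s)) (cong₂ ℚ._+_ (sym (+/1 (total r))) (trans (/1-neg (+ total s)) (cong (λ t → ℚ.- t) (sym (+/1 (total s)))))))
    (sym (+/1 m)))
  k₂≡ : (+ n ℤ.* (+ n ℤ.- + 3)) / 4 ≡ num n ℚ.* (num n ℚ.- (+ 3 / 1)) ℚ.* (½ ℚ.* ½)
  k₂≡ = trans (/-split (+ n) (+ n ℤ.- + 3) 3) (cong₂ (λ s t → s ℚ.* t ℚ.* (+ 1 / 4)) (sym (+/1 n))
    (trans (/1-+ (+ n) (ℤ.- + 3)) (cong (ℚ._+ (ℚ.- (+ 3 / 1))) (sym (+/1 n)))))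
  arith : ∀ R S M L k N → N ≡ M ℚ.+ L → k ℚ.+ k ≡ 1ℚ →
    N ℚ.* (N ℚ.+ 1ℚ) ℚ.* (k ℚ.* k) ℚ.- (ℚ.- R ℚ.+ (S ℚ.+ L)) ≡ R ℚ.- S ℚ.+ M ℚ.+ N ℚ.* (N ℚ.- (+ 3 / 1)) ℚ.* (k ℚ.* k)
  arith R S M L k N N≡ 2k = trans
    (solve 6 (λ R S M L k N → N :* (N :+ con 1ℚ) :* (k :* k) :- (:- R :+ (S :+ L))
      := R :- S :+ M :+ N :* (N :- con (+ 3 / 1)) :* (k :* k) :+ (N :* ((k :+ k) :* (k :+ k)) :- (M :+ L))) refl R S M L k N)
    (trans (cong₂ (λ t u → R ℚ.- S ℚ.+ M ℚ.+ N ℚ.* (N ℚ.- (+ 3 / 1)) ℚ.* (k ℚ.* k) ℚ.+ (N ℚ.* (t ℚ.* t) ℚ.- u)) 2k (sym N≡))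
      (solve 2 (λ s N → s :+ (N :* (con 1ℚ :* con 1ℚ) :- N) := s) refl (R ℚ.- S ℚ.+ M ℚ.+ N ℚ.* (N ℚ.- (+ 3 / 1)) ℚ.* (k ℚ.* k)) N))

½^ : ∀ n k → seq (fromℚ ½ ^ n) k ≡ half^ n
½^ zero k = refl
½^ (suc n) k = cong (ℚ._* ½) (½^ n k)

corollary1p3 : (n m : ℕ) → 1 ℕ.≤ n → m ℕ.≤ n →
    (r : Vector ℕ m) (s : Vector ℕ (n ℕ.∸ m)) →
    StrictlyDecreasing r → StrictlyDecreasing s →
    (∀ j k → neg ((+ r j) +½) ≢ (+ s k) +½) →
    Σ[ C ∈ ℝ ] Σ[ δ ∈ ℝ ] (0ℝ < δ ×
    (∀ (y : ℝ) → 0ℝ < y → y < δ →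
    Σ[ g ∈ ℂ ] (HasValue (G r s) (ofℝ (exp (- (fromℚ (+ 2 / 1) * π * y)))) g ×
    ∣ g -ᶜ ofℝ (fromℚ ½ ^ n *
    (1ℝ - π * (fromℚ ((+ total r ℤ.- + total s ℤ.+ + m) / 1)
    + fromℚ ((+ n ℤ.* (+ n ℤ.- + 3)) / 4)) * y))
    ∣≤ (C * (y * y)))))
corollary1p3 n m _ m≤n r s dr ds _ =
  -- The error is K z² with z = 2πy. As π is at most 4, y < 1/16 keeps z at most ½, which is the
  -- range where 1 - z + z² is at most 1 - z/2.
  fromℚ K * (2π * 2π) , fromℚ (+ 1 / 16) ,
  (+ 1 / 16 , 0<1/suc 15 , 0 , λ _ _ → ℚP.≤-reflexive (ℚP.+-identityˡ (+ 1 / 16))) ,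
  λ y 0<y y<δ →
    let D , z≡ , sums = SmallTemperature.thermal-gas y 0<y y<δ in
    ofℝ (Gas.p D X) , sum⇒hasValue (≗ᶜ-F (exponents r s)) (sums X) ,
    bd⇒disk {c = fromℚ K * (2π * 2π) * (y * y)} (≗ᴿ-sub (≗ᴿ-ofℝ (Gas.p D X)) (≗ᴿ-ofℝ (target y)))
      (bd-resp (sub-cong (≈-refl {Gas.p D X}) (≈-pt (first-order y (Gas.z D) z≡))) (≈-pt (second-order y (Gas.z D) z≡)) (O.bound (Jet.rest jet-X) D))
  where
  X : List ℤ
  X = sites (exponents r s)
  2π : ℝ
  2π = fromℚ (+ 2 / 1) * π
  jet-X : Jet (λ D → Gas.p D X) (half^ (length X)) (ℚ.- (half^ (length X) ℚ.* ½ ℚ.* κ X))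
  jet-X = expand X (sites-unique r s dr ds)
  K : ℚ
  K = O.C (Jet.rest jet-X)
  k₁ k₂ : ℚ
  k₁ = (+ total r ℤ.- + total s ℤ.+ + m) / 1
  k₂ = (+ n ℤ.* (+ n ℤ.- + 3)) / 4
  target : ℝ → ℝ
  target y = fromℚ ½ ^ n * (1ℝ - π * (fromℚ k₁ + fromℚ k₂) * y)
  half-X : ∀ i → half^ (length X) ≡ seq (fromℚ ½ ^ n) i
  half-X i = trans (cong half^ (trans (length-sites (exponents r s)) (ℕP.m+[n∸m]≡n m≤n))) (sym (½^ n i))
  -- Inserting z = 2πy turns the linear term -κ z/2 into -π κ y.
  first-order : ∀ y z → z ≡ 2π * y → ∀ i →
    seq (fromℚ (half^ (length X)) + fromℚ (ℚ.- (half^ (length X) ℚ.* ½ ℚ.* κ X)) * z) i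
    ≡ seq (target y) i
  first-order y _ refl i = trans (cong₂ (λ h c → h ℚ.+ (ℚ.- (h ℚ.* ½ ℚ.* c)) ℚ.* ((+ 2 / 1) ℚ.* seq π i ℚ.* seq y i)) (half-X i) (κ-sites n m m≤n r s))
    (trans (solve 6 (λ h k t c p y → h :+ (:- (h :* k :* c)) :* (t :* p :* y) := h :* (con 1ℚ :- p :* c :* y :* (k :* t))) refl
        (seq (fromℚ ½ ^ n) i) ½ (+ 2 / 1) (k₁ ℚ.+ k₂) (seq π i) (seq y i))
      (cong (λ t → seq (fromℚ ½ ^ n) i ℚ.* (1ℚ ℚ.- t)) (ℚP.*-identityʳ (seq π i ℚ.* (k₁ ℚ.+ k₂) ℚ.* seq y i))))
  second-order : ∀ y z → z ≡ 2π * y → ∀ i → seq (fromℚ K * z ^ 2) i ≡ seq (fromℚ K * (2π * 2π) * (y * y)) i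
  second-order y _ refl i = solve 3 (λ K t y → K :* (con 1ℚ :* (t :* y) :* (t :* y)) := K :* (t :* t) :* (y :* y)) refl K (seq 2π i) (seq y i)
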